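{- Let $P\subset\mathbb{R}^2$ be an arbitrary $2$-dimensional rational polygon. Then $|\mathrm{Q}_1(P,r)|\leq \mathrm{Q}_1(P,0)$ for all rational $0\leq r<\mathrm{q}(P)$.
   Context: For a rational polytope $P\subset\mathbb{R}^n$, let $\mathrm{G}_i(P,\cdot)$ be the unique periodic functions on $\mathbb{Z}_{\ge 0}$ with $\#(kP\cap\mathbb{Z}^n)=\sum_i\mathrm{G}_i(P,k)k^i$ for $k\in\mathbb{Z}_{\ge0}$. The rational Ehrhart coefficients are $\mathrm{Q}_i(P,a/b):=b^i\mathrm{G}_i(\tfrac1bP,a)$ for $a\in\mathbb{Z}_{\ge0}$, $b\in\mathbb{Z}_{>0}$; they are well defined, periodic, and $\#(rP\cap\mathbb{Z}^n)=\sum_i\mathrm{Q}_i(P,r)r^i$ for $r\in\mathbb{Q}_{\ge0}$. The rational denominator is $\mathrm{q}(P)=\min\{r\in\mathbb{Q}_{>0}: rP\text{ has all vertices in }\mathbb{Z}^n\}$. -}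

module Defs where

open import Data.Nat using (ℕ; zero; suc; NonZero)
open import Data.Integer using (ℤ; +_)
open import Data.Fin using (Fin; zero; suc)
open import Data.Product using (_×_; _,_; Σ; ∃; ∃-syntax; proj₁; proj₂)
open import Data.List using (List; length)
open import Data.List.Membership.Propositional using (_∈_)
open import Data.List.Relation.Unary.Unique.Propositional using (Unique)
open import Data.Rational using (ℚ; 0ℚ; 1ℚ; _+_; _*_; _-_; _≤_; _<_; _/_)
open import Relation.Binary.PropositionalEquality using (_≡_; _≢_)
open import Relation.Nullary using (¬_)
open import Function.Bundles using (_⇔_)

Pt : Set
Pt = ℚ × ℚ

sumFin : ∀ {m} → (Fin m → ℚ) → ℚ
sumFin {zero}  f = 0ℚ
sumFin {suc m} f = f zero + sumFin (λ i → f (suc i))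

ι : ℤ → ℚ
ι z = z / 1

ι² : ℤ × ℤ → Pt
ι² (x , y) = ι x , ι y

scalePt : ℚ → Pt → Pt
scalePt r (x , y) = r * x , r * y

scale : ∀ {m} → ℚ → (Fin m → Pt) → (Fin m → Pt)
scale r V i = scalePt r (V i)

IsConvexCoeffs : ∀ {m} → (Fin m → ℚ) → Set
IsConvexCoeffs {m} w = (∀ i → 0ℚ ≤ w i) × sumFin w ≡ 1ℚ

Combines : ∀ {m} → (Fin m → ℚ) → (Fin m → Pt) → Pt → Set
Combines w V x =
  (sumFin (λ i → w i * proj₁ (V i)) ≡ proj₁ x) ×
  (sumFin (λ i → w i * proj₂ (V i)) ≡ proj₂ x)

-- x lies in the convex hull conv{V_0,…,V_{m-1}}
-- (for rational x and rational V_i, rational coefficients suffice)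
InConv : ∀ {m} → (Fin m → Pt) → Pt → Set
InConv V x = ∃[ w ] (IsConvexCoeffs w × Combines w V x)

InConvExcept : ∀ {m} → (Fin m → Pt) → Fin m → Pt → Set
InConvExcept V i x = ∃[ w ] (IsConvexCoeffs w × (w i ≡ 0ℚ) × Combines w V x)

det : Pt → Pt → ℚ
det (a , b) (c , d) = a * d - b * c

sub : Pt → Pt → Pt
sub (a , b) (c , d) = a - c , b - d

-- V lists exactly the vertices of a 2-dimensional rational polygon P = conv V:
-- no V_i lies in the hull of the others, and P is not contained in a line.
IsRationalPolygon : ∀ {m} → (Fin m → Pt) → Set
IsRationalPolygon V =
  (∀ i → ¬ InConvExcept V i (V i)) ×
  (∃[ i ] ∃[ j ] ∃[ k ] det (sub (V j) (V i)) (sub (V k) (V i)) ≢ 0ℚ)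

LatticeCount : ∀ {m} → (Fin m → Pt) → ℕ → Set
LatticeCount V N =
  ∃[ L ] (Unique L × length L ≡ N × (∀ (z : ℤ × ℤ) → (z ∈ L) ⇔ InConv V (ι² z)))

IsLatticePt : Pt → Set
IsLatticePt x = ∃[ z ] ι² z ≡ x

IsRationalDenominator : ∀ {m} → (Fin m → Pt) → ℚ → Set
IsRationalDenominator V q =
  (0ℚ < q) × (∀ i → IsLatticePt (scalePt q (V i))) ×
  (∀ s → 0ℚ < s → (∀ i → IsLatticePt (scalePt s (V i))) → q ≤ s)

ℕtoℚ : ℕ → ℚ
ℕtoℚ n = + n / 1

-- G₀ G₁ G₂ are periodic functions on ℤ≥0 with
-- #(k·conv V ∩ ℤ²) = G₀(k) + G₁(k) k + G₂(k) k²   for all k ∈ ℤ≥0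
-- (i.e. they are G_0, G_1, G_2 of the polygon conv V; they are unique)
IsEhrhartQuasiPoly : ∀ {m} → (Fin m → Pt) → (ℕ → ℚ) → (ℕ → ℚ) → (ℕ → ℚ) → Set
IsEhrhartQuasiPoly V G₀ G₁ G₂ =
  (∃[ p ] (NonZero p × (∀ k → G₀ (k Data.Nat.+ p) ≡ G₀ k)
                     × (∀ k → G₁ (k Data.Nat.+ p) ≡ G₁ k)
                     × (∀ k → G₂ (k Data.Nat.+ p) ≡ G₂ k)))
  × (∀ k → ∃[ N ] (LatticeCount (scale (ℕtoℚ k) V) N ×
                   ℕtoℚ N ≡ G₀ k + G₁ k * ℕtoℚ k + G₂ k * (ℕtoℚ k * ℕtoℚ k)))

{-# OPTIONS --safe #-}
-- Count the lattice points of kP column by column.  Cut P by the vertical lines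
-- x = s / W, where W is a common denominator of the vertices: over each strip P
-- lies between two lines, and a column of kP contains ⌊t⌋ + ⌊b⌋ + 1 points, where
-- t and −b are the heights of its ends.  Writing ⌊t⌋ + 1/2 = t + (1/2 − {t}), the
-- terms t and b sum up to a quadratic polynomial in k, whose linear part telescopes
-- to the lengths of the vertical edges times 1/2 − {·}.  The sum of 1/2 − {gx + θ}
-- over a period of x is at most, in absolute value, its value at θ = 0.  Hence
-- #(kP ∩ ℤ²) = A k² + e(k) with |e(k)| ≤ c k + O(1), and e(k) ≥ c k − O(1) when k is a
-- multiple of some M.  For the polygon (1/b) P, the first bound along k ≡ a gives
-- |G₁(a)| ≤ c, and the second along multiples of b M gives b c ≤ H₁(0).

module Submission where

open import Defs
open import Data.Nat as ℕ using (ℕ; zero; suc; NonZero; _!)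
import Data.Nat.Properties as ℕP
import Data.Nat.DivMod as ℕD
import Data.Nat.Divisibility as ℕV
import Data.Nat.Tactic.RingSolver as ℕR
open import Data.Integer as ℤ using (ℤ; +_; -[1+_]; +≤+; +<+; 0ℤ; 1ℤ; -1ℤ)
import Data.Integer.Properties as ℤP
open import Data.Integer.DivMod using (_%ℕ_; _/ℕ_; n%ℕd<d; a≡a%ℕn+[a/ℕn]*n)
open import Data.Integer.Tactic.RingSolver using (solve-∀)
open import Algebra.Properties.AbelianGroup ℤP.+-0-abelianGroup using ()
  renaming (∙-cancelˡ to +-cancelˡ-≡; ∙-cancelʳ to +-cancelʳ-≡)
open import Data.Fin as Fin using (Fin; zero; suc)
open import Data.List using (List; []; _∷_; upTo; length; filter; map; allFin; cartesianProduct)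
open import Data.List.Properties using (length-map; length-upTo)
open import Data.List.Extrema ℤP.≤-totalOrder using (argmin; f[argmin]≤f[xs])
open import Data.List.Membership.Propositional using (_∈_)
open import Data.List.Membership.Propositional.Properties
  using (∈-upTo⁺; ∈-upTo⁻; ∈-filter⁺; ∈-filter⁻; ∈-map⁺; ∈-map⁻; ∈-allFin; ∈-cartesianProduct⁺)
open import Data.List.Membership.Propositional.Properties.WithK using (unique∧set⇒bag)
open import Data.List.Relation.Unary.Any using (here; there)
import Data.List.Relation.Unary.All as All
open import Data.List.Relation.Unary.Unique.Propositional using (Unique)
open import Data.List.Relation.Unary.Unique.Propositional.Properties using (filter⁺; map⁺; upTo⁺)
open import Data.List.Relation.Binary.BagAndSetEquality using (∼bag⇒↭)
open import Data.List.Relation.Binary.Permutation.Propositional.Properties using (↭-length)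
open import Data.Product using (_×_; _,_; ∃-syntax; proj₁; proj₂)
open import Data.Sum using (_⊎_; inj₁; inj₂)
open import Data.Unit using (⊤; tt)
open import Data.Empty using (⊥-elim)
open import Function.Bundles using (_⇔_; mk⇔; Equivalence)
open import Relation.Nullary using (yes; no)
open import Relation.Nullary.Decidable using (_×-dec_)
open import Relation.Unary using (Decidable)
open import Relation.Binary.PropositionalEquality
  using (_≡_; _≢_; refl; sym; trans; cong; cong₂; subst; subst₂; module ≡-Reasoning)

-- Everything up to the final comparison is done in integers: a statement about heights, widths or
-- areas is multiplied by the denominators occurring in it, inequalities take the form `0ℤ ≤ z`, and
-- the ring solver checks that z is a sum of products of nonnegative terms. The constants `E`, `W`,
-- `B` and `K` are these denominators. The obstacle is sharpness, since the slope c must not only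
-- bound e(k) but also be attained. For suitable k all sawtooth sums start at θ = 0 and both extreme
-- cuts fall on integer columns, so their terms reach the maximum together. At an inner cut,
-- however, the end terms of the two neighbouring slices have opposite signs; they have to be
-- cancelled before anything is estimated. The quasi-polynomials are given only by their periodicity
-- and their values, so their coefficients are reached through growth along a progression on which
-- they are constant.

module Integral where

  open import Data.Integer hiding (suc; +_; -[1+_]; +≤+; +<+; 0ℤ; 1ℤ; -1ℤ; ℤ)
  open import Data.Integer.Properties

  -- Inequalities between integers, certified by polynomial identities

  infixl 6 _⊕_
  infixl 7 _⊗_

  _⊕_ : ∀ {x y} → 0ℤ ≤ x → 0ℤ ≤ y → 0ℤ ≤ x + y
  p ⊕ q = +-mono-≤ p q

  _⊗_ : ∀ {x y} → 0ℤ ≤ x → 0ℤ ≤ y → 0ℤ ≤ x * y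
  _⊗_ {+ m} {+ n} _ _ = subst (0ℤ ≤_) (pos-* m n) (+≤+ ℕ.z≤n)

  nonneg : ∀ n → 0ℤ ≤ + n
  nonneg n = +≤+ ℕ.z≤n

  diff : ∀ {x y} → x ≤ y → 0ℤ ≤ y - x
  diff = i≤j⇒0≤j-i

  diff< : ∀ {x y} → x < y → 0ℤ ≤ y - x - 1ℤ
  diff< {x} {y} p = subst (0ℤ ≤_) (e x y) (diff (i<j⇒suc[i]≤j p))
    where
    e : ∀ x y → y - (1ℤ + x) ≡ y - x - 1ℤ
    e = solve-∀

  -- The shape of nearly every inequality proof below: the ring solver supplies an identity for the
  -- difference, and `_⊕_` and `_⊗_` build its right side from terms known to be nonnegative.
  ≤-from : ∀ {x y z} → y - x ≡ z → 0ℤ ≤ z → x ≤ y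
  ≤-from e p = 0≤i-j⇒j≤i (subst (0ℤ ≤_) (sym e) p)

  <-from : ∀ {x y z} → y - x - 1ℤ ≡ z → 0ℤ ≤ z → x < y
  <-from {x} {y} e p = suc[i]≤j⇒i<j (≤-from (trans (e' x y) e) p)
    where
    e' : ∀ x y → y - (1ℤ + x) ≡ y - x - 1ℤ
    e' = solve-∀

  -- Refutations have the same shape: nonnegative terms, usually including the negated goal, that
  -- add up to `-1ℤ`.
  absurd : ∀ {a} {A : Set a} {z} → z ≡ -1ℤ → 0ℤ ≤ z → A
  absurd refl ()

  1≤* : ∀ x y → 1ℤ ≤ x → 1ℤ ≤ y → 1ℤ ≤ x * y
  1≤* x y p q = ≤-from (id₁ x y) (diff p ⊗ diff q ⊕ diff p ⊕ diff q)
    where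
    id₁ : ∀ x y → x * y - 1ℤ ≡ (x - 1ℤ) * (y - 1ℤ) + (x - 1ℤ) + (y - 1ℤ)
    id₁ = solve-∀

  -- Finite sums

  sum< : ℕ → (ℕ → ℤ) → ℤ
  sum< zero    f = 0ℤ
  sum< (suc n) f = sum< n f + f n

  sum-cong : ∀ n {f g : ℕ → ℤ} → (∀ j → j ℕ.< n → f j ≡ g j) → sum< n f ≡ sum< n g
  sum-cong zero    h = refl
  sum-cong (suc n) h = cong₂ _+_ (sum-cong n λ j j<n → h j (ℕP.m<n⇒m<1+n j<n)) (h n ℕP.≤-refl)

  sum-mono : ∀ n {f g : ℕ → ℤ} → (∀ j → j ℕ.< n → f j ≤ g j) → sum< n f ≤ sum< n g
  sum-mono zero    h = ≤-refl
  sum-mono (suc n) h = +-mono-≤ (sum-mono n λ j j<n → h j (ℕP.m<n⇒m<1+n j<n)) (h n ℕP.≤-refl)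

  sum-+ : ∀ n (f g : ℕ → ℤ) → sum< n (λ j → f j + g j) ≡ sum< n f + sum< n g
  sum-+ zero    f g = refl
  sum-+ (suc n) f g = trans (cong (_+ (f n + g n)) (sum-+ n f g)) (e (sum< n f) (sum< n g) (f n) (g n))
    where
    e : ∀ a b c d → a + b + (c + d) ≡ a + c + (b + d)
    e = solve-∀

  sum-* : ∀ n c (f : ℕ → ℤ) → sum< n (λ j → c * f j) ≡ c * sum< n f
  sum-* zero    c f = sym (*-zeroʳ c)
  sum-* (suc n) c f = trans (cong (_+ c * f n) (sum-* n c f)) (sym (*-distribˡ-+ c (sum< n f) (f n)))

  sum-const : ∀ n c → sum< n (λ _ → c) ≡ + n * c
  sum-const zero    c = refl
  sum-const (suc n) c = trans (cong (_+ c) (sum-const n c)) (e (+ n) c)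
    where
    e : ∀ n c → n * c + c ≡ (1ℤ + n) * c
    e = solve-∀

  sum-append : ∀ m n (f : ℕ → ℤ) → sum< (m ℕ.+ n) f ≡ sum< m f + sum< n (λ j → f (m ℕ.+ j))
  sum-append m zero    f = trans (cong (λ x → sum< x f) (ℕP.+-identityʳ m)) (sym (+-identityʳ _))
  sum-append m (suc n) f = trans (cong (λ x → sum< x f) (ℕP.+-suc m n))
    (trans (cong (_+ f (m ℕ.+ n)) (sum-append m n f)) (+-assoc (sum< m f) _ _))

  sum-head : ∀ n (f : ℕ → ℤ) → sum< (suc n) f ≡ f 0 + sum< n (λ j → f (suc j))
  sum-head n f = trans (sum-append 1 n f) (cong (_+ sum< n (λ j → f (suc j))) (+-identityˡ (f 0)))

  sum-reverse : ∀ n (f g : ℕ → ℤ) → (∀ i j → suc (i ℕ.+ j) ≡ n → f i ≡ g j) → sum< n f ≡ sum< n g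
  sum-reverse zero    f g h = refl
  sum-reverse (suc n) f g h = begin
    sum< n f + f n                 ≡⟨ +-comm (sum< n f) (f n) ⟩
    f n + sum< n f                 ≡⟨ cong₂ _+_ (h n 0 (cong suc (ℕP.+-identityʳ n)))
                                        (sum-reverse n f (λ j → g (suc j)) λ i j e → h i (suc j)
                                            (trans (cong suc (ℕP.+-suc i j)) (cong suc e))) ⟩
    g 0 + sum< n (λ j → g (suc j)) ≡⟨ sum-head n g ⟨
    sum< (suc n) g                 ∎
    where open ≡-Reasoning

  sum-rotate : ∀ n (f : ℕ → ℤ) → (∀ j → f (n ℕ.+ j) ≡ f j) → ∀ m → sum< n (λ j → f (m ℕ.+ j)) ≡ sum< n f
  sum-rotate n f per m = +-cancelˡ-≡ (sum< m f) _ _ (begin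
    sum< m f + sum< n (λ j → f (m ℕ.+ j)) ≡⟨ sum-append m n f ⟨
    sum< (m ℕ.+ n) f                      ≡⟨ cong (λ x → sum< x f) (ℕP.+-comm m n) ⟩
    sum< (n ℕ.+ m) f                      ≡⟨ sum-append n m f ⟩
    sum< n f + sum< m (λ j → f (n ℕ.+ j)) ≡⟨ cong (λ x → sum< n f + x) (sum-cong m λ j _ → per j) ⟩
    sum< n f + sum< m f                   ≡⟨ +-comm (sum< n f) _ ⟩
    sum< m f + sum< n f                   ∎)
    where open ≡-Reasoning

  -- Residues of an arithmetic progression over one period

  module Residues (B : ℕ) .{{_ : ℕ.NonZero B}} where

    rem : ℤ → ℤ
    rem t = + (t %ℕ B)

    0≤rem : ∀ t → 0ℤ ≤ rem t
    0≤rem t = +≤+ ℕ.z≤n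

    rem< : ∀ t → rem t < + B
    rem< t = +<+ (n%ℕd<d t B)

    rem-eq : ∀ t → t ≡ rem t + (t /ℕ B) * + B
    rem-eq t = a≡a%ℕn+[a/ℕn]*n t B

    rem-≤ : ∀ {r r'} q q' → r < + B → 0ℤ ≤ r' → r + q * + B ≡ r' + q' * + B → q' ≤ q
    rem-≤ {r} {r'} q q' r<B 0≤r' e with q' ≤? q
    ... | yes p = p
    ... | no ¬p = absurd (trans (id₁ (+ B) r r' q q') (trans (cong (λ x → (x - (r' + q' * + B)) * -1ℤ - 1ℤ) e)
        (id₂ (r' + q' * + B))))
                    (diff< r<B ⊕ 0≤r' ⊕ (nonneg B ⊗ diff< (≰⇒> ¬p)))
      where
      id₁ : ∀ b r r' q q' → b - r - 1ℤ + r' + b * (q' - q - 1ℤ) ≡ (r + q * b - (r' + q' * b)) * -1ℤ - 1ℤ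
      id₁ = solve-∀
      id₂ : ∀ x → (x - x) * -1ℤ - 1ℤ ≡ -1ℤ
      id₂ = solve-∀

    rem-unique : ∀ {t r} q → 0ℤ ≤ r → r < + B → t ≡ r + q * + B → rem t ≡ r
    rem-unique {t} {r} q 0≤r r<B e = +-cancelʳ-≡ (q * + B) _ _
      (trans (cong (λ x → rem t + x * + B) (≤-antisym q≤ ≤q)) both)
      where
      both : rem t + (t /ℕ B) * + B ≡ r + q * + B
      both = trans (sym (rem-eq t)) e
      ≤q : t /ℕ B ≤ q
      ≤q = rem-≤ q (t /ℕ B) r<B (0≤rem t) (sym both)
      q≤ : q ≤ t /ℕ B
      q≤ = rem-≤ (t /ℕ B) q (rem< t) 0≤r both

    rem-cong : ∀ t t' q → t ≡ t' + q * + B → rem t ≡ rem t'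
    rem-cong t t' q e = rem-unique (q + t' /ℕ B) (0≤rem t') (rem< t')
      (trans e (trans (cong (_+ q * + B) (rem-eq t')) (id₁ (rem t') (t' /ℕ B) q (+ B))))
      where
      id₁ : ∀ r p q b → r + p * b + q * b ≡ r + (q + p) * b
      id₁ = solve-∀

    -- The reflection t ↦ -t - 1 reverses the residues 0, ..., B - 1 without the exceptional case at
    -- 0 that t ↦ -t would have.
    rem-complement : ∀ t → rem (- t - 1ℤ) ≡ + B - 1ℤ - rem t
    rem-complement t = rem-unique (- (t /ℕ B) - 1ℤ)
      (subst (0ℤ ≤_) (id₁ (+ B) (rem t)) (diff< (rem< t)))
      (<-from (id₂ (+ B) (rem t)) (0≤rem t))
      (trans (cong (λ x → - x - 1ℤ) (rem-eq t)) (id₃ (rem t) (t /ℕ B) (+ B)))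
      where
      id₁ : ∀ b r → b - r - 1ℤ ≡ b - 1ℤ - r
      id₁ = solve-∀
      id₂ : ∀ b r → b - (b - 1ℤ - r) - 1ℤ ≡ r
      id₂ = solve-∀
      id₃ : ∀ r q b → - (r + q * b) - 1ℤ ≡ b - 1ℤ - r + (- q - 1ℤ) * b
      id₃ = solve-∀

    remSum : ℤ → ℤ → ℤ
    remSum g θ = sum< B (λ j → rem (g * + j + θ))

    rem-periodic : ∀ g θ j → rem (g * + (B ℕ.+ j) + θ) ≡ rem (g * + j + θ)
    rem-periodic g θ j = rem-cong _ (g * + j + θ) g (id₁ g (+ B) (+ j) θ)
      where
      id₁ : ∀ g b j θ → g * (b + j) + θ ≡ g * j + θ + g * b
      id₁ = solve-∀

    -- Replacing x by x + m in gx + θ only rotates a full period.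
    remSum-shift : ∀ g θ m → remSum g (g * m + θ) ≡ remSum g θ
    remSum-shift g θ m = trans (sum-cong B λ j _ → step j)
                           (sum-rotate B (λ j → rem (g * + j + θ)) (rem-periodic g θ) (m %ℕ B))
      where
      id₁ : ∀ g j r q b θ → g * j + (g * (r + q * b) + θ) ≡ g * (r + j) + θ + g * q * b
      id₁ = solve-∀
      step : ∀ j → rem (g * + j + (g * m + θ)) ≡ rem (g * + (m %ℕ B ℕ.+ j) + θ)
      step j = rem-cong _ (g * + (m %ℕ B ℕ.+ j) + θ) (g * (m /ℕ B))
        (trans (cong (λ x → g * + j + (g * x + θ)) (rem-eq m)) (id₁ g (+ j) (rem m) (m /ℕ B) (+ B) θ))

    minRem : ∀ g θ → ∃[ m ] (∀ x → rem (g * m + θ) ≤ rem (g * x + θ))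
    minRem g θ = + m₀ , λ x → subst (f m₀ ≤_) (sym (step x))
        (All.lookup (f[argmin]≤f[xs] {f = f} 0 (upTo B)) (∈-upTo⁺ (n%ℕd<d x B)))
      where
      f : ℕ → ℤ
      f j = rem (g * + j + θ)
      m₀ = argmin f 0 (upTo B)
      id₁ : ∀ g r q b θ → g * (r + q * b) + θ ≡ g * r + θ + g * q * b
      id₁ = solve-∀
      step : ∀ x → rem (g * x + θ) ≡ f (x %ℕ B)
      step x = rem-cong _ (g * rem x + θ) (g * (x /ℕ B))
        (trans (cong (λ x → g * x + θ) (rem-eq x)) (id₁ g (rem x) (x /ℕ B) (+ B) θ))

    -- Adding to a multiple of g the smallest residue of the progression cannot
    -- wrap around, so the residues of gx + θ dominate those of gx termwise.
    remSum-min : ∀ g θ → remSum g 0ℤ ≤ remSum g θ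
    remSum-min g θ = subst (remSum g 0ℤ ≤_) (remSum-shift g θ m) (sum-mono B λ j _ → step (+ j))
      where
      m = proj₁ (minRem g θ)
      μ = rem (g * m + θ)
      id₀ : ∀ g j s → g * j + s ≡ s + (g * j + 0ℤ)
      id₀ = solve-∀
      id₁ : ∀ g j m θ → g * j + (g * m + θ) ≡ g * (m + j) + θ
      id₁ = solve-∀
      id₂ : ∀ μ ρ → μ + ρ - ρ ≡ μ
      id₂ = solve-∀
      id₃ : ∀ μ ρ b p q → μ + p * b + (ρ + q * b) ≡ μ + ρ + (p + q) * b
      id₃ = solve-∀
      id₄ : ∀ μ ρ b p q → μ + p * b + (ρ + q * b) ≡ μ + ρ - b + (p + q + 1ℤ) * b
      id₄ = solve-∀
      id₅ : ∀ μ ρ b → b - (μ + ρ - b) - 1ℤ ≡ b - μ - 1ℤ + (b - ρ - 1ℤ) + 1ℤ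
      id₅ = solve-∀
      id₆ : ∀ μ ρ b → b - ρ - 1ℤ + (μ + ρ - b - μ) ≡ -1ℤ
      id₆ = solve-∀
      step : ∀ j → rem (g * j + 0ℤ) ≤ rem (g * j + (g * m + θ))
      step j with μ + rem (g * j + 0ℤ) <? + B
      ... | yes small = ≤-from (trans (cong (_- ρ) (rem-unique (p + q) (0≤rem s ⊕ 0≤rem t) small split))
          (id₂ μ ρ)) (0≤rem s)
        where
        s = g * m + θ
        t = g * j + 0ℤ
        ρ = rem t
        p = s /ℕ B
        q = t /ℕ B
        split : g * j + s ≡ μ + ρ + (p + q) * + B
        split = trans (id₀ g j s) (trans (cong₂ _+_ (rem-eq s) (rem-eq t)) (id₃ μ ρ (+ B) p q))
      -- A wrap would make the residue at `m + j` equal to μ + ρ - B, which is below μ because ρ <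
      -- B; this contradicts the choice of `m`.
      ... | no large = absurd (id₆ μ ρ (+ B)) (diff< (rem< t) ⊕ diff (subst (μ ≤_) wrapped minimal))
        where
        s = g * m + θ
        t = g * j + 0ℤ
        ρ = rem t
        p = s /ℕ B
        q = t /ℕ B
        split : g * (m + j) + θ ≡ μ + ρ - + B + (p + q + 1ℤ) * + B
        split = trans (trans (sym (id₁ g j m θ)) (id₀ g j s)) (trans (cong₂ _+_ (rem-eq s) (rem-eq t))
            (id₄ μ ρ (+ B) p q))
        minimal : μ ≤ rem (g * (m + j) + θ)
        minimal = proj₂ (minRem g θ) (m + j)
        wrapped : rem (g * (m + j) + θ) ≡ μ + ρ - + B
        wrapped = rem-unique (p + q + 1ℤ) (diff (≮⇒≥ large))
          (<-from (id₅ μ ρ (+ B)) (diff< (rem< s) ⊕ diff< (rem< t) ⊕ nonneg 1)) split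

    -- Modulo B, -g i equals g (j + 1) when i + j + 1 = B; so reversing the period and shifting it
    -- by one step turns the slope -g into g.
    remSum-reverse : ∀ g → remSum (- g) 0ℤ ≡ remSum g 0ℤ
    remSum-reverse g = trans (sum-reverse B _ _ step) (remSum-shift g 0ℤ 1ℤ)
      where
      id₁ : ∀ g i j → - g * i + 0ℤ ≡ g * j + (g * 1ℤ + 0ℤ) + (- g) * (1ℤ + (i + j))
      id₁ = solve-∀
      step : ∀ i j → suc (i ℕ.+ j) ≡ B → rem (- g * + i + 0ℤ) ≡ rem (g * + j + (g * 1ℤ + 0ℤ))
      step i j e = rem-cong _ (g * + j + (g * 1ℤ + 0ℤ)) (- g)
          (trans (id₁ g (+ i) (+ j)) (cong (λ b → g * + j + (g * 1ℤ + 0ℤ) + (- g) * + b) e))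

    remSum-complement : ∀ g θ → remSum (- g) (- θ - 1ℤ) ≡ + B * (+ B - 1ℤ) - remSum g θ
    remSum-complement g θ = begin
      remSum (- g) (- θ - 1ℤ)                                            ≡⟨ sum-cong B (λ j _ → step (+ j)) ⟩
      sum< B (λ j → (+ B - 1ℤ) + -1ℤ * rem (g * + j + θ))                ≡⟨ sum-+ B _ _ ⟩
      sum< B (λ _ → + B - 1ℤ) + sum< B (λ j → -1ℤ * rem (g * + j + θ))   ≡⟨ cong₂ _+_ (sum-const B _)
          (sum-* B -1ℤ _) ⟩
      + B * (+ B - 1ℤ) + -1ℤ * remSum g θ                                ≡⟨ id₂ (+ B * (+ B - 1ℤ)) (remSum g θ) ⟩
      + B * (+ B - 1ℤ) - remSum g θ                                      ∎
      where
      open ≡-Reasoning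
      id₁ : ∀ g j θ → - g * j + (- θ - 1ℤ) ≡ - (g * j + θ) - 1ℤ
      id₁ = solve-∀
      id₂ : ∀ x y → x + -1ℤ * y ≡ x - y
      id₂ = solve-∀
      step : ∀ j → rem (- g * j + (- θ - 1ℤ)) ≡ (+ B - 1ℤ) + -1ℤ * rem (g * j + θ)
      step j = trans (cong rem (id₁ g j θ)) (trans (rem-complement (g * j + θ))
          (sym (id₂ (+ B - 1ℤ) (rem (g * j + θ)))))

    -- This is `remSum-min` for -g and the reflected offset. Weakening B (B - 1) to B² makes the
    -- resulting bounds on B² - 2 `remSum` symmetric about 0.
    remSum-max : ∀ g θ → remSum g θ + remSum g 0ℤ ≤ + B * + B
    remSum-max g θ = ≤-from (id₁ (+ B) (remSum g θ) (remSum g 0ℤ)) (diff lower ⊕ nonneg B)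
      where
      lower : remSum g 0ℤ ≤ + B * (+ B - 1ℤ) - remSum g θ
      lower = subst₂ _≤_ (remSum-reverse g) (remSum-complement g θ) (remSum-min (- g) (- θ - 1ℤ))
      id₁ : ∀ b x y → b * b - (x + y) ≡ b * (b - 1ℤ) - x - y + b
      id₁ = solve-∀

  -- Linear and sawtooth sums over an interval of columns

  sum-blocks : ∀ n {lo hi} (f : ℤ → ℤ) →
    (∀ x → lo ≤ sum< n (λ j → f (x + + j)) × sum< n (λ j → f (x + + j)) ≤ hi) →
    ∀ q x → + q * lo ≤ sum< (q ℕ.* n) (λ j → f (x + + j)) × sum< (q ℕ.* n) (λ j → f (x + + j)) ≤ + q * hi
  sum-blocks n f h zero    x = ≤-refl , ≤-refl
  sum-blocks n {lo} {hi} f h (suc q) x = subst₂ _≤_ (id₁ (+ q) lo) (sym split) (+-mono-≤ (proj₁ (h x)) (proj₁ rest))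
                                       , subst₂ _≤_ (sym split) (id₁ (+ q) hi) (+-mono-≤ (proj₂ (h x)) (proj₂ rest))
    where
    rest = sum-blocks n f h q (x + + n)
    id₁ : ∀ q c → c + q * c ≡ (1ℤ + q) * c
    id₁ = solve-∀
    split : sum< (n ℕ.+ q ℕ.* n) (λ j → f (x + + j)) ≡
            sum< n (λ j → f (x + + j)) + sum< (q ℕ.* n) (λ j → f (x + + n + + j))
    split = trans (sum-append n (q ℕ.* n) (λ j → f (x + + j)))
      (cong (λ y → sum< n (λ j → f (x + + j)) + y)
        (sum-cong (q ℕ.* n) λ j _ → cong f (sym (+-assoc x (+ n) (+ j)))))

  -- The factor 2 avoids the half in x (x - 1) / 2. As a polynomial in the two ends of the interval,
  -- the sum is ready for substituting the cutting lines.
  sum-linear : ∀ ℓ G D x → sum< ℓ (λ j → + 2 * (G * (x + + j) + D)) ≡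
    G * ((x + + ℓ) * (x + + ℓ - 1ℤ) - x * (x - 1ℤ)) + + 2 * D * + ℓ
  sum-linear zero    G D x = sym (id₁ G D x)
    where
    id₁ : ∀ G D x → G * ((x + 0ℤ) * (x + 0ℤ - 1ℤ) - x * (x - 1ℤ)) + + 2 * D * 0ℤ ≡ 0ℤ
    id₁ = solve-∀
  sum-linear (suc ℓ) G D x = trans (cong (_+ + 2 * (G * (x + + ℓ) + D)) (sum-linear ℓ G D x)) (id₁ G D x (+ ℓ))
    where
    id₁ : ∀ G D x ℓ → G * ((x + ℓ) * (x + ℓ - 1ℤ) - x * (x - 1ℤ)) + + 2 * D * ℓ + + 2 * (G * (x + ℓ) + D) ≡
      G * ((x + (1ℤ + ℓ)) * (x + (1ℤ + ℓ) - 1ℤ) - x * (x - 1ℤ)) + + 2 * D * (1ℤ + ℓ)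
    id₁ = solve-∀

  module Sawtooth (B : ℕ) .{{_ : ℕ.NonZero B}} where
    open Residues B public

    -- This is 2B (1/2 - {t / B}).
    saw : ℤ → ℤ
    saw t = + B - + 2 * rem t

    -B≤saw : ∀ t → - + B ≤ saw t
    -B≤saw t = ≤-from (id₁ (+ B) (rem t)) (nonneg 2 ⊗ (diff< (rem< t) ⊕ nonneg 1))
      where
      id₁ : ∀ b r → b - + 2 * r - - b ≡ + 2 * (b - r - 1ℤ + 1ℤ)
      id₁ = solve-∀

    saw≤B : ∀ t → saw t ≤ + B
    saw≤B t = ≤-from (id₁ (+ B) (rem t)) (nonneg 2 ⊗ 0≤rem t)
      where
      id₁ : ∀ b r → b - (b - + 2 * r) ≡ + 2 * r
      id₁ = solve-∀

    -- The sawtooth sum over one period at offset 0; its value is B · gcd (g, B).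
    peak : ℤ → ℤ
    peak g = + B * + B - + 2 * remSum g 0ℤ

    saw-block : ∀ g θ x → sum< B (λ j → saw (g * (x + + j) + θ)) ≡ + B * + B - + 2 * remSum g θ
    saw-block g θ x = begin
      sum< B (λ j → saw (g * (x + + j) + θ))
        ≡⟨ sum-cong B (λ j _ → trans (cong saw (id₁ g x (+ j) θ)) (id₂ (+ B) (rem (g * + j + (g * x + θ))))) ⟩
      sum< B (λ j → + B + - + 2 * rem (g * + j + (g * x + θ)))
        ≡⟨ sum-+ B _ _ ⟩
      sum< B (λ _ → + B) + sum< B (λ j → - + 2 * rem (g * + j + (g * x + θ)))
        ≡⟨ cong₂ _+_ (sum-const B (+ B)) (sum-* B (- + 2) _) ⟩
      + B * + B + - + 2 * remSum g (g * x + θ)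
        ≡⟨ cong (λ y → + B * + B + - + 2 * y) (remSum-shift g θ x) ⟩
      + B * + B + - + 2 * remSum g θ
        ≡⟨ id₃ (+ B) (remSum g θ) ⟩
      + B * + B - + 2 * remSum g θ ∎
      where
      open ≡-Reasoning
      id₁ : ∀ g x j θ → g * (x + j) + θ ≡ g * j + (g * x + θ)
      id₁ = solve-∀
      id₂ : ∀ b r → b - + 2 * r ≡ b + - + 2 * r
      id₂ = solve-∀
      id₃ : ∀ b r → b * b + - + 2 * r ≡ b * b - + 2 * r
      id₃ = solve-∀

    saw-block-bounds : ∀ g θ x → - peak g ≤ sum< B (λ j → saw (g * (x + + j) + θ)) ×
                                 sum< B (λ j → saw (g * (x + + j) + θ)) ≤ peak g
    saw-block-bounds g θ x rewrite saw-block g θ x =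
        ≤-from (id₁ (+ B) (remSum g 0ℤ) (remSum g θ)) (nonneg 2 ⊗ diff (remSum-max g θ))
      , ≤-from (id₂ (+ B) (remSum g 0ℤ) (remSum g θ)) (nonneg 2 ⊗ diff (remSum-min g θ))
      where
      id₁ : ∀ b r s → b * b - + 2 * s - - (b * b - + 2 * r) ≡ + 2 * (b * b - (s + r))
      id₁ = solve-∀
      id₂ : ∀ b r s → b * b - + 2 * r - (b * b - + 2 * s) ≡ + 2 * (s - r)
      id₂ = solve-∀

    saw-block-sharp : ∀ g q x → sum< B (λ j → saw (g * (x + + j) + q * + B)) ≡ peak g
    saw-block-sharp g q x = trans (saw-block g (q * + B) x)
      (cong (λ y → + B * + B - + 2 * y)
        (sum-cong B λ j _ → rem-cong _ (g * + j + 0ℤ) q (cong (_+ q * + B) (sym (+-identityʳ (g * + j))))))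

    0≤peak : ∀ g → 0ℤ ≤ peak g
    0≤peak g = *-cancelˡ-≤-pos 0ℤ (peak g) (+ 2) (≤-from (id₁ (peak g)) (diff (≤-trans (proj₁ b) (proj₂ b))))
      where
      b = saw-block-bounds g 0ℤ 0ℤ
      id₁ : ∀ p → + 2 * p - + 2 * 0ℤ ≡ p - - p
      id₁ = solve-∀

    module _ (g θ x : ℤ) (ℓ : ℕ) where

      sawSum : ℤ
      sawSum = sum< ℓ (λ j → saw (g * (x + + j) + θ))

      private
        f : ℤ → ℤ
        f y = saw (g * y + θ)
        q = ℓ ℕ./ B
        t = ℓ ℕ.% B
        ℓ-eq : + ℓ ≡ + t + + q * + B
        ℓ-eq = trans (cong +_ (ℕD.m≡m%n+[m/n]*n ℓ B)) (cong (λ y → + t + y) (pos-* q B))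
        t<B : + t < + B
        t<B = +<+ (ℕD.m%n<n ℓ B)

      -- The `t` terms that do not fill a period are split off first and cost at most B each, less
      -- than B² in all. Multiplying by B expresses the number of whole periods as ℓ - t without
      -- division and turns this error into B³.
      sawSum-between : ∀ {lo hi} → (∀ y → lo ≤ sum< B (λ j → f (y + + j)) × sum< B (λ j → f (y + + j)) ≤ hi) →
        (0ℤ ≤ + B * sawSum + + B * + B * + B - (+ ℓ - + t) * lo) ×
        (0ℤ ≤ (+ ℓ - + t) * hi + + B * + B * + B - + B * sawSum)
      sawSum-between {lo} {hi} h =
          subst (0ℤ ≤_) (trans (id₁ (+ B) (+ t) (+ q) lo S₁ S₂) (fix lo (λ S y → + B * S + + B * + B * + B - y)))
            (nonneg B ⊗ (diff (proj₁ small) ⊕ diff (proj₁ large)) ⊕ nonneg B ⊗ nonneg B ⊗ (diff< t<B ⊕ nonneg 1))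
        , subst (0ℤ ≤_) (trans (id₂ (+ B) (+ t) (+ q) hi S₁ S₂) (fix hi (λ S y → y + + B * + B * + B - + B * S)))
            (nonneg B ⊗ (diff (proj₂ small) ⊕ diff (proj₂ large)) ⊕ nonneg B ⊗ nonneg B ⊗ (diff< t<B ⊕ nonneg 1))
        where
        S₁ = sum< t (λ j → f (x + + j))
        S₂ = sum< (q ℕ.* B) (λ j → f (x + + t + + j))
        small : + t * - + B ≤ S₁ × S₁ ≤ + t * + B
        small = subst (_≤ S₁) (sum-const t (- + B)) (sum-mono t λ j _ → -B≤saw (g * (x + + j) + θ))
              , subst (S₁ ≤_) (sum-const t (+ B)) (sum-mono t λ j _ → saw≤B (g * (x + + j) + θ))
        large : + q * lo ≤ S₂ × S₂ ≤ + q * hi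
        large = sum-blocks B f h q (x + + t)
        split : sawSum ≡ S₁ + S₂
        split = trans (cong (λ y → sum< y (λ j → f (x + + j))) (ℕD.m≡m%n+[m/n]*n ℓ B))
          (trans (sum-append t (q ℕ.* B) (λ j → f (x + + j)))
            (cong (λ y → S₁ + y) (sum-cong (q ℕ.* B) λ j _ → cong f (sym (+-assoc x (+ t) (+ j))))))
        id₀ : ∀ t q b c → (t + q * b - t) * c ≡ b * q * c
        id₀ = solve-∀
        fix : ∀ c (F : ℤ → ℤ → ℤ) → F (S₁ + S₂) (+ B * + q * c) ≡ F sawSum ((+ ℓ - + t) * c)
        fix c F = cong₂ F (sym split) (sym (trans (cong (λ y → (y - + t) * c) ℓ-eq) (id₀ (+ t) (+ q) (+ B) c)))
        id₁ : ∀ b t q lo s₁ s₂ → b * (s₁ - t * - b + (s₂ - q * lo)) + b * b * (b - t - 1ℤ + 1ℤ) ≡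
          b * (s₁ + s₂) + b * b * b - b * q * lo
        id₁ = solve-∀
        id₂ : ∀ b t q hi s₁ s₂ → b * (t * b - s₁ + (q * hi - s₂)) + b * b * (b - t - 1ℤ + 1ℤ) ≡
          b * q * hi + b * b * b - b * (s₁ + s₂)
        id₂ = solve-∀

      sawSum-bounds : (0ℤ ≤ + ℓ * peak g + + B * + B * + B + + B * sawSum) ×
                      (0ℤ ≤ + ℓ * peak g + + B * + B * + B - + B * sawSum)
      sawSum-bounds =
          subst (0ℤ ≤_) (id₁ (+ B * sawSum) (+ B * + B * + B) (+ ℓ) (+ t) (peak g)) (proj₁ b ⊕ nonneg t ⊗ 0≤peak g)
        , subst (0ℤ ≤_) (id₂ (+ B * sawSum) (+ B * + B * + B) (+ ℓ) (+ t) (peak g)) (proj₂ b ⊕ nonneg t ⊗ 0≤peak g)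
        where
        b = sawSum-between (saw-block-bounds g θ)
        id₁ : ∀ s c ℓ t p → s + c - (ℓ - t) * - p + t * p ≡ ℓ * p + c + s
        id₁ = solve-∀
        id₂ : ∀ s c ℓ t p → (ℓ - t) * p + c - s + t * p ≡ ℓ * p + c - s
        id₂ = solve-∀

      -- If B divides θ, each whole period has sum exactly `peak g`; replacing ℓ - t by ℓ then costs
      -- at most B · `peak g`.
      sawSum-sharp : ∀ q' → θ ≡ q' * + B → 0ℤ ≤ + B * sawSum + + B * + B * + B + + B * peak g - + ℓ * peak g
      sawSum-sharp q' refl =
        subst (0ℤ ≤_) (id₁ (+ B * sawSum) (+ B * + B * + B) (+ ℓ) (+ t) (peak g) (+ B))
          (proj₁ (sawSum-between (λ y → ≤-reflexive (sym (saw-block-sharp g q' y)) , ≤-reflexive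
              (saw-block-sharp g q' y)))
            ⊕ (diff< t<B ⊕ nonneg 1) ⊗ 0≤peak g)
        where
        id₁ : ∀ s c ℓ t p b → s + c - (ℓ - t) * p + (b - t - 1ℤ + 1ℤ) * p ≡ s + c + b * p - ℓ * p
        id₁ = solve-∀

  -- Linear estimates, and the contribution of one slice

  module Estimates (B : ℕ) .{{_ : ℕ.NonZero B}} {I : Set} (k : I → ℤ) where

    -- f = O(k) with an explicit slope, which is attained up to O(1) when B divides k.
    record Est (f : I → ℤ) : Set where
      field
        slope offset : ℤ
        upper : ∀ i → 0ℤ ≤ slope * k i + offset - f i
        lower : ∀ i → 0ℤ ≤ slope * k i + offset + f i
        sharp : ∀ i → ∃[ q ] k i ≡ q * + B → 0ℤ ≤ f i + offset - slope * k i

    open Est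

    est-cong : ∀ {f g : I → ℤ} → (∀ i → f i ≡ g i) → Est f → Est g
    est-cong e F .slope  = F .slope
    est-cong e F .offset = F .offset
    est-cong e F .upper i = subst (λ y → 0ℤ ≤ F .slope * k i + F .offset - y) (e i) (F .upper i)
    est-cong e F .lower i = subst (λ y → 0ℤ ≤ F .slope * k i + F .offset + y) (e i) (F .lower i)
    est-cong e F .sharp i d = subst (λ y → 0ℤ ≤ y + F .offset - F .slope * k i) (e i) (F .sharp i d)

    est-+ : ∀ {f g : I → ℤ} → Est f → Est g → Est (λ i → f i + g i)
    est-+ F G .slope  = F .slope + G .slope
    est-+ F G .offset = F .offset + G .offset
    est-+ {f} {g} F G .upper i = subst (0ℤ ≤_) (id₁ (F .slope) (F .offset) (G .slope) (G .offset) (f i) (g i)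
        (k i)) (F .upper i ⊕ G .upper i)
      where
      id₁ : ∀ a b c d f g k → a * k + b - f + (c * k + d - g) ≡ (a + c) * k + (b + d) - (f + g)
      id₁ = solve-∀
    est-+ {f} {g} F G .lower i = subst (0ℤ ≤_) (id₁ (F .slope) (F .offset) (G .slope) (G .offset) (f i) (g i)
        (k i)) (F .lower i ⊕ G .lower i)
      where
      id₁ : ∀ a b c d f g k → a * k + b + f + (c * k + d + g) ≡ (a + c) * k + (b + d) + (f + g)
      id₁ = solve-∀
    est-+ {f} {g} F G .sharp i d = subst (0ℤ ≤_) (id₁ (F .slope) (F .offset) (G .slope) (G .offset) (f i) (g i)
        (k i)) (F .sharp i d ⊕ G .sharp i d)
      where
      id₁ : ∀ a b c d f g k → f + b - a * k + (g + d - c * k) ≡ f + g + (b + d) - (a + c) * k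
      id₁ = solve-∀

    est-bounded : ∀ (f : I → ℤ) C → (∀ i → - C ≤ f i) → (∀ i → f i ≤ C) → Est f
    est-bounded f C lo hi .slope  = 0ℤ
    est-bounded f C lo hi .offset = C
    est-bounded f C lo hi .upper i = subst (0ℤ ≤_) (id₁ C (f i) (k i)) (diff (hi i))
      where
      id₁ : ∀ C f k → C - f ≡ 0ℤ * k + C - f
      id₁ = solve-∀
    est-bounded f C lo hi .lower i = subst (0ℤ ≤_) (id₁ C (f i) (k i)) (diff (lo i))
      where
      id₁ : ∀ C f k → f - - C ≡ 0ℤ * k + C + f
      id₁ = solve-∀
    est-bounded f C lo hi .sharp i _ = subst (0ℤ ≤_) (id₁ C (f i) (k i)) (diff (lo i))
      where
      id₁ : ∀ C f k → f - - C ≡ f + C - 0ℤ * k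
      id₁ = solve-∀

    est-bounded-* : ∀ (f : I → ℤ) c C → (∀ i → - C ≤ f i) → (∀ i → f i ≤ C) → Est (λ i → c * f i)
    est-bounded-* f (+ n) C lo hi = est-bounded (λ i → + n * f i) (+ n * C)
      (λ i → ≤-from (id₁ (+ n) (f i) C) (nonneg n ⊗ diff (lo i)))
      (λ i → ≤-from (id₂ (+ n) (f i) C) (nonneg n ⊗ diff (hi i)))
      where
      id₁ : ∀ n f C → n * f - - (n * C) ≡ n * (f - - C)
      id₁ = solve-∀
      id₂ : ∀ n f C → n * C - n * f ≡ n * (C - f)
      id₂ = solve-∀
    est-bounded-* f -[1+ n ] C lo hi = est-bounded (λ i → -[1+ n ] * f i) (+ suc n * C)
      (λ i → ≤-from (id₁ (+ suc n) (f i) C) (nonneg (suc n) ⊗ diff (hi i)))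
      (λ i → ≤-from (id₂ (+ suc n) (f i) C) (nonneg (suc n) ⊗ diff (lo i)))
      where
      id₁ : ∀ n f C → - n * f - - (n * C) ≡ n * (C - f)
      id₁ = solve-∀
      id₂ : ∀ n f C → n * C - (- n) * f ≡ n * (f - - C)
      id₂ = solve-∀

    -- Abscissae are measured in units of 1 / W: the cuts lie at k s and k (s + 1), and `ρ`, `ρ'`
    -- are the distances from them to the first column of the slice and to the first column after
    -- it. They stay in [0, W], so terms containing them without a factor k are O(1).
    module SliceEstimate (W : ℕ)
      (ρ ρ' : I → ℤ)
      (0≤ρ : ∀ i → 0ℤ ≤ ρ i) (ρ≤W : ∀ i → ρ i ≤ + W)
      (0≤ρ' : ∀ i → 0ℤ ≤ ρ' i) (ρ'≤W : ∀ i → ρ' i ≤ + W)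
      (s : ℤ) (x : I → ℤ) (ℓ : I → ℕ)
      (left : ∀ i → + W * x i ≡ k i * s + ρ i)
      (right : ∀ i → + W * (x i + + ℓ i) ≡ k i * (1ℤ + s) + ρ' i) where

      open Sawtooth B

      width : ∀ i → + W * + ℓ i ≡ k i + ρ' i - ρ i
      width i = trans (id₁ (+ W) (x i) (+ ℓ i)) (trans (cong₂ _-_ (right i) (left i)) (id₂ (k i) s (ρ i) (ρ' i)))
        where
        id₁ : ∀ W x ℓ → W * ℓ ≡ W * (x + ℓ) - W * x
        id₁ = solve-∀
        id₂ : ∀ k s ρ ρ' → k * (1ℤ + s) + ρ' - (k * s + ρ) ≡ k + ρ' - ρ
        id₂ = solve-∀

      -- By `width`, W ℓ equals k up to W, so the factor W turns growth in ℓ into growth in k. In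
      -- the offset, W · `peak g` pays for this difference, W B³ for the incomplete period and W B ·
      -- `peak g` for the loss in `sawSum-sharp`.
      est-sawSum : ∀ g d → Est (λ i → + W * (+ B * sawSum g (k i * d) (x i) (ℓ i)))
      est-sawSum g d .slope  = peak g
      est-sawSum g d .offset = + W * peak g + + W * (+ B * + B * + B) + + W * (+ B * peak g)
      est-sawSum g d .upper i = subst (0ℤ ≤_)
        (trans (id₁ (+ W) (+ ℓ i) p S (+ B) (ρ i) (ρ' i))
            (trans (cong (λ y → (y + (ρ i + (+ W - ρ' i))) * p + + W * (+ B * + B * + B) + + W *
            (+ B * p) - + W * (+ B * S)) (width i)) (id₂ (+ W) (k i) p S (+ B) (ρ i) (ρ' i))))
        (nonneg W ⊗ proj₂ (sawSum-bounds g (k i * d) (x i) (ℓ i)) ⊕ (0≤ρ i ⊕ diff (ρ'≤W i)) ⊗ 0≤peak g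
            ⊕ nonneg W ⊗ (nonneg B ⊗ 0≤peak g))
        where
        p = peak g
        S = sawSum g (k i * d) (x i) (ℓ i)
        id₁ : ∀ W ℓ p S b ρ ρ' → W * (ℓ * p + b * b * b - b * S) + (ρ + (W - ρ')) * p + W * (b * p) ≡
          (W * ℓ + (ρ + (W - ρ'))) * p + W * (b * b * b) + W * (b * p) - W * (b * S)
        id₁ = solve-∀
        id₂ : ∀ W k p S b ρ ρ' → (k + ρ' - ρ + (ρ + (W - ρ'))) * p + W * (b * b * b) + W * (b * p) - W * (b * S) ≡
          p * k + (W * p + W * (b * b * b) + W * (b * p)) - W * (b * S)
        id₂ = solve-∀
      est-sawSum g d .lower i = subst (0ℤ ≤_)
        (trans (id₁ (+ W) (+ ℓ i) p S (+ B) (ρ i) (ρ' i))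
            (trans (cong (λ y → (y + (ρ i + (+ W - ρ' i))) * p + + W * (+ B * + B * + B) + + W *
            (+ B * p) + + W * (+ B * S)) (width i)) (id₂ (+ W) (k i) p S (+ B) (ρ i) (ρ' i))))
        (nonneg W ⊗ proj₁ (sawSum-bounds g (k i * d) (x i) (ℓ i)) ⊕ (0≤ρ i ⊕ diff (ρ'≤W i)) ⊗ 0≤peak g
            ⊕ nonneg W ⊗ (nonneg B ⊗ 0≤peak g))
        where
        p = peak g
        S = sawSum g (k i * d) (x i) (ℓ i)
        id₁ : ∀ W ℓ p S b ρ ρ' → W * (ℓ * p + b * b * b + b * S) + (ρ + (W - ρ')) * p + W * (b * p) ≡
          (W * ℓ + (ρ + (W - ρ'))) * p + W * (b * b * b) + W * (b * p) + W * (b * S)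
        id₁ = solve-∀
        id₂ : ∀ W k p S b ρ ρ' → (k + ρ' - ρ + (ρ + (W - ρ'))) * p + W * (b * b * b) + W * (b * p) + W * (b * S) ≡
          p * k + (W * p + W * (b * b * b) + W * (b * p)) + W * (b * S)
        id₂ = solve-∀
      est-sawSum g d .sharp i (q , k≡qB) = subst (0ℤ ≤_)
        (trans (id₁ (+ W) (+ ℓ i) p S (+ B) (ρ i) (ρ' i))
            (trans (cong (λ y → + W * (+ B * S) + + W * (+ B * + B * + B) + + W * (+ B * p) +
            (ρ' i + (+ W - ρ i) - y) * p) (width i)) (id₂ (+ W) (k i) p S (+ B) (ρ i) (ρ' i))))
        (nonneg W ⊗ sawSum-sharp g (k i * d) (x i) (ℓ i) (q * d) (trans (cong (_* d) k≡qB) (id₃ q (+ B) d))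
            ⊕ (0≤ρ' i ⊕ diff (ρ≤W i)) ⊗ 0≤peak g)
        where
        p = peak g
        S = sawSum g (k i * d) (x i) (ℓ i)
        id₁ : ∀ W ℓ p S b ρ ρ' → W * (b * S + b * b * b + b * p - ℓ * p) + (ρ' + (W - ρ)) * p ≡
          W * (b * S) + W * (b * b * b) + W * (b * p) + (ρ' + (W - ρ) - W * ℓ) * p
        id₁ = solve-∀
        id₂ : ∀ W k p S b ρ ρ' → W * (b * S) + W * (b * b * b) + W * (b * p) + (ρ' + (W - ρ) - (k + ρ' - ρ)) * p ≡
          W * (b * S) + (W * p + W * (b * b * b) + W * (b * p)) - p * k
        id₂ = solve-∀
        id₃ : ∀ q b d → q * b * d ≡ q * d * b
        id₃ = solve-∀

      -- The part of the quadratic sum free of k: with W x = k s + ρ, the term W² x (x - 1) leaves ρ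
      -- (ρ - W).
      est-corner : ∀ c → Est (λ i → c * (ρ' i * (ρ' i - + W) - ρ i * (ρ i - + W)))
      est-corner c = est-bounded-* (λ i → ρ' i * (ρ' i - + W) - ρ i * (ρ i - + W)) c (+ W * + W)
        (λ i → ≤-from (id₁ (ρ i) (ρ' i) (+ W)) (0≤ρ i ⊗ diff (ρ≤W i) ⊕ 0≤ρ' i ⊗ 0≤ρ' i ⊕ nonneg W ⊗ diff (ρ'≤W i)))
        (λ i → ≤-from (id₂ (ρ i) (ρ' i) (+ W)) (0≤ρ' i ⊗ diff (ρ'≤W i) ⊕ 0≤ρ i ⊗ 0≤ρ i ⊕ nonneg W ⊗ diff (ρ≤W i)))
        where
        id₁ : ∀ ρ ρ' W → ρ' * (ρ' - W) - ρ * (ρ - W) - - (W * W) ≡ ρ * (W - ρ) + ρ' * ρ' + W * (W - ρ')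
        id₁ = solve-∀
        id₂ : ∀ ρ ρ' W → W * W - (ρ' * (ρ' - W) - ρ * (ρ - W)) ≡ ρ' * (W - ρ') + ρ * ρ + W * (W - ρ)
        id₂ = solve-∀

      -- The last summand telescopes over consecutive slices, so that only the
      -- two ends of the polygon contribute to it.
      slice-est : ∀ γ g d g' d' → g + g' ≡ + W * γ → (col : I → ℤ → ℤ) →
        (∀ i j → j ℕ.< ℓ i → let y = x i + + j; t = g * y + k i * d; b = g' * y + k i * d' in
           + B * col i y ≡ t - rem t + (b - rem b) + + B) →
        Est (λ i → + 2 * + B * + B * + W * sum< (ℓ i) (λ j → col i (x i + + j))
                   - + B * (γ * (1ℤ + + 2 * s) + + 2 * (d + d')) * (k i * k i)
                   - + B * k i * ((γ * (1ℤ + s) + (d + d')) * (+ 2 * ρ' i - + W) - (γ * s + (d + d')) *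
                       (+ 2 * ρ i - + W)))
      slice-est γ g d g' d' slopes col col-eq =
        est-cong total (est-+ (est-corner (+ B * γ)) (est-+ (est-sawSum g d) (est-sawSum g' d')))
        where
        Δ = d + d'
        G = g + g'
        module _ (i : I) where
          K = k i
          X = x i
          L = ℓ i
          S₁ = sawSum g (K * d) X L
          S₂ = sawSum g' (K * d') X L
          S = sum< L (λ j → col i (X + + j))
          -- The 1 in ⌊t⌋ + ⌊b⌋ + 1 is shared equally by the two ends, which makes each floor a
          -- linear term plus a sawtooth.
          twice : ∀ b c t r t' r' → b * c ≡ t - r + (t' - r') + b → + 2 * b * c ≡ + 2 * (t + t') +
              ((b - + 2 * r) + (b - + 2 * r'))
          twice b c t r t' r' e = trans (*-assoc (+ 2) b c) (trans (cong (+ 2 *_) e) (id₁ b t r t' r'))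
            where
            id₁ : ∀ b t r t' r' → + 2 * (t - r + (t' - r') + b) ≡ + 2 * (t + t') + ((b - + 2 * r) + (b - + 2 * r'))
            id₁ = solve-∀
          collect : ∀ g g' y K d d' → g * y + K * d + (g' * y + K * d') ≡ (g + g') * y + K * (d + d')
          collect = solve-∀
          counted : + 2 * + B * S ≡ G * ((X + + L) * (X + + L - 1ℤ) - X * (X - 1ℤ)) + + 2 * (K * Δ) * + L + (S₁ + S₂)
          counted = begin
            + 2 * + B * S
              ≡⟨ sum-* L (+ 2 * + B) (λ j → col i (X + + j)) ⟨
            sum< L (λ j → + 2 * + B * col i (X + + j))
              ≡⟨ sum-cong L (λ j j<L → let y = X + + j in
                   trans (twice (+ B) (col i y) (g * y + K * d) (rem (g * y + K * d)) (g' * y + K * d')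
                       (rem (g' * y + K * d')) (col-eq i j j<L))
                     (cong (λ z → + 2 * z + (saw (g * y + K * d) + saw (g' * y + K * d'))) (collect g g' y K d d'))) ⟩
            sum< L (λ j → + 2 * (G * (X + + j) + K * Δ) + (saw (g * (X + + j) + K * d) + saw
                (g' * (X + + j) + K * d')))
              ≡⟨ sum-+ L _ _ ⟩
            sum< L (λ j → + 2 * (G * (X + + j) + K * Δ)) + sum< L (λ j → saw (g * (X + + j) + K * d) + saw
                (g' * (X + + j) + K * d'))
              ≡⟨ cong₂ _+_ (sum-linear L G (K * Δ) X) (sum-+ L _ _) ⟩
            G * ((X + + L) * (X + + L - 1ℤ) - X * (X - 1ℤ)) + + 2 * (K * Δ) * + L + (S₁ + S₂) ∎
            where open ≡-Reasoning
          -- Once the cuts are substituted for the ends, `area` is a polynomial in K; `quadratic`,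
          -- `linear` and `corner` are its terms of degree two, one and zero.
          corner : ℤ
          corner = + B * γ * (ρ' i * (ρ' i - + W) - ρ i * (ρ i - + W))
          quadratic linear : ℤ
          quadratic = + B * (γ * (1ℤ + + 2 * s) + + 2 * Δ) * (K * K)
          linear = + B * K * ((γ * (1ℤ + s) + Δ) * (+ 2 * ρ' i - + W) - (γ * s + Δ) * (+ 2 * ρ i - + W))
          area : ℤ → ℤ → ℤ
          area P Q = + B * (γ * (Q * (Q - + W) - P * (P - + W)) + + 2 * (K * Δ) * (Q - P))
          scaled : + 2 * + B * + B * + W * S ≡ area (K * s + ρ i) (K * (1ℤ + s) + ρ' i) + + W *
              (+ B * S₁) + + W * (+ B * S₂)
          scaled = begin
            + 2 * + B * + B * + W * S
              ≡⟨ id₁ (+ B) (+ W) S ⟩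
            + B * + W * (+ 2 * + B * S)
              ≡⟨ cong (+ B * + W *_) counted ⟩
            + B * + W * (G * ((X + + L) * (X + + L - 1ℤ) - X * (X - 1ℤ)) + + 2 * (K * Δ) * + L + (S₁ + S₂))
              ≡⟨ cong (λ y → + B * + W * (y * ((X + + L) * (X + + L - 1ℤ) - X * (X - 1ℤ)) + + 2 *
                  (K * Δ) * + L + (S₁ + S₂))) slopes ⟩
            + B * + W * (+ W * γ * ((X + + L) * (X + + L - 1ℤ) - X * (X - 1ℤ)) + + 2 * (K * Δ) * + L + (S₁ + S₂))
              ≡⟨ id₂ (+ B) (+ W) γ X (+ L) (K * Δ) S₁ S₂ ⟩
            area (+ W * X) (+ W * (X + + L)) + + W * (+ B * S₁) + + W * (+ B * S₂)
              ≡⟨ cong₂ (λ P Q → area P Q + + W * (+ B * S₁) + + W * (+ B * S₂)) (left i) (right i) ⟩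
            area (K * s + ρ i) (K * (1ℤ + s) + ρ' i) + + W * (+ B * S₁) + + W * (+ B * S₂) ∎
            where
            open ≡-Reasoning
            id₁ : ∀ b w s → + 2 * b * b * w * s ≡ b * w * (+ 2 * b * s)
            id₁ = solve-∀
            id₂ : ∀ b w γ x ℓ e s₁ s₂ → b * w * (w * γ * ((x + ℓ) * (x + ℓ - 1ℤ) - x * (x - 1ℤ)) + + 2 * e * ℓ +
                (s₁ + s₂)) ≡
              b * (γ * ((w * (x + ℓ)) * (w * (x + ℓ) - w) - w * x * (w * x - w)) + + 2 * e *
                  (w * (x + ℓ) - w * x)) + w * (b * s₁) + w * (b * s₂)
            id₂ = solve-∀
          total : corner + (+ W * (+ B * S₁) + + W * (+ B * S₂)) ≡ + 2 * + B * + B * + W * S - quadratic - linear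
          total = trans (id₁ (+ B) (+ W) γ K s (ρ i) (ρ' i) Δ (+ W * (+ B * S₁)) (+ W * (+ B * S₂)))
                    (cong (λ y → y - quadratic - linear) (sym scaled))
            where
            id₁ : ∀ b w γ k s ρ ρ' Δ u v → b * γ * (ρ' * (ρ' - w) - ρ * (ρ - w)) + (u + v) ≡
              b * (γ * ((k * (1ℤ + s) + ρ') * (k * (1ℤ + s) + ρ' - w) - (k * s + ρ) * (k * s + ρ - w)) + + 2 *
                  (k * Δ) * (k * (1ℤ + s) + ρ' - (k * s + ρ))) + u + v
              - b * (γ * (1ℤ + + 2 * s) + + 2 * Δ) * (k * k)
              - b * k * ((γ * (1ℤ + s) + Δ) * (+ 2 * ρ' - w) - (γ * s + Δ) * (+ 2 * ρ - w))
            id₁ = solve-∀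

  -- Counting lattice points by columns

  sum-zero : ∀ n {f : ℕ → ℤ} → (∀ j → j ℕ.< n → f j ≡ 0ℤ) → sum< n f ≡ 0ℤ
  sum-zero n h = trans (sum-cong n h) (trans (sum-const n 0ℤ) (*-zeroʳ (+ n)))

  sum-single : ∀ n m {f : ℕ → ℤ} → m ℕ.< n → f m ≡ 1ℤ → (∀ j → j ≢ m → f j ≡ 0ℤ) → sum< n f ≡ 1ℤ
  sum-single (suc n) m m<n one zeros with m ℕ.≟ n
  ... | yes refl = cong₂ _+_ (sum-zero n λ j j<n → zeros j (ℕP.<⇒≢ j<n)) one
  ... | no m≢n   = cong₂ _+_ (sum-single n m (ℕP.≤∧≢⇒< (ℕP.≤-pred m<n) m≢n) one zeros) (zeros n (λ e → m≢n (sym e)))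

  inColumn : ℤ → List (ℤ × ℤ) → List (ℤ × ℤ)
  inColumn x = filter (λ z → proj₁ z ≟ x)

  column : List (ℤ × ℤ) → ℤ → ℤ
  column L x = + length (inColumn x L)

  private
    isIn : ℤ × ℤ → ℤ → ℤ
    isIn z x = column (z ∷ []) x

    isIn-yes : ∀ z x → proj₁ z ≡ x → isIn z x ≡ 1ℤ
    isIn-yes z x e with proj₁ z ≟ x
    ... | yes _ = refl
    ... | no ¬e = ⊥-elim (¬e e)

    isIn-no : ∀ z x → proj₁ z ≢ x → isIn z x ≡ 0ℤ
    isIn-no z x ¬e with proj₁ z ≟ x
    ... | yes e = ⊥-elim (¬e e)
    ... | no _  = refl

    column-∷ : ∀ z L x → column (z ∷ L) x ≡ isIn z x + column L x
    column-∷ z L x with proj₁ z ≟ x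
    ... | yes _ = refl
    ... | no _  = sym (+-identityˡ _)

  length-by-columns : ∀ L n x → (∀ z → z ∈ L → ∃[ j ] j ℕ.< n × proj₁ z ≡ x + + j) →
    + length L ≡ sum< n (λ j → column L (x + + j))
  length-by-columns [] n x h = sym (sum-zero n (λ _ _ → refl))
  length-by-columns (z ∷ L) n x h with h z (here refl)
  ... | m , m<n , e = sym (begin
    sum< n (λ j → column (z ∷ L) (x + + j))                        ≡⟨ sum-cong n (λ j _ → column-∷ z L (x + + j)) ⟩
    sum< n (λ j → isIn z (x + + j) + column L (x + + j))           ≡⟨ sum-+ n _ _ ⟩
    sum< n (λ j → isIn z (x + + j)) + sum< n (λ j → column L (x + + j))
      ≡⟨ cong₂ _+_ (sum-single n m m<n (isIn-yes z _ e)
                      λ j j≢m → isIn-no z _ λ e' → j≢m (+-injective (+-cancelˡ-≡ x _ _ (trans (sym e') e))))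
                   (sym (length-by-columns L n x λ z' z'∈L → h z' (there z'∈L))) ⟩
    + length (z ∷ L) ∎)
    where
    open ≡-Reasoning

  module ColumnCount (B : ℕ) .{{_ : ℕ.NonZero B}} where
    open Residues B

    column-count : ∀ L x t b → Unique L → 0ℤ ≤ t + b →
      (∀ y → (x , y) ∈ L ⇔ (+ B * y ≤ t × - (+ B * y) ≤ b)) →
      + B * column L x ≡ t - rem t + (b - rem b) + + B
    column-count L x t b unique 0≤t+b member = trans (cong (λ y → + B * y) length≡c) counted
      where
      p = t /ℕ B
      q = b /ℕ B
      c = ∣ p + q + 1ℤ ∣

      t-eq : t - rem t ≡ + B * p
      t-eq = trans (cong (_- rem t) (rem-eq t)) (id₁ (rem t) p (+ B))
        where
        id₁ : ∀ r p b → r + p * b - r ≡ b * p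
        id₁ = solve-∀
      b-eq : b - rem b ≡ + B * q
      b-eq = trans (cong (_- rem b) (rem-eq b)) (id₁ (rem b) q (+ B))
        where
        id₁ : ∀ r p b → r + p * b - r ≡ b * p
        id₁ = solve-∀

      -- B times a floor lies less than B below its argument, so 0 ≤ t + b forces p + q ≥ -1.
      -- Equality means a column that crosses the polygon between lattice points, which the formula
      -- counts as 0.
      0≤p+q+1 : 0ℤ ≤ p + q + 1ℤ
      0≤p+q+1 with 0ℤ ≤? p + q + 1ℤ
      ... | yes h = h
      ... | no ¬h = absurd (trans
          (cong₂ (λ u v → u + v + ((+ B - rem t - 1ℤ) + (+ B - rem b - 1ℤ) + 1ℤ + + B *
          (0ℤ - (p + q + 1ℤ) - 1ℤ))) (rem-eq t) (rem-eq b)) (id₁ (rem t) (rem b) p q (+ B)))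
          (0≤t+b ⊕ (diff< (rem< t) ⊕ diff< (rem< b) ⊕ nonneg 1 ⊕ nonneg B ⊗ diff< (≰⇒> ¬h)))
        where
        id₁ : ∀ r s p q b → r + p * b + (s + q * b) + ((b - r - 1ℤ) + (b - s - 1ℤ) + 1ℤ + b *
            (0ℤ - (p + q + 1ℤ) - 1ℤ)) ≡ -1ℤ
        id₁ = solve-∀

      c-eq : + c ≡ p + q + 1ℤ
      c-eq = 0≤i⇒+∣i∣≡i 0≤p+q+1

      counted : + B * + c ≡ t - rem t + (b - rem b) + + B
      counted = trans (cong (λ y → + B * y) c-eq)
          (trans (id₁ (+ B) p q) (sym (cong₂ (λ u v → u + v + + B) t-eq b-eq)))
        where
        id₁ : ∀ b p q → b * (p + q + 1ℤ) ≡ b * p + b * q + b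
        id₁ = solve-∀

      point : ℕ → ℤ × ℤ
      point j = x , - q + + j
      points = map point (upTo c)

      below : ∀ {y} t → + B * y ≤ t → y ≤ t /ℕ B
      below {y} t h with y ≤? t /ℕ B
      ... | yes p = p
      ... | no ¬p = absurd (trans (cong (λ u → u - + B * y + (+ B - rem t - 1ℤ + + B * (y - t /ℕ B - 1ℤ)))
          (rem-eq t)) (id₁ (rem t) (t /ℕ B) y (+ B)))
                      (diff h ⊕ (diff< (rem< t) ⊕ nonneg B ⊗ diff< (≰⇒> ¬p)))
        where
        id₁ : ∀ r p y b → r + p * b - b * y + (b - r - 1ℤ + b * (y - p - 1ℤ)) ≡ -1ℤ
        id₁ = solve-∀

      above : ∀ {y} t → y ≤ t /ℕ B → + B * y ≤ t
      above {y} t h = ≤-from (trans (cong (_- + B * y) (rem-eq t)) (id₁ (rem t) (t /ℕ B) y (+ B)))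
          (0≤rem t ⊕ nonneg B ⊗ diff h)
        where
        id₁ : ∀ r p y b → r + p * b - b * y ≡ r + b * (p - y)
        id₁ = solve-∀

      to : ∀ {z} → z ∈ points → z ∈ inColumn x L
      to z∈ with ∈-map⁻ point z∈
      ... | j , j∈ , refl = ∈-filter⁺ (λ z → proj₁ z ≟ x)
          (Equivalence.from (member (- q + + j))
              (above t y≤p , subst (_≤ b) (sym (neg-distribʳ-* (+ B) (- q + + j))) (above b -y≤q))) refl
        where
        j<c : + j < p + q + 1ℤ
        j<c = subst (+ j <_) c-eq (+<+ (∈-upTo⁻ j∈))
        y≤p : - q + + j ≤ p
        y≤p = ≤-from (id₁ p q (+ j)) (diff< j<c)
          where
          id₁ : ∀ p q j → p - (- q + j) ≡ p + q + 1ℤ - j - 1ℤ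
          id₁ = solve-∀
        -y≤q : - (- q + + j) ≤ q
        -y≤q = ≤-from (id₁ q (+ j)) (nonneg j)
          where
          id₁ : ∀ q j → q - - (- q + j) ≡ j
          id₁ = solve-∀

      from : ∀ {z} → z ∈ inColumn x L → z ∈ points
      from {z} z∈ with ∈-filter⁻ (λ z → proj₁ z ≟ x) {v = z} {xs = L} z∈
      from {_ , y} z∈ | z∈L , refl = subst (_∈ points)
          (cong (x ,_) (trans (cong (λ u → - q + u) j-eq) (id₁ q y))) (∈-map⁺ point (∈-upTo⁺ j<c))
        where
        bounds = Equivalence.to (member y) z∈L
        -y≤q : - y ≤ q
        -y≤q = below b (subst (_≤ b) (neg-distribʳ-* (+ B) y) (proj₂ bounds))
        j = ∣ y + q ∣
        j-eq : + j ≡ y + q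
        j-eq = 0≤i⇒+∣i∣≡i (subst (0ℤ ≤_) (id₂ q y) (diff -y≤q))
          where
          id₂ : ∀ q y → q - - y ≡ y + q
          id₂ = solve-∀
        id₁ : ∀ q y → - q + (y + q) ≡ y
        id₁ = solve-∀
        j<c : j ℕ.< c
        j<c = drop‿+<+ (subst₂ _<_ (sym j-eq) (sym c-eq) (<-from (id₃ p q y) (diff (below t (proj₁ bounds)))))
          where
          id₃ : ∀ p q y → p + q + 1ℤ - (y + q) - 1ℤ ≡ p - y
          id₃ = solve-∀

      point-injective : ∀ {i j} → point i ≡ point j → i ≡ j
      point-injective e = +-injective (+-cancelˡ-≡ (- q) _ _ (cong proj₂ e))

      length≡c : column L x ≡ + c
      length≡c = cong +_ (trans
        (↭-length (∼bag⇒↭ (unique∧set⇒bag (filter⁺ (λ z → proj₁ z ≟ x) unique) (map⁺ point-injective (upTo⁺ c))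
            (mk⇔ from to))))
        (trans (length-map point (upTo c)) (length-upTo c)))

  -- Assembling the slices

  -- Over the strip lo + s ≤ W x / k ≤ lo + s + 1 the k-th dilate lies between the lines
  -- E W y = g s W x + k d s (above) and − E W y = g' s W x + k d' s (below).
  record Sliced (W E n : ℕ) (InP : ℤ → ℤ → ℤ → Set) : Set where
    field
      lo : ℤ
      g d g' d' : ℕ → ℤ
      range : ∀ k x y → 1ℤ ≤ k → InP k x y → k * lo ≤ + W * x × + W * x ≤ k * (lo + + n)
      slice : ∀ s k x y → s ℕ.< n → 1ℤ ≤ k → k * (lo + + s) ≤ + W * x → + W * x ≤ k * (lo + + suc s) →
        InP k x y ⇔ (+ (E ℕ.* W) * y ≤ g s * + W * x + k * d s × - (+ (E ℕ.* W) * y) ≤ g' s * + W * x + k * d' s)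
      thick : ∀ s k x → s ℕ.< n → 1ℤ ≤ k → k * (lo + + s) ≤ + W * x → + W * x ≤ k * (lo + + suc s) →
        0ℤ ≤ g s * + W * x + k * d s + (g' s * + W * x + k * d' s)

  module SlicedCount (W E n' : ℕ) .{{_ : ℕ.NonZero W}} .{{_ : ℕ.NonZero E}} .{{_ : ℕ.NonZero (E ℕ.* W)}}
    {InP : ℤ → ℤ → ℤ → Set} (sliced : Sliced W E (suc n') InP) where

    open Sliced sliced

    n B : ℕ
    n = suc n'
    B = E ℕ.* W

    B-eq : + B ≡ + E * + W
    B-eq = pos-* E W

    place : ℕ → ℤ
    place s = lo + + s

    place-suc : ∀ s → 1ℤ + place s ≡ place (suc s)
    place-suc s = id₁ lo (+ s)
      where
      id₁ : ∀ l s → 1ℤ + (l + s) ≡ l + (1ℤ + s)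
      id₁ = solve-∀

    γ Δ : ℕ → ℤ
    γ s = g s + g' s
    Δ s = d s + d' s

    1≤W : 1ℤ ≤ + W
    1≤W = +≤+ (ℕ.>-nonZero⁻¹ W)

    1≤B : 1ℤ ≤ + B
    1≤B = +≤+ (ℕ.>-nonZero⁻¹ B)

    private
      -- Dilating by B and taking the column E σ puts the abscissa σ / W of the polygon on a lattice
      -- column, since W E σ = B σ, and makes the ends g σ + d and -(g' σ + d') of the segment over
      -- it integral. Lattice points then determine this segment exactly.
      module AtPosition (s : ℕ) (s<n : s ℕ.< n) (σ : ℤ) (s≤σ : place s ≤ σ) (σ≤s : σ ≤ place (suc s)) where
        left : + B * place s ≤ + W * (+ E * σ)
        left = ≤-from (trans (cong (λ b → + W * (+ E * σ) - b * place s) B-eq) (id₁ (+ W) (+ E) σ (place s)))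
            (nonneg W ⊗ (nonneg E ⊗ diff s≤σ))
          where
          id₁ : ∀ w e σ s → w * (e * σ) - e * w * s ≡ w * (e * (σ - s))
          id₁ = solve-∀
        right : + W * (+ E * σ) ≤ + B * place (suc s)
        right = ≤-from (trans (cong (λ b → b * place (suc s) - + W * (+ E * σ)) B-eq)
            (id₁ (+ W) (+ E) σ (place (suc s)))) (nonneg W ⊗ (nonneg E ⊗ diff σ≤s))
          where
          id₁ : ∀ w e σ s → e * w * s - w * (e * σ) ≡ w * (e * (s - σ))
          id₁ = solve-∀
        rescale : ∀ a c → a * + W * (+ E * σ) + + B * c ≡ + B * (a * σ + c)
        rescale a c = trans (cong (λ b → a * + W * (+ E * σ) + b * c) B-eq) (trans (id₁ a c (+ W) (+ E) σ)
            (cong (_* (a * σ + c)) (sym B-eq)))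
          where
          id₁ : ∀ a c w e σ → a * w * (e * σ) + e * w * c ≡ e * w * (a * σ + c)
          id₁ = solve-∀
        cancelB : ∀ u v → + B * u ≤ + B * v → u ≤ v
        cancelB u v = *-cancelˡ-≤-pos u v (+ B) {{positive (<-≤-trans (+<+ (ℕ.s≤s ℕ.z≤n)) 1≤B)}}
        thick-at : 0ℤ ≤ γ s * σ + Δ s
        thick-at = cancelB 0ℤ (γ s * σ + Δ s) (subst₂ _≤_ (sym (*-zeroʳ (+ B)))
          (trans (cong₂ _+_ (rescale (g s) (d s)) (rescale (g' s) (d' s))) (id₁ (+ B) (g s) (g' s) (d s) (d' s) σ))
          (thick s (+ B) (+ E * σ) s<n 1≤B left right))
          where
          id₁ : ∀ b g g' d d' σ → b * (g * σ + d) + b * (g' * σ + d') ≡ b * ((g + g') * σ + (d + d'))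
          id₁ = solve-∀
        slice-at : ∀ y → InP (+ B) (+ E * σ) y ⇔ (y ≤ g s * σ + d s × - y ≤ g' s * σ + d' s)
        slice-at y = mk⇔
          (λ p → let (t , b) = Equivalence.to onSlice p in
             cancelB y (g s * σ + d s) (subst (λ z → + B * y ≤ z) (rescale (g s) (d s)) t) ,
             cancelB (- y) (g' s * σ + d' s) (subst₂ _≤_ (neg-distribʳ-* (+ B) y) (rescale (g' s) (d' s)) b))
          (λ (t , b) → Equivalence.from onSlice
             ( subst (+ B * y ≤_) (sym (rescale (g s) (d s))) (*-monoˡ-≤-nonNeg (+ B) t)
             , subst₂ _≤_ (sym (neg-distribʳ-* (+ B) y)) (sym (rescale (g' s) (d' s))) (*-monoˡ-≤-nonNeg (+ B) b)))
          where
          onSlice = slice s (+ B) (+ E * σ) y s<n 1≤B left right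

    pos-≤ : ∀ s → place s ≤ place (suc s)
    pos-≤ s = ≤-from (id₁ lo (+ s)) (nonneg 1)
      where
      id₁ : ∀ l s → l + (1ℤ + s) - (l + s) ≡ 1ℤ
      id₁ = solve-∀

    -- Both slices meeting at an abscissa describe the same segment of the
    -- polygon over it, so they agree about its length.
    continuous : ∀ s → suc s ℕ.< n → γ s * place (suc s) + Δ s ≡ γ (suc s) * place (suc s) + Δ (suc s)
    continuous s s+1<n = trans (split (g s) (g' s) (d s) (d' s) σ)
        (trans (cong₂ _+_ (≤-antisym top₁ top₂) (≤-antisym bot₁ bot₂))
            (sym (split (g (suc s)) (g' (suc s)) (d (suc s)) (d' (suc s)) σ)))
      where
      σ = place (suc s)
      module P = AtPosition s (ℕP.<-trans (ℕP.n<1+n s) s+1<n) σ (pos-≤ s) ≤-refl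
      module Q = AtPosition (suc s) s+1<n σ ≤-refl (pos-≤ (suc s))
      split : ∀ g g' d d' σ → (g + g') * σ + (d + d') ≡ (g * σ + d) + (g' * σ + d')
      split = solve-∀
      bottom : ∀ g g' d d' → 0ℤ ≤ (g + g') * σ + (d + d') → - (g * σ + d) ≤ g' * σ + d'
      bottom g g' d d' h = ≤-from (id₁ g g' d d' σ) h
        where
        id₁ : ∀ g g' d d' σ → g' * σ + d' - - (g * σ + d) ≡ (g + g') * σ + (d + d')
        id₁ = solve-∀
      top : ∀ g g' d d' → 0ℤ ≤ (g + g') * σ + (d + d') → - (g' * σ + d') ≤ g * σ + d
      top g g' d d' h = ≤-from (id₁ g g' d d' σ) h
        where
        id₁ : ∀ g g' d d' σ → g * σ + d - - (g' * σ + d') ≡ (g + g') * σ + (d + d')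
        id₁ = solve-∀
      -- The upper end of the segment according to slice s is a lattice point of the dilate
      -- (thickness puts it above the lower end), so slice s + 1 has to accept it.
      top₁ : g s * σ + d s ≤ g (suc s) * σ + d (suc s)
      top₁ = proj₁ (Equivalence.to (Q.slice-at _) (Equivalence.from (P.slice-at _)
        (≤-refl , bottom (g s) (g' s) (d s) (d' s) P.thick-at)))
      top₂ : g (suc s) * σ + d (suc s) ≤ g s * σ + d s
      top₂ = proj₁ (Equivalence.to (P.slice-at _) (Equivalence.from (Q.slice-at _)
        (≤-refl , bottom (g (suc s)) (g' (suc s)) (d (suc s)) (d' (suc s)) Q.thick-at)))
      bot₁ : g' s * σ + d' s ≤ g' (suc s) * σ + d' (suc s)
      bot₁ = subst (_≤ g' (suc s) * σ + d' (suc s)) (neg-involutive _)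
        (proj₂ (Equivalence.to (Q.slice-at _) (Equivalence.from (P.slice-at (- (g' s * σ + d' s)))
          (top (g s) (g' s) (d s) (d' s) P.thick-at , ≤-reflexive (neg-involutive _)))))
      bot₂ : g' (suc s) * σ + d' (suc s) ≤ g' s * σ + d' s
      bot₂ = subst (_≤ g' s * σ + d' s) (neg-involutive _)
        (proj₂ (Equivalence.to (P.slice-at _) (Equivalence.from (Q.slice-at (- (g' (suc s) * σ + d' (suc s))))
          (top (g (suc s)) (g' (suc s)) (d (suc s)) (d' (suc s)) Q.thick-at , ≤-reflexive (neg-involutive _)))))

    -- B times the length of the cross-section of the polygon at the abscissa `place s` / W. Only
    -- the first cut is read from the slice to its right, because the last cut has none there.
    ω : ℕ → ℤ
    ω zero    = γ 0 * place 0 + Δ 0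
    ω (suc s) = γ s * place (suc s) + Δ s

    ω-left : ∀ s → s ℕ.< n → γ s * place s + Δ s ≡ ω s
    ω-left zero    _     = refl
    ω-left (suc s) s+1<n = sym (continuous s s+1<n)

    0≤ω₀ : 0ℤ ≤ ω 0
    0≤ω₀ = AtPosition.thick-at 0 (ℕ.s≤s ℕ.z≤n) (place 0) ≤-refl (pos-≤ 0)

    0≤ωₙ : 0ℤ ≤ ω n
    0≤ωₙ = AtPosition.thick-at n' ℕP.≤-refl (place n) (pos-≤ n') ≤-refl

    -- The index type of the estimates: a dilate with an enumeration of its lattice points. The
    -- bound `W≤k` makes every strip at least one column wide, which keeps the first columns of the
    -- slices in order.
    record Config : Set where
      field
        k : ℕ
        W≤k : W ℕ.≤ k
        L : List (ℤ × ℤ)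
        unique : Unique L
        member : ∀ x y → (x , y) ∈ L ⇔ InP (+ k) x y

    size : Config → ℤ
    size i = + Config.k i

    open Estimates B {Config} size

    private module W where
      open Residues W public

    -- Column X s is the first one of slice s.  Slice 0 contains its left end;
    -- rounding strictly up afterwards makes column X n the first one past the polygon.
    X ρ : Config → ℕ → ℤ
    X i zero    = - ((- (size i * place 0)) /ℕ W)
    X i (suc s) = (size i * place (suc s)) /ℕ W + 1ℤ
    ρ i zero    = W.rem (- (size i * place 0))
    ρ i (suc s) = + W - W.rem (size i * place (suc s))

    X-ρ : ∀ i s → + W * X i s ≡ size i * place s + ρ i s
    X-ρ i zero = trans (id₁ (+ W) (P' /ℕ W) (W.rem P')) (trans (cong (λ p → - p + W.rem P') (sym (W.rem-eq P')))
        (cong (_+ W.rem P') (neg-involutive (size i * place 0))))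
      where
      P' = - (size i * place 0)
      id₁ : ∀ w q r → w * - q ≡ - (r + q * w) + r
      id₁ = solve-∀
    X-ρ i (suc s) = trans (id₁ (+ W) (P /ℕ W) (W.rem P)) (cong (_+ (+ W - W.rem P)) (sym (W.rem-eq P)))
      where
      P = size i * place (suc s)
      id₁ : ∀ w q r → w * (q + 1ℤ) ≡ r + q * w + (w - r)
      id₁ = solve-∀

    0≤ρ : ∀ i s → 0ℤ ≤ ρ i s
    0≤ρ i zero    = W.0≤rem (- (size i * place 0))
    0≤ρ i (suc s) = diff (<⇒≤ (W.rem< (size i * place (suc s))))

    ρ≤W : ∀ i s → ρ i s ≤ + W
    ρ≤W i zero    = <⇒≤ (W.rem< (- (size i * place 0)))
    ρ≤W i (suc s) = ≤-from (id₁ (+ W) (W.rem (size i * place (suc s)))) (W.0≤rem (size i * place (suc s)))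
      where
      id₁ : ∀ w r → w - (w - r) ≡ r
      id₁ = solve-∀

    cancelW : ∀ {u v} → + W * u ≤ + W * v → u ≤ v
    cancelW {u} {v} = *-cancelˡ-≤-pos u v (+ W) {{positive (<-≤-trans (+<+ (ℕ.s≤s ℕ.z≤n)) 1≤W)}}

    X-mono : ∀ i s → X i s ≤ X i (suc s)
    X-mono i s = cancelW (≤-from
      (trans (cong₂ _-_ (X-ρ i (suc s)) (X-ρ i s)) (id₁ (size i) lo (+ s) (ρ i s) (ρ i (suc s)) (+ W)))
      (diff (+≤+ (Config.W≤k i)) ⊕ 0≤ρ i (suc s) ⊕ diff (ρ≤W i s)))
      where
      id₁ : ∀ k l s ρ ρ' w → k * (l + (1ℤ + s)) + ρ' - (k * (l + s) + ρ) ≡ k - w + ρ' + (w - ρ)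
      id₁ = solve-∀

    ℓ : Config → ℕ → ℕ
    ℓ i s = ∣ X i (suc s) - X i s ∣

    X-ℓ : ∀ i s → X i s + + ℓ i s ≡ X i (suc s)
    X-ℓ i s = trans (cong (λ y → X i s + y) (0≤i⇒+∣i∣≡i (diff (X-mono i s)))) (id₁ (X i s) (X i (suc s)))
      where
      id₁ : ∀ x y → x + (y - x) ≡ y
      id₁ = solve-∀

    upto : Config → ℕ → ℕ
    upto i zero    = 0
    upto i (suc s) = upto i s ℕ.+ ℓ i s

    X-upto : ∀ i s → X i 0 + + upto i s ≡ X i s
    X-upto i zero    = +-identityʳ (X i 0)
    X-upto i (suc s) = trans (sym (+-assoc (X i 0) (+ upto i s) (+ ℓ i s)))
        (trans (cong (_+ + ℓ i s) (X-upto i s)) (X-ℓ i s))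

    col : Config → ℤ → ℤ
    col i = column (Config.L i)

    partialSum : Config → ℕ → ℤ
    partialSum i s = sum< (upto i s) (λ j → col i (X i 0 + + j))

    partialSum-suc : ∀ i s → partialSum i (suc s) ≡ partialSum i s + sum< (ℓ i s) (λ j → col i (X i s + + j))
    partialSum-suc i s = trans (sum-append (upto i s) (ℓ i s) _)
      (cong (λ y → partialSum i s + y) (sum-cong (ℓ i s) λ j _ →
        cong (col i) (trans (sym (+-assoc (X i 0) (+ upto i s) (+ j))) (cong (_+ + j) (X-upto i s)))))

    1≤size : ∀ i → 1ℤ ≤ size i
    1≤size i = ≤-trans 1≤W (+≤+ (Config.W≤k i))

    col-eq : ∀ s → s ℕ.< n → ∀ i j → j ℕ.< ℓ i s →
      let open Residues B; y = X i s + + j; t = g s * + W * y + size i * d s; b = g' s * + W * y + size i * d' s in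
      + B * col i y ≡ t - rem t + (b - rem b) + + B
    col-eq s s<n i j j<ℓ = ColumnCount.column-count B (Config.L i) y t b (Config.unique i)
        (thick s (size i) y s<n (1≤size i) left right)
        (λ z → mk⇔ (λ p → Equivalence.to (slice s (size i) y z s<n (1≤size i) left right)
            (Equivalence.to (Config.member i y z) p))
                   (λ p → Equivalence.from (Config.member i y z)
                       (Equivalence.from (slice s (size i) y z s<n (1≤size i) left right) p)))
      where
      y = X i s + + j
      t = g s * + W * y + size i * d s
      b = g' s * + W * y + size i * d' s
      left : size i * place s ≤ + W * y
      left = ≤-from (trans (cong (_- size i * place s) (*-distribˡ-+ (+ W) (X i s) (+ j)))
                      (trans (cong (λ u → u + + W * + j - size i * place s) (X-ρ i s))
                          (id₁ (size i * place s) (ρ i s) (+ W * + j))))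
                (0≤ρ i s ⊕ nonneg W ⊗ nonneg j)
        where
        id₁ : ∀ p ρ w → p + ρ + w - p ≡ ρ + w
        id₁ = solve-∀
      right : + W * y ≤ size i * place (suc s)
      right = ≤-from (trans (id₂ (size i * place (suc s)) (+ W) (X i s) (+ j) (+ ℓ i s))
                       (cong (λ u → u + + W * (+ ℓ i s - + j - 1ℤ))
                         (trans (cong (λ u → size i * place (suc s) - + W * u + + W) (X-ℓ i s))
                           (trans (cong (λ u → size i * place (suc s) - u + + W) (X-ρ i (suc s)))
                               (id₁ (size i * place (suc s)) (ρ i (suc s)) (+ W))))))
                (diff (ρ≤W i (suc s)) ⊕ nonneg W ⊗ diff< (+<+ j<ℓ))
        where
        id₁ : ∀ p ρ w → p - (p + ρ) + w ≡ w - ρ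
        id₁ = solve-∀
        id₂ : ∀ p w x j ℓ → p - w * (x + j) ≡ p - w * (x + ℓ) + w + w * (ℓ - j - 1ℤ)
        id₂ = solve-∀

    -- Collects the denominators: 2 for the halves in the sawtooth and in x (x - 1) / 2, one B for
    -- heights, one B for counting whole periods, W for widths.
    K : ℤ
    K = + 2 * + B * + B * + W

    -- The end terms are carried along rather than estimated: at an inner cut they cancel by
    -- `continuous`. Taken alone, the left end of a later slice has ρ = W when B divides k, so its
    -- term would be smallest exactly where sharpness asks for the maximum.
    partial-est : ∀ s → s ℕ.≤ n → ∃[ A ] Est (λ i → K * partialSum i s - A * (size i * size i)
      - + B * size i * (ω s * (+ 2 * ρ i s - + W) - ω 0 * (+ 2 * ρ i 0 - + W)))
    partial-est zero _ = 0ℤ , est-cong (λ i → id₁ K (size i * size i) (+ B * size i)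
        (ω 0 * (+ 2 * ρ i 0 - + W))) (est-bounded (λ _ → 0ℤ) 0ℤ (λ _ → ≤-refl) (λ _ → ≤-refl))
      where
      id₁ : ∀ K k b e → 0ℤ ≡ K * 0ℤ - 0ℤ * k - b * (e - e)
      id₁ = solve-∀
    partial-est (suc s) s<n with partial-est s (ℕP.<⇒≤ s<n)
    ... | A , est = A + A' , est-cong total (est-+ est piece)
      where
      A' = + B * ((g s + g' s) * (1ℤ + + 2 * place s) + + 2 * (d s + d' s))
      S : Config → ℤ
      S i = sum< (ℓ i s) (λ j → col i (X i s + + j))
      piece : Est (λ i → K * S i - A' * (size i * size i)
        - + B * size i * ((γ s * (1ℤ + place s) + Δ s) * (+ 2 * ρ i (suc s) - + W) - (γ s * place s + Δ s) *
            (+ 2 * ρ i s - + W)))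
      piece = SliceEstimate.slice-est W (λ i → ρ i s) (λ i → ρ i (suc s)) (λ i → 0≤ρ i s) (λ i → ρ≤W i s)
        (λ i → 0≤ρ i (suc s)) (λ i → ρ≤W i (suc s)) (place s) (λ i → X i s) (λ i → ℓ i s)
        (λ i → X-ρ i s)
        (λ i → trans (cong (λ u → + W * u) (X-ℓ i s))
            (trans (X-ρ i (suc s)) (cong (λ u → size i * u + ρ i (suc s)) (sym (place-suc s)))))
        (γ s) (g s * + W) (d s) (g' s * + W) (d' s) (id₁ (g s) (g' s) (+ W)) col (col-eq s s<n)
        where
        id₁ : ∀ g g' w → g * w + g' * w ≡ w * (g + g')
        id₁ = solve-∀
      total : ∀ i → _ ≡ _
      total i = trans (cong₂ (λ u v → first + (K * S i - A' * (size i * size i) - + B * size i *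
          ((γ s * u + Δ s) * (+ 2 * ρ i (suc s) - + W) - v * (+ 2 * ρ i s - + W)))) (place-suc s) (ω-left s s<n))
        (trans (id₁ K (partialSum i s) (S i) A A' (size i * size i) (+ B * size i) (ω s * (+ 2 * ρ i s - + W))
            (ω 0 * (+ 2 * ρ i 0 - + W)) (ω (suc s) * (+ 2 * ρ i (suc s) - + W)))
          (cong (λ u → K * u - (A + A') * (size i * size i) - + B * size i *
              (ω (suc s) * (+ 2 * ρ i (suc s) - + W) - ω 0 * (+ 2 * ρ i 0 - + W))) (sym (partialSum-suc i s))))
        where
        first = K * partialSum i s - A * (size i * size i) - + B * size i * (ω s * (+ 2 * ρ i s - + W) - ω 0 *
            (+ 2 * ρ i 0 - + W))
        id₁ : ∀ K P S A A' q b e e₀ e' → K * P - A * q - b * (e - e₀) + (K * S - A' * q - b * (e' - e)) ≡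
          K * (P + S) - (A + A') * q - b * (e' - e₀)
        id₁ = solve-∀

    est-end : ∀ ν (σ : Config → ℤ) → 0ℤ ≤ ν → (∀ i → - + W ≤ σ i) → (∀ i → σ i ≤ + W) →
      (∀ i → ∃[ q ] size i ≡ q * + B → σ i ≡ + W) → Est (λ i → + B * size i * (ν * σ i))
    est-end ν σ 0≤ν lower upper sharp = record
      { slope  = + B * (ν * + W)
      ; offset = 0ℤ
      ; upper  = λ i → subst (0ℤ ≤_) (id₁ (+ B) (size i) ν (σ i) (+ W)) (nonneg B ⊗ nonneg (Config.k i) ⊗
          (0≤ν ⊗ diff (upper i)))
      ; lower  = λ i → subst (0ℤ ≤_) (id₂ (+ B) (size i) ν (σ i) (+ W)) (nonneg B ⊗ nonneg (Config.k i) ⊗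
          (0≤ν ⊗ diff (lower i)))
      ; sharp  = λ i d → ≤-reflexive (trans (id₃ (+ B) (size i) ν (+ W))
          (cong (λ u → + B * size i * (ν * u) + 0ℤ - + B * (ν * + W) * size i) (sym (sharp i d))))
      }
      where
      id₁ : ∀ b k ν σ w → b * k * (ν * (w - σ)) ≡ b * (ν * w) * k + 0ℤ - b * k * (ν * σ)
      id₁ = solve-∀
      id₂ : ∀ b k ν σ w → b * k * (ν * (σ - - w)) ≡ b * (ν * w) * k + 0ℤ + b * k * (ν * σ)
      id₂ = solve-∀
      id₃ : ∀ b k ν w → 0ℤ ≡ b * k * (ν * w) + 0ℤ - b * (ν * w) * k
      id₃ = solve-∀

    -- If B divides k, the first and the last cut run along integer columns. Rounding stays on the
    -- first (ρ = 0) and steps past the last (ρ = W), so both vertical edges are counted in full and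
    -- the factors `σ₀` and `σₙ` attain their maximum W.
    ρ₀-sharp : ∀ i → ∃[ q ] size i ≡ q * + B → ρ i 0 ≡ 0ℤ
    ρ₀-sharp i (q , e) = W.rem-unique (- (q * + E * place 0)) ≤-refl (<-≤-trans (+<+ (ℕ.s≤s ℕ.z≤n)) 1≤W)
      (trans (cong (λ u → - (u * place 0)) (trans e (cong (λ b → q * b) B-eq))) (id₁ q (+ E) (+ W) (place 0)))
      where
      id₁ : ∀ q e w p → - (q * (e * w) * p) ≡ 0ℤ + - (q * e * p) * w
      id₁ = solve-∀

    ρₙ-sharp : ∀ i → ∃[ q ] size i ≡ q * + B → ρ i n ≡ + W
    ρₙ-sharp i (q , e) = trans (cong (λ r → + W - r) (W.rem-unique (q * + E * place n) ≤-refl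
        (<-≤-trans (+<+ (ℕ.s≤s ℕ.z≤n)) 1≤W)
      (trans (cong (λ u → u * place n) (trans e (cong (λ b → q * b) B-eq))) (id₁ q (+ E) (+ W) (place n)))))
          (+-identityʳ (+ W))
      where
      id₁ : ∀ q e w p → q * (e * w) * p ≡ 0ℤ + q * e * p * w
      id₁ = solve-∀

    length-eq : ∀ i → + length (Config.L i) ≡ partialSum i n
    length-eq i = length-by-columns (Config.L i) (upto i n) (X i 0) covered
      where
      P = size i * place n
      covered : ∀ z → z ∈ Config.L i → ∃[ j ] j ℕ.< upto i n × proj₁ z ≡ X i 0 + + j
      covered (x , y) z∈ = ∣ x - X i 0 ∣ , drop‿+<+ (subst (_< + upto i n) (sym j-eq) j<) , trans
          (id₁ x (X i 0)) (cong (λ u → X i 0 + u) (sym j-eq))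
        where
        bounds = range (size i) x y (1≤size i) (Equivalence.to (Config.member i x y) z∈)
        id₁ : ∀ x y → x ≡ y + (x - y)
        id₁ = solve-∀
        X₀≤x : X i 0 ≤ x
        X₀≤x with X i 0 ≤? x
        ... | yes p = p
        ... | no ¬p = absurd (trans
            (cong (λ u → + W * x - size i * lo + (+ W - ρ i 0 - 1ℤ + (u - + W * x - + W))) (X-ρ i 0))
            (id₂ (size i) lo (+ W) x (ρ i 0)))
                (diff (proj₁ bounds) ⊕ (diff< (W.rem< (- (size i * place 0))) ⊕ subst (0ℤ ≤_)
                    (id₃ (+ W) (X i 0) x) (nonneg W ⊗ diff< (≰⇒> ¬p))))
          where
          id₂ : ∀ k l w x ρ → w * x - k * l + (w - ρ - 1ℤ + (k * (l + 0ℤ) + ρ - w * x - w)) ≡ -1ℤ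
          id₂ = solve-∀
          id₃ : ∀ w a x → w * (a - x - 1ℤ) ≡ w * a - w * x - w
          id₃ = solve-∀
        x<Xₙ : x < X i n
        x<Xₙ with x <? X i n
        ... | yes p = p
        ... | no ¬p = absurd (trans (cong (λ u → P - + W * x + (+ W - W.rem P - 1ℤ + (+ W * x - u))) (X-ρ i n))
            (id₂ P (+ W) x (W.rem P)))
                (diff (proj₂ bounds) ⊕ (diff< (W.rem< P) ⊕ subst (0ℤ ≤_) (id₃ (+ W) (X i n) x)
                    (nonneg W ⊗ diff (≮⇒≥ ¬p))))
          where
          id₂ : ∀ p w x r → p - w * x + (w - r - 1ℤ + (w * x - (p + (w - r)))) ≡ -1ℤ
          id₂ = solve-∀
          id₃ : ∀ w a x → w * (x - a) ≡ w * x - w * a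
          id₃ = solve-∀
        j-eq : + ∣ x - X i 0 ∣ ≡ x - X i 0
        j-eq = 0≤i⇒+∣i∣≡i (diff X₀≤x)
        j< : x - X i 0 < + upto i n
        j< = <-from (trans (id₄ (X i 0) x (+ upto i n)) (cong (λ u → u - x - 1ℤ) (X-upto i n))) (diff< x<Xₙ)
          where
          id₄ : ∀ a x u → u - (x - a) - 1ℤ ≡ a + u - x - 1ℤ
          id₄ = solve-∀

    σₙ σ₀ : Config → ℤ
    σₙ i = + 2 * ρ i n - + W
    σ₀ i = + W - + 2 * ρ i 0

    est-ends : Est (λ i → + B * size i * (ω n * σₙ i)) × Est (λ i → + B * size i * (ω 0 * σ₀ i))
    est-ends =
        est-end (ω n) σₙ 0≤ωₙ (λ i → low (0≤ρ i n)) (λ i → high (ρ≤W i n))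
          (λ i d → trans (cong (λ u → + 2 * u - + W) (ρₙ-sharp i d)) (id₁ (+ W)))
      , est-end (ω 0) σ₀ 0≤ω₀ (λ i → low' (ρ≤W i 0)) (λ i → high' (0≤ρ i 0))
          (λ i d → trans (cong (λ u → + W - + 2 * u) (ρ₀-sharp i d)) (id₂ (+ W)))
      where
      id₁ : ∀ w → + 2 * w - w ≡ w
      id₁ = solve-∀
      id₂ : ∀ w → w - + 2 * 0ℤ ≡ w
      id₂ = solve-∀
      low : ∀ {ρ} → 0ℤ ≤ ρ → - + W ≤ + 2 * ρ - + W
      low {ρ} h = ≤-from (e ρ (+ W)) (nonneg 2 ⊗ h)
        where
        e : ∀ ρ w → + 2 * ρ - w - - w ≡ + 2 * ρ
        e = solve-∀
      high : ∀ {ρ} → ρ ≤ + W → + 2 * ρ - + W ≤ + W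
      high {ρ} h = ≤-from (e ρ (+ W)) (nonneg 2 ⊗ diff h)
        where
        e : ∀ ρ w → w - (+ 2 * ρ - w) ≡ + 2 * (w - ρ)
        e = solve-∀
      low' : ∀ {ρ} → ρ ≤ + W → - + W ≤ + W - + 2 * ρ
      low' {ρ} h = ≤-from (e ρ (+ W)) (nonneg 2 ⊗ diff h)
        where
        e : ∀ ρ w → w - + 2 * ρ - - w ≡ + 2 * (w - ρ)
        e = solve-∀
      high' : ∀ {ρ} → 0ℤ ≤ ρ → + W - + 2 * ρ ≤ + W
      high' {ρ} h = ≤-from (e ρ (+ W)) (nonneg 2 ⊗ h)
        where
        e : ∀ ρ w → w - (w - + 2 * ρ) ≡ + 2 * ρ
        e = solve-∀

    -- The two remaining end terms have nonnegative lengths as coefficients, so they can now be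
    -- estimated sharply. `A` is `K` times the area of the polygon.
    count-est : ∃[ A ] Est (λ i → K * + length (Config.L i) - A * (size i * size i))
    count-est = A , est-cong total (est-+ (proj₂ partial) (est-+ (proj₁ est-ends) (proj₂ est-ends)))
      where
      partial = partial-est n ℕP.≤-refl
      A = proj₁ partial
      id₁ : ∀ K P q b ωₙ ω₀ ρₙ ρ₀ w → K * P - q - b * (ωₙ * (+ 2 * ρₙ - w) - ω₀ * (+ 2 * ρ₀ - w)) +
          (b * (ωₙ * (+ 2 * ρₙ - w)) + b * (ω₀ * (w - + 2 * ρ₀))) ≡ K * P - q
      id₁ = solve-∀
      total : ∀ i → K * partialSum i n - A * (size i * size i) - + B * size i *
          (ω n * (+ 2 * ρ i n - + W) - ω 0 * (+ 2 * ρ i 0 - + W))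
        + (+ B * size i * (ω n * σₙ i) + + B * size i * (ω 0 * σ₀ i)) ≡ K * + length (Config.L i) - A *
            (size i * size i)
      total i = trans (id₁ K (partialSum i n) (A * (size i * size i)) (+ B * size i) (ω n) (ω 0) (ρ i n) (ρ i 0)
          (+ W))
        (cong (λ u → K * u - A * (size i * size i)) (sym (length-eq i)))

  -- Edges over a strip

  maximum : ∀ {A : Set} {Q : A → Set} (Q? : Decidable Q) (f : A → ℤ) xs a → Q a →
    ∃[ m ] (Q m × f a ≤ f m × (∀ x → x ∈ xs → Q x → f x ≤ f m))
  maximum Q? f []       a Qa = a , Qa , ≤-refl , λ _ ()
  maximum Q? f (x ∷ xs) a Qa with Q? x
  ... | no ¬Qx = let (m , Qm , am , max) = maximum Q? f xs a Qa in
    m , Qm , am , λ { _ (here refl) Qx → ⊥-elim (¬Qx Qx) ; y (there y∈) Qy → max y y∈ Qy }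
  ... | yes Qx with ≤-total (f x) (f a)
  ...   | inj₁ x≤a = let (m , Qm , am , max) = maximum Q? f xs a Qa in
    m , Qm , am , λ { _ (here refl) _ → ≤-trans x≤a am ; y (there y∈) Qy → max y y∈ Qy }
  ...   | inj₂ a≤x = let (m , Qm , xm , max) = maximum Q? f xs x Qx in
    m , Qm , ≤-trans a≤x xm , λ { _ (here refl) _ → xm ; y (there y∈) Qy → max y y∈ Qy }

  -- Lines through points with integer abscissae at distance e ≤ n have slopes with denominator e;
  -- `n !` serves all of them, and this is the factor that extends e to it. The value at e = 0 is a
  -- default.
  cofactor : ℕ → ℕ → ℕ
  cofactor n zero    = 0
  cofactor n (suc e) = n ! ℕ./ suc e

  cofactor-* : ∀ n e → 1 ℕ.≤ e → e ℕ.≤ n → cofactor n e ℕ.* e ≡ n !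
  cofactor-* n (suc e) _ e<n = ℕD.m/n*n≡m (ℕV.∣-trans (ℕV.m∣m*n (e !)) (ℕV.m≤n⇒m!∣n! e<n))

  cancel-pos : ∀ κ x → 1ℤ ≤ κ → κ * x ≤ 0ℤ → x ≤ 0ℤ
  cancel-pos κ x 1≤κ h = *-cancelˡ-≤-pos x 0ℤ κ {{positive (<-≤-trans (+<+ (ℕ.s≤s ℕ.z≤n)) 1≤κ)}}
      (subst (κ * x ≤_) (sym (*-zeroʳ κ)) h)

  -- A chord on the edge of the upper hull that spans the strip from s to s + 1, with its line E v =
  -- g u + d; for - v it belongs to the lower hull. As abscissae are integers, no vertex lies inside
  -- the strip.
  record Bridge {m} (u v : Fin m → ℤ) (E : ℕ) (s g d : ℤ) : Set where
    field
      i j : Fin m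
      i-left  : u i ≤ s
      j-right : 1ℤ + s ≤ u j
      i-on : + E * v i ≡ g * u i + d
      j-on : + E * v j ≡ g * u j + d
      above : ∀ l → + E * v l ≤ g * u l + d

  module Crossing {m} (u v : Fin m → ℤ) (n : ℕ) (s : ℤ) (spread : ∀ i j → u j - u i ≤ + n) where

    Crosses : Fin m × Fin m → Set
    Crosses (i , j) = u i ≤ s × 1ℤ + s ≤ u j
    crosses? : Decidable Crosses
    crosses? (i , j) = u i ≤? s ×-dec 1ℤ + s ≤? u j
    κ : Fin m → Fin m → ℤ
    κ i j = + cofactor n ∣ u j - u i ∣
    -- Interpolation at s + 1/2, times 2 (u₂ - u₁); so `height` is 2 (n !) times the ordinate there,
    -- on the same scale for all segments. At the half-integer both weights of a crossing segment
    -- are strictly positive, which could fail at s or s + 1.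
    midline : ℤ → ℤ → ℤ → ℤ → ℤ
    midline u₁ v₁ u₂ v₂ = (+ 2 * u₂ - + 2 * s - 1ℤ) * v₁ + (+ 2 * s + 1ℤ - + 2 * u₁) * v₂
    height : Fin m × Fin m → ℤ
    height (i , j) = κ i j * midline (u i) (v i) (u j) (v j)

    gap : ∀ i j → Crosses (i , j) → 0ℤ ≤ u j - u i - 1ℤ
    gap i j (l , r) = subst (0ℤ ≤_) (id₁ (u i) (u j) s) (diff l ⊕ diff r)
      where
      id₁ : ∀ a b s → s - a + (b - (1ℤ + s)) ≡ b - a - 1ℤ
      id₁ = solve-∀

    κ-* : ∀ i j → Crosses (i , j) → κ i j * (u j - u i) ≡ + (n !)
    κ-* i j c = trans (cong (κ i j *_) (sym e-eq)) (trans (sym (pos-* (cofactor n e) e))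
        (cong +_ (cofactor-* n e 1≤e e≤n)))
      where
      e = ∣ u j - u i ∣
      e-eq : + e ≡ u j - u i
      e-eq = 0≤i⇒+∣i∣≡i (subst (0ℤ ≤_) (id₁ (u j - u i)) (gap i j c ⊕ nonneg 1))
        where
        id₁ : ∀ x → x - 1ℤ + 1ℤ ≡ x
        id₁ = solve-∀
      1≤e : 1 ℕ.≤ e
      1≤e = drop‿+≤+ (subst (1ℤ ≤_) (sym e-eq) (0≤i-j⇒j≤i (gap i j c)))
      e≤n : e ℕ.≤ n
      e≤n = drop‿+≤+ (subst (_≤ + n) (sym e-eq) (spread i j))

    module Highest (i j : Fin m) (i-left : u i ≤ s) (j-right : 1ℤ + s ≤ u j)
      (highest : ∀ i' j' → Crosses (i' , j') → height (i' , j') ≤ height (i , j)) where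

      κ₀ : ℤ
      κ₀ = κ i j
      κ₀-* : κ₀ * (u j - u i) ≡ + (n !)
      κ₀-* = κ-* i j (i-left , j-right)
      g d : ℤ
      g = κ₀ * (v j - v i)
      d = κ₀ * (v i * u j - v j * u i)
      i-on : + (n !) * v i ≡ g * u i + d
      i-on = trans (cong (_* v i) (sym κ₀-*)) (id₁ κ₀ (u i) (v i) (u j) (v j))
        where
        id₁ : ∀ κ a b c e → κ * (c - a) * b ≡ κ * (e - b) * a + κ * (b * c - e * a)
        id₁ = solve-∀
      j-on : + (n !) * v j ≡ g * u j + d
      j-on = trans (cong (_* v j) (sym κ₀-*)) (id₁ κ₀ (u i) (v i) (u j) (v j))
        where
        id₁ : ∀ κ a b c e → κ * (c - a) * e ≡ κ * (e - b) * c + κ * (b * c - e * a)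
        id₁ = solve-∀

      1≤n! : 0ℤ ≤ + (n !) - 1ℤ
      1≤n! = diff (+≤+ (ℕP.1≤n! n))

      -- The change of the midline ordinate is a weighted mean of the signed distances of the new
      -- end points from the old line.
      excess : ∀ i' j' → Crosses (i' , j') →
        + (n !) * (height (i' , j') - height (i , j)) ≡
        κ i' j' * ((+ 2 * u j' - + 2 * s - 1ℤ) * (+ (n !) * v i' - (g * u i' + d)) +
            (+ 2 * s + 1ℤ - + 2 * u i') * (+ (n !) * v j' - (g * u j' + d)))
      excess i' j' c = trans (cong (λ h → + (n !) * (height (i' , j') - h)) (id₁ κ₀ (u i) (v i) (u j) (v j) s))
        (trans (id₂ (+ (n !)) (height (i' , j')) ((+ 2 * s + 1ℤ) * g + + 2 * d))
          (trans (cong (λ E → + (n !) * height (i' , j') - E * ((+ 2 * s + 1ℤ) * g + + 2 * d)) (sym (κ-* i' j' c)))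
            (id₃ (+ (n !)) (κ i' j') (u i') (v i') (u j') (v j') s g d)))
        where
        id₁ : ∀ κ a b c e s → κ * ((+ 2 * c - + 2 * s - 1ℤ) * b + (+ 2 * s + 1ℤ - + 2 * a) * e) ≡
          (+ 2 * s + 1ℤ) * (κ * (e - b)) + + 2 * (κ * (b * c - e * a))
        id₁ = solve-∀
        id₂ : ∀ E h t → E * (h - t) ≡ E * h - E * t
        id₂ = solve-∀
        id₃ : ∀ E κ a b c e s g d
            → E * (κ * ((+ 2 * c - + 2 * s - 1ℤ) * b + (+ 2 * s + 1ℤ - + 2 * a) * e)) - κ * (c - a) *
            ((+ 2 * s + 1ℤ) * g + + 2 * d) ≡
          κ * ((+ 2 * c - + 2 * s - 1ℤ) * (E * b - (g * a + d)) + (+ 2 * s + 1ℤ - + 2 * a) * (E * e - (g * c + d)))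
        id₃ = solve-∀

      1≤κ : ∀ i j → Crosses (i , j) → 0ℤ ≤ κ i j - 1ℤ
      1≤κ i j c with 1ℤ ≤? κ i j
      ... | yes p = diff p
      ... | no ¬p = absurd (trans (cong (λ E → E - 1ℤ + (0ℤ - κ i j) * (u j - u i)) (sym (κ-* i j c)))
          (id₁ (κ i j) (u j - u i)))
          (1≤n! ⊕ (subst (0ℤ ≤_) (id₂ (κ i j)) (diff< (≰⇒> ¬p)) ⊗ subst (0ℤ ≤_) (id₃ (u j - u i))
              (gap i j c ⊕ nonneg 1)))
        where
        id₁ : ∀ κ e → κ * e - 1ℤ + (0ℤ - κ) * e ≡ -1ℤ
        id₁ = solve-∀
        id₂ : ∀ κ → 1ℤ - κ - 1ℤ ≡ 0ℤ - κ
        id₂ = solve-∀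
        id₃ : ∀ e → e - 1ℤ + 1ℤ ≡ e
        id₃ = solve-∀

      lower : ∀ {h h'} → h ≤ h' → + (n !) * (h - h') ≤ 0ℤ
      lower {h} {h'} h≤h' = ≤-from (id₁ (+ (n !)) h h') (nonneg (n !) ⊗ diff h≤h')
        where
        id₁ : ∀ E h h' → 0ℤ - E * (h - h') ≡ E * (h' - h)
        id₁ = solve-∀

      above : ∀ l → + (n !) * v l ≤ g * u l + d
      above l with u l ≤? s
      -- The pair (l , j) still crosses the strip, and `j`, being on the line, contributes nothing
      -- to its excess; the positive factors `κ l j` and `α` are then cancelled.
      ... | yes l-left = i-j≤0⇒i≤j (cancel-pos α ε α≥1 (cancel-pos (κ l j) (α * ε) (0≤i-j⇒j≤i (1≤κ l j c))
          (subst (_≤ 0ℤ) eq lowered)))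
        where
        c : Crosses (l , j)
        c = l-left , j-right
        α = + 2 * u j - + 2 * s - 1ℤ
        ε = + (n !) * v l - (g * u l + d)
        α≥1 : 1ℤ ≤ α
        α≥1 = ≤-from (id₁ (u j) s) (nonneg 2 ⊗ diff j-right)
          where
          id₁ : ∀ b s → + 2 * b - + 2 * s - 1ℤ - 1ℤ ≡ + 2 * (b - (1ℤ + s))
          id₁ = solve-∀
        lowered : + (n !) * (height (l , j) - height (i , j)) ≤ 0ℤ
        lowered = lower (highest l j c)
        eq : + (n !) * (height (l , j) - height (i , j)) ≡ κ l j * (α * ε)
        eq = trans (excess l j c)
            (trans (cong (λ z → κ l j * (α * ε + (+ 2 * s + 1ℤ - + 2 * u l) * (z - (g * u j + d)))) j-on)
               (id₁ (κ l j) (α * ε) (+ 2 * s + 1ℤ - + 2 * u l) (g * u j + d)))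
          where
          id₁ : ∀ κ x β z → κ * (x + β * (z - z)) ≡ κ * x
          id₁ = solve-∀
      ... | no ¬l-left = i-j≤0⇒i≤j (cancel-pos β ε β≥1 (cancel-pos (κ i l) (β * ε) (0≤i-j⇒j≤i (1≤κ i l c))
          (subst (_≤ 0ℤ) eq lowered)))
        where
        c : Crosses (i , l)
        c = i-left , i<j⇒suc[i]≤j (≰⇒> ¬l-left)
        β = + 2 * s + 1ℤ - + 2 * u i
        ε = + (n !) * v l - (g * u l + d)
        β≥1 : 1ℤ ≤ β
        β≥1 = ≤-from (id₁ (u i) s) (nonneg 2 ⊗ diff i-left)
          where
          id₁ : ∀ a s → + 2 * s + 1ℤ - + 2 * a - 1ℤ ≡ + 2 * (s - a)
          id₁ = solve-∀
        lowered : + (n !) * (height (i , l) - height (i , j)) ≤ 0ℤ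
        lowered = lower (highest i l c)
        eq : + (n !) * (height (i , l) - height (i , j)) ≡ κ i l * (β * ε)
        eq = trans (excess i l c)
            (trans (cong (λ z → κ i l * ((+ 2 * u l - + 2 * s - 1ℤ) * (z - (g * u i + d)) + β * ε)) i-on)
               (id₁ (κ i l) (β * ε) (+ 2 * u l - + 2 * s - 1ℤ) (g * u i + d)))
          where
          id₁ : ∀ κ x α z → κ * (α * (z - z) + x) ≡ κ * x
          id₁ = solve-∀

  -- Among the segments crossing the strip s ≤ u ≤ s+1, take one which is highest
  -- at the midline: replacing an endpoint by a point above its line would raise it.
  bridge : ∀ {m} (u v : Fin m → ℤ) (n : ℕ) (s : ℤ) → (∀ i j → u j - u i ≤ + n) →
    ∀ i₀ j₀ → u i₀ ≤ s → 1ℤ + s ≤ u j₀ → ∃[ g ] ∃[ d ] Bridge u v (n !) s g d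
  bridge {m} u v n s spread i₀ j₀ i₀-left j₀-right =
    let ((i , j) , (i-left , j-right) , _ , max) =
          maximum crosses? height (cartesianProduct (allFin m) (allFin m)) (i₀ , j₀) (i₀-left , j₀-right)
        open Highest i j i-left j-right (λ i' j' → max (i' , j') (∈-cartesianProduct⁺ (∈-allFin i') (∈-allFin j')))
    in g , d , record
      { i = i ; j = j ; i-left = i-left ; j-right = j-right ; i-on = i-on ; j-on = j-on ; above = above }
    where open Crossing u v n s spread

  -- The region between the upper and the lower bridge

  module Strip {m} (u v : Fin m → ℤ) (E : ℕ) (1≤E : 1ℤ ≤ + E) (s g d g' d' : ℤ)
    (top : Bridge u v E s g d) (bot : Bridge u (λ i → - v i) E s g' d') where

    private
      module T = Bridge top
      module B = Bridge bot

    below-top : ∀ l → 0ℤ ≤ g * u l + - + E * v l + d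
    below-top l = subst (0ℤ ≤_) (id₁ g d (+ E) (u l) (v l)) (diff (T.above l))
      where
      id₁ : ∀ g d E u v → g * u + d - E * v ≡ g * u + - E * v + d
      id₁ = solve-∀

    above-bottom : ∀ l → 0ℤ ≤ g' * u l + + E * v l + d'
    above-bottom l = subst (0ℤ ≤_) (id₁ g' d' (+ E) (u l) (v l)) (diff (B.above l))
      where
      id₁ : ∀ g d E u v → g * u + d - E * (- v) ≡ g * u + E * v + d
      id₁ = solve-∀

    e e' : ℤ
    e  = u T.j - u T.i
    e' = u B.j - u B.i

    gap : ∀ {a b} → a ≤ s → 1ℤ + s ≤ b → 1ℤ ≤ b - a
    gap {a} {b} p q = ≤-from (id₁ a b s) (diff p ⊕ diff q)
      where
      id₁ : ∀ a b s → b - a - 1ℤ ≡ s - a + (b - (1ℤ + s))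
      id₁ = solve-∀

    1≤e : 1ℤ ≤ e
    1≤e = gap T.i-left T.j-right

    1≤e' : 1ℤ ≤ e'
    1≤e' = gap B.i-left B.j-right

    module Column (k P t b : ℤ) (t-eq : t ≡ g * P + k * d) (b-eq : b ≡ g' * P + k * d')
      (1≤k : 1ℤ ≤ k) (left : k * s ≤ P) (right : P ≤ k * (1ℤ + s)) where

      0≤k : 0ℤ ≤ k
      0≤k = ≤-trans (+≤+ ℕ.z≤n) 1≤k

      -- Together with `before`, the barycentric weights of the point over P on a chord from a ≤ s
      -- to b ≥ s + 1; their total is k (b - a).
      after : ∀ {a} → a ≤ s → 0ℤ ≤ P - k * a
      after {a} p = subst (0ℤ ≤_) (id₁ k s P a) (diff left ⊕ 0≤k ⊗ diff p)
        where
        id₁ : ∀ k s P a → P - k * s + k * (s - a) ≡ P - k * a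
        id₁ = solve-∀

      before : ∀ {b} → 1ℤ + s ≤ b → 0ℤ ≤ k * b - P
      before {b} p = subst (0ℤ ≤_) (id₁ k s P b) (diff right ⊕ 0≤k ⊗ diff p)
        where
        id₁ : ∀ k s P b → k * (1ℤ + s) - P + k * (b - (1ℤ + s)) ≡ k * b - P
        id₁ = solve-∀

      -- The end points of the top bridge are vertices, hence lie above the bottom line;
      -- interpolating their distances to it yields e (t + b).
      thickness : 0ℤ ≤ t + b
      thickness = *-cancelˡ-≤-pos 0ℤ (t + b) e {{positive (<-≤-trans (+<+ (ℕ.s≤s ℕ.z≤n)) 1≤e)}}
        (subst₂ _≤_ (sym (*-zeroʳ e)) eq (before T.j-right ⊗ above-bottom T.i ⊕ after T.i-left ⊗ above-bottom T.j))
        where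
        id₁ : ∀ k P a c g d g' d' → (k * c - P) * (g' * a + (g * a + d) + d') + (P - k * a) *
            (g' * c + (g * c + d) + d') ≡
          (c - a) * (g * P + k * d + (g' * P + k * d'))
        id₁ = solve-∀
        eq : (k * u T.j - P) * (g' * u T.i + + E * v T.i + d') + (P - k * u T.i) *
            (g' * u T.j + + E * v T.j + d') ≡ e * (t + b)
        eq = trans (cong₂ (λ y z → (k * u T.j - P) * (g' * u T.i + y + d') + (P - k * u T.i) *
            (g' * u T.j + z + d')) T.i-on T.j-on)
               (trans (id₁ k P (u T.i) (u T.j) g d g' d') (cong₂ (λ y z → e * (y + z)) (sym t-eq) (sym b-eq)))

      -- `C X Y N` stands for membership of (X / N , Y / N) in the hull; leaving it abstract keeps
      -- rational weights out of the integer argument.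
      module _ (C : ℤ → ℤ → ℤ → Set) (vertex : ∀ i → C (u i) (v i) 1ℤ)
        (combine : ∀ {X Y N X' Y' N'} a b → 0ℤ ≤ a → 0ℤ ≤ b → C X Y N → C X' Y' N' →
          C (a * X + b * X') (a * Y + b * Y') (a * N + b * N')) where

        private
          congC : ∀ {X Y N X' Y' N'} → X ≡ X' → Y ≡ Y' → N ≡ N' → C X Y N → C X' Y' N'
          congC refl refl refl c = c

          neg-swap : ∀ {l z} → + E * (- v l) ≡ z → + E * v l ≡ - z
          neg-swap {l} {z} h = trans (id₁ (+ E) (v l)) (cong -_ h)
            where
            id₁ : ∀ E v → E * v ≡ - (E * - v)
            id₁ = solve-∀

          onTop : ∃[ Y ] (+ E * Y ≡ t * e × C (P * e) Y (k * e))
          onTop = α * v T.i + β * v T.j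
                , trans (id₁ (+ E) α β (v T.i) (v T.j)) (trans (cong₂ (λ y z → α * y + β * z) T.i-on T.j-on)
                    (trans (id₂ k P (u T.i) (u T.j) g d) (cong (_* e) (sym t-eq))))
                , congC (id₃ k P (u T.i) (u T.j)) refl (id₄ k P (u T.i) (u T.j)) (combine α β (before T.j-right)
                    (after T.i-left) (vertex T.i) (vertex T.j))
            where
            α = k * u T.j - P
            β = P - k * u T.i
            id₁ : ∀ E α β v w → E * (α * v + β * w) ≡ α * (E * v) + β * (E * w)
            id₁ = solve-∀
            id₂ : ∀ k P a c g d → (k * c - P) * (g * a + d) + (P - k * a) * (g * c + d) ≡ (g * P + k * d) * (c - a)
            id₂ = solve-∀
            id₃ : ∀ k P a c → (k * c - P) * a + (P - k * a) * c ≡ P * (c - a)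
            id₃ = solve-∀
            id₄ : ∀ k P a c → (k * c - P) * 1ℤ + (P - k * a) * 1ℤ ≡ k * (c - a)
            id₄ = solve-∀

          onBottom : ∃[ Y ] (+ E * Y ≡ - (b * e') × C (P * e') Y (k * e'))
          onBottom = α * v B.i + β * v B.j
                , trans (id₁ (+ E) α β (v B.i) (v B.j))
                    (trans (cong₂ (λ y z → α * y + β * z) (neg-swap B.i-on) (neg-swap B.j-on))
                    (trans (id₂ k P (u B.i) (u B.j) g' d') (cong (λ y → - (y * e')) (sym b-eq))))
                , congC (id₃ k P (u B.i) (u B.j)) refl (id₄ k P (u B.i) (u B.j)) (combine α β (before B.j-right)
                    (after B.i-left) (vertex B.i) (vertex B.j))
            where
            α = k * u B.j - P
            β = P - k * u B.i
            id₁ : ∀ E α β v w → E * (α * v + β * w) ≡ α * (E * v) + β * (E * w)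
            id₁ = solve-∀
            id₂ : ∀ k P a c g d → (k * c - P) * (- (g * a + d)) + (P - k * a) * (- (g * c + d))
                ≡ - ((g * P + k * d) * (c - a))
            id₂ = solve-∀
            id₃ : ∀ k P a c → (k * c - P) * a + (P - k * a) * c ≡ P * (c - a)
            id₃ = solve-∀
            id₄ : ∀ k P a c → (k * c - P) * 1ℤ + (P - k * a) * 1ℤ ≡ k * (c - a)
            id₄ = solve-∀

        thickCase : ∀ Q → + E * Q ≤ t → - (+ E * Q) ≤ b → 1ℤ ≤ t + b → ∃[ τ ] (1ℤ ≤ τ × C (τ * P) (τ * Q) (τ * k))
        thickCase Q Q≤t -Q≤b 1≤t+b = τ , 1≤τ , congC
            (id₁ (+ E) (+ E * Q) t b e e' P)
            Y-eq
            (id₁ (+ E) (+ E * Q) t b e e' k)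
            (combine α β 0≤α 0≤β (proj₂ (proj₂ onTop)) (proj₂ (proj₂ onBottom)))
          where
          Y Y' τ α β : ℤ
          Y = proj₁ onTop
          Y' = proj₁ onBottom
          -- The weights come from the distances of `Q` to the bottom and the top line. The factors
          -- `e'` and `e` equalise the denominators of the two projections, and `E` enters because
          -- only `E * Y` and `E * Y'` are known explicitly.
          τ = + E * (t + b) * e * e'
          α = + E * (+ E * Q + b) * e'
          β = + E * (t - + E * Q) * e
          1≤τ : 1ℤ ≤ τ
          1≤τ = 1≤* (+ E * (t + b) * e) e' (1≤* (+ E * (t + b)) e (1≤* (+ E) (t + b) 1≤E 1≤t+b) 1≤e) 1≤e'
          0≤α : 0ℤ ≤ α
          0≤α = nonneg E ⊗ subst (0ℤ ≤_) (id₄ (+ E * Q) b) (diff -Q≤b) ⊗ ≤-trans (+≤+ ℕ.z≤n) 1≤e'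
            where
            id₄ : ∀ y b → b - - y ≡ y + b
            id₄ = solve-∀
          0≤β : 0ℤ ≤ β
          0≤β = nonneg E ⊗ diff Q≤t ⊗ ≤-trans (+≤+ ℕ.z≤n) 1≤e
          id₁ : ∀ E y t b e e' P → E * (y + b) * e' * (P * e) + E * (t - y) * e * (P * e') ≡ E * (t + b) * e * e' * P
          id₁ = solve-∀
          Y-eq : α * Y + β * Y' ≡ τ * Q
          Y-eq = trans (id₂ (+ E) (+ E * Q) t b e e' Y Y')
                   (trans (cong₂ (λ y z → (+ E * Q + b) * e' * y + (t - + E * Q) * e * z) (proj₁ (proj₂ onTop))
                       (proj₁ (proj₂ onBottom)))
                     (id₃ (+ E) Q t b e e'))
            where
            id₂ : ∀ E y t b e e' Y Y' → E * (y + b) * e' * Y + E * (t - y) * e * Y' ≡ (y + b) * e' * (E * Y) +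
                (t - y) * e * (E * Y')
            id₂ = solve-∀
            id₃ : ∀ E Q t b e e' → (E * Q + b) * e' * (t * e) + (t - E * Q) * e * (- (b * e'))
                ≡ E * (t + b) * e * e' * Q
            id₃ = solve-∀

        flatCase : ∀ Q → + E * Q ≤ t → - (+ E * Q) ≤ b → t + b < 1ℤ → ∃[ τ ] (1ℤ ≤ τ × C (τ * P) (τ * Q) (τ * k))
        flatCase Q Q≤t -Q≤b t+b<1 = + E * e , 1≤* (+ E) e 1≤E 1≤e , congC
            (id₁ (+ E) e P)
            (trans (id₂ (+ E) (proj₁ onTop)) (trans (proj₁ (proj₂ onTop)) (trans (cong (_* e) t≡) (id₃ (+ E) Q e))))
            (id₁ (+ E) e k)
            -- With weight 0 on the second summand, `combine` merely scales a point of the top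
            -- bridge.
            (combine (+ E) 0ℤ (nonneg E) ≤-refl (proj₂ (proj₂ onTop)) (proj₂ (proj₂ onTop)))
          where
          t≡ : t ≡ + E * Q
          t≡ = ≤-antisym (≤-from (id₄ t b (+ E * Q)) (diff -Q≤b ⊕ diff< t+b<1)) Q≤t
            where
            id₄ : ∀ t b y → y - t ≡ b - - y + (1ℤ - (t + b) - 1ℤ)
            id₄ = solve-∀
          id₁ : ∀ E e P → E * (P * e) + 0ℤ * (P * e) ≡ E * e * P
          id₁ = solve-∀
          id₂ : ∀ E Y → E * Y + 0ℤ * Y ≡ E * Y
          id₂ = solve-∀
          id₃ : ∀ E Q e → E * Q * e ≡ E * e * Q
          id₃ = solve-∀

        -- A point between the bottom and the top line is a convex combination of
        -- its projections to them, unless these coincide (t + b = 0).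
        between : ∀ Q → + E * Q ≤ t → - (+ E * Q) ≤ b → ∃[ τ ] (1ℤ ≤ τ × C (τ * P) (τ * Q) (τ * k))
        between Q Q≤t -Q≤b with 1ℤ ≤? t + b
        ... | yes 1≤t+b = thickCase Q Q≤t -Q≤b 1≤t+b
        ... | no 1≰t+b  = flatCase Q Q≤t -Q≤b (≰⇒> 1≰t+b)

  -- Cutting a polygon into slices

  module Slicing {m} (u v : Fin m → ℤ) (W n : ℕ) (InP : ℤ → ℤ → ℤ → Set) (C : ℤ → ℤ → ℤ → Set)
    (vertex : ∀ i → C (u i) (v i) 1ℤ)
    (combine : ∀ {X Y N X' Y' N'} a b → 0ℤ ≤ a → 0ℤ ≤ b → C X Y N → C X' Y' N' →
      C (a * X + b * X') (a * Y + b * Y') (a * N + b * N'))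
    (cone⇒InP : ∀ τ k x y → 1ℤ ≤ τ → 1ℤ ≤ k → C (τ * (+ W * x)) (τ * (+ W * y)) (τ * k) → InP k x y)
    (halfplane : ∀ α β δ → (∀ i → 0ℤ ≤ α * u i + β * v i + δ) →
      ∀ k x y → 0ℤ ≤ k → InP k x y → 0ℤ ≤ α * (+ W * x) + β * (+ W * y) + k * δ)
    (i₀ j₀ : Fin m) (least : ∀ i → u i₀ ≤ u i) (greatest : ∀ i → u i ≤ u j₀) (extent : u j₀ - u i₀ ≡ + n) where

    E : ℕ
    E = n !

    lo : ℤ
    lo = u i₀

    spread : ∀ i j → u j - u i ≤ + n
    spread i j = ≤-from (trans (cong (_- (u j - u i)) (sym extent)) (id₁ (u i₀) (u j₀) (u i) (u j)))
        (diff (least i) ⊕ diff (greatest j))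
      where
      id₁ : ∀ a b x y → b - a - (y - x) ≡ x - a + (b - y)
      id₁ = solve-∀

    strip : ∀ (t : Fin m → ℤ) s → ∃[ g ] ∃[ d ] (s ℕ.< n → Bridge u t E (lo + + s) g d)
    strip t s with s ℕ.<? n
    -- Default values that make `g` and `d` total functions of s.
    ... | no s≮n  = 0ℤ , 0ℤ , λ s<n → ⊥-elim (s≮n s<n)
    ... | yes s<n = proj₁ B , proj₁ (proj₂ B) , λ _ → proj₂ (proj₂ B)
      where
      left : lo ≤ lo + + s
      left = ≤-from (id₁ lo (+ s)) (nonneg s)
        where
        id₁ : ∀ l s → l + s - l ≡ s
        id₁ = solve-∀
      right : 1ℤ + (lo + + s) ≤ u j₀
      right = ≤-from (trans (id₁ (u i₀) (u j₀) (+ s)) (cong (λ z → z - + s - 1ℤ) extent)) (diff< (+<+ s<n))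
        where
        id₁ : ∀ a b s → b - (1ℤ + (a + s)) ≡ b - a - s - 1ℤ
        id₁ = solve-∀
      B : ∃[ g ] ∃[ d ] Bridge u t E (lo + + s) g d
      B = bridge u t n (lo + + s) spread i₀ j₀ left right

    g d g' d' : ℕ → ℤ
    g  s = proj₁ (strip v s)
    d  s = proj₁ (proj₂ (strip v s))
    g' s = proj₁ (strip (λ i → - v i) s)
    d' s = proj₁ (proj₂ (strip (λ i → - v i) s))

    1≤E : 1ℤ ≤ + E
    1≤E = +≤+ (ℕP.1≤n! n)

    module S (s : ℕ) (s<n : s ℕ.< n) = Strip u v E 1≤E (lo + + s) (g s) (d s) (g' s) (d' s)
      (proj₂ (proj₂ (strip v s)) s<n) (proj₂ (proj₂ (strip (λ i → - v i) s)) s<n)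

    EW : ∀ y → + E * (+ W * y) ≡ + (E ℕ.* W) * y
    EW y = trans (sym (*-assoc (+ E) (+ W) y)) (cong (_* y) (sym (pos-* E W)))

    next : ∀ s → lo + + suc s ≡ 1ℤ + (lo + + s)
    next s = id₁ lo (+ s)
      where
      id₁ : ∀ l s → l + (1ℤ + s) ≡ 1ℤ + (l + s)
      id₁ = solve-∀

    line : ∀ g x z → g * + W * x + z ≡ g * (+ W * x) + z
    line g x z = cong (_+ z) (*-assoc g (+ W) x)

    sliced : Sliced W E n InP
    sliced = record { lo = lo ; g = g ; d = d ; g' = g' ; d' = d' ; range = range ; slice = slice ; thick = thick }
      where
      range : ∀ k x y → 1ℤ ≤ k → InP k x y → k * lo ≤ + W * x × + W * x ≤ k * (lo + + n)
      range k x y 1≤k p =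
          ≤-from (id₁ (+ W * x) (+ W * y) k lo)
              (halfplane 1ℤ 0ℤ (- lo) (λ i → subst (0ℤ ≤_) (id₃ (u i) (v i) lo) (diff (least i))) k x y 0≤k p)
        , ≤-from (trans (cong (λ z → k * (lo + z) - + W * x) (sym extent)) (id₂ (+ W * x) (+ W * y) k lo (u j₀)))
            (halfplane -1ℤ 0ℤ (u j₀) (λ i → subst (0ℤ ≤_) (id₄ (u i) (v i) (u j₀)) (diff (greatest i))) k x y 0≤k p)
        where
        0≤k = ≤-trans (+≤+ ℕ.z≤n) 1≤k
        id₁ : ∀ x y k l → x - k * l ≡ 1ℤ * x + 0ℤ * y + k * - l
        id₁ = solve-∀
        id₂ : ∀ x y k l h → k * (l + (h - l)) - x ≡ -1ℤ * x + 0ℤ * y + k * h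
        id₂ = solve-∀
        id₃ : ∀ a b l → a - l ≡ 1ℤ * a + 0ℤ * b + - l
        id₃ = solve-∀
        id₄ : ∀ a b h → h - a ≡ -1ℤ * a + 0ℤ * b + h
        id₄ = solve-∀
      slice : ∀ s k x y → s ℕ.< n → 1ℤ ≤ k → k * (lo + + s) ≤ + W * x → + W * x ≤ k * (lo + + suc s) →
        InP k x y ⇔ (+ (E ℕ.* W) * y ≤ g s * + W * x + k * d s × - (+ (E ℕ.* W) * y) ≤ g' s * + W * x + k * d' s)
      slice s k x y s<n 1≤k left right = mk⇔ to from
        where
        t b : ℤ
        t = g s * + W * x + k * d s
        b = g' s * + W * x + k * d' s
        open S s s<n
        open Column k (+ W * x) t b (line (g s) x (k * d s)) (line (g' s) x (k * d' s)) 1≤k left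
            (subst (λ z → + W * x ≤ k * z) (next s) right)
        id₁ : ∀ g E X Y k d → g * X + k * d - E * Y ≡ g * X + - E * Y + k * d
        id₁ = solve-∀
        id₂ : ∀ g E X Y k d → g * X + k * d - - (E * Y) ≡ g * X + E * Y + k * d
        id₂ = solve-∀
        below : InP k x y → + E * (+ W * y) ≤ g s * (+ W * x) + k * d s
        below p = ≤-from (id₁ (g s) (+ E) (+ W * x) (+ W * y) k (d s))
            (halfplane (g s) (- + E) (d s) below-top k x y 0≤k p)
        above : InP k x y → - (+ E * (+ W * y)) ≤ g' s * (+ W * x) + k * d' s
        above p = ≤-from (id₂ (g' s) (+ E) (+ W * x) (+ W * y) k (d' s))
            (halfplane (g' s) (+ E) (d' s) above-bottom k x y 0≤k p)
        to : InP k x y → + (E ℕ.* W) * y ≤ t × - (+ (E ℕ.* W) * y) ≤ b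
        to p = subst₂ _≤_ (EW y) (sym (line (g s) x (k * d s))) (below p)
             , subst₂ _≤_ (cong -_ (EW y)) (sym (line (g' s) x (k * d' s))) (above p)
        from : + (E ℕ.* W) * y ≤ t × - (+ (E ℕ.* W) * y) ≤ b → InP k x y
        from (p , q) = let (τ , 1≤τ , c) = between C vertex combine (+ W * y) (subst (_≤ t) (sym (EW y)) p) (subst (_≤ b) (cong -_ (sym (EW y))) q)
                       in cone⇒InP τ k x y 1≤τ 1≤k c
      thick : ∀ s k x → s ℕ.< n → 1ℤ ≤ k → k * (lo + + s) ≤ + W * x → + W * x ≤ k * (lo + + suc s) →
        0ℤ ≤ g s * + W * x + k * d s + (g' s * + W * x + k * d' s)
      thick s k x s<n 1≤k left right = S.Column.thickness s s<n k (+ W * x) (g s * + W * x + k * d s)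
          (g' s * + W * x + k * d' s)
        (line (g s) x (k * d s)) (line (g' s) x (k * d' s)) 1≤k left (subst (λ z → + W * x ≤ k * z) (next s) right)

  -- Comparison of coefficients

  -- A quasi-polynomial is a polynomial only along an arithmetic progression, so coefficients are
  -- compared at arbitrarily large arguments rather than at all large ones.
  Frequently : (ℕ → Set) → Set
  Frequently P = ∀ n → ∃[ x ] (n ℕ.≤ x × P x)

  private
    0≤∣i∣-i : ∀ i → 0ℤ ≤ + ∣ i ∣ - i
    0≤∣i∣-i (+ n)    = ≤-reflexive (sym (+-inverseʳ (+ n)))
    0≤∣i∣-i -[1+ n ] = +≤+ ℕ.z≤n

  linear-nonneg : ∀ a b → Frequently (λ x → 0ℤ ≤ a * + x + b) → 0ℤ ≤ a
  linear-nonneg a b often with 0ℤ ≤? a | often (suc ∣ b ∣)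
  ... | yes p | _ = p
  ... | no ¬p | x , b<x , 0≤ax+b = absurd (id₁ a b (+ x) (+ ∣ b ∣))
      (0≤ax+b ⊕ (nonneg x ⊗ diff< (≰⇒> ¬p) ⊕ 0≤∣i∣-i b ⊕ diff (+≤+ b<x)))
    where
    id₁ : ∀ a b x c → a * x + b + (x * (0ℤ - a - 1ℤ) + (c - b) + (x - (1ℤ + c))) ≡ -1ℤ
    id₁ = solve-∀

  -- For x ≥ 1 the constant is at most ∣c∣ x; then a factor x cancels and the linear case applies.
  quadratic-nonneg : ∀ a b c → Frequently (λ x → 0ℤ ≤ a * (+ x * + x) + b * + x + c) → 0ℤ ≤ a
  quadratic-nonneg a b c often = linear-nonneg a (b + + ∣ c ∣) λ n → let (x , n<x , h) = often (suc n) in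
      x , ℕP.<⇒≤ n<x , reduce x (ℕP.≤-trans (ℕ.s≤s ℕ.z≤n) n<x) h
    where
    id₁ : ∀ a b c x d → a * (x * x) + b * x + c + (d * (x - 1ℤ) + (d - c)) ≡ x * (a * x + (b + d))
    id₁ = solve-∀
    reduce : ∀ x → 1 ℕ.≤ x → 0ℤ ≤ a * (+ x * + x) + b * + x + c → 0ℤ ≤ a * + x + (b + + ∣ c ∣)
    reduce x 1≤x h = *-cancelˡ-≤-pos 0ℤ _ (+ x) {{positive (+<+ 1≤x)}}
      (subst₂ _≤_ (sym (*-zeroʳ (+ x))) (id₁ a b c (+ x) (+ ∣ c ∣)) (h ⊕ (nonneg ∣ c ∣ ⊗ diff (+≤+ 1≤x) ⊕ 0≤∣i∣-i c)))

  quadratic-nonneg₁ : ∀ a b c → a ≡ 0ℤ → Frequently (λ x → 0ℤ ≤ a * (+ x * + x) + b * + x + c) → 0ℤ ≤ b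
  quadratic-nonneg₁ _ b c refl often = linear-nonneg b c λ n → let (x , n≤x , h) = often n in
      x , n≤x , subst (0ℤ ≤_) (id₁ b c (+ x)) h
    where
    id₁ : ∀ b c x → 0ℤ * (x * x) + b * x + c ≡ b * x + c
    id₁ = solve-∀

  -- Along a sequence where the quadratic z satisfies D N(x) = z₀ + z₁x + z₂x² and
  -- K N(x) = A (βx)² + O(x), the leading coefficients match, so the bounds on the
  -- error term become bounds on K z₁.
  module Compare (D K A c C β z₀ z₁ z₂ : ℤ) (0≤D : 0ℤ ≤ D) where

    Value : ℕ → ℤ → Set
    Value x N = D * N ≡ z₀ + z₁ * + x + z₂ * (+ x * + x)

    Upper Lower Sharp : ℕ → ℤ → Set
    Upper x N = 0ℤ ≤ c * (β * + x) + C - (K * N - A * (β * + x * (β * + x)))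
    Lower x N = 0ℤ ≤ c * (β * + x) + C + (K * N - A * (β * + x * (β * + x)))
    Sharp x N = 0ℤ ≤ K * N - A * (β * + x * (β * + x)) + C - c * (β * + x)

    private
      upper : ∀ {x N} → Value x N → Upper x N → 0ℤ ≤ (D * A * (β * β) - K * z₂) * (+ x * + x) +
          (D * c * β - K * z₁) * + x + (D * C - K * z₀)
      upper {x} {N} v h = subst (0ℤ ≤_) (trans (id₁ D K A c C β N (+ x))
          (trans (cong (λ z → D * (c * (β * + x) + C + A * (β * + x * (β * + x))) - K * z) v)
          (id₂ D K A c C β z₀ z₁ z₂ (+ x)))) (0≤D ⊗ h)
        where
        id₁ : ∀ D K A c C β N x → D * (c * (β * x) + C - (K * N - A * (β * x * (β * x))))
            ≡ D * (c * (β * x) + C + A * (β * x * (β * x))) - K * (D * N)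
        id₁ = solve-∀
        id₂ : ∀ D K A c C β z₀ z₁ z₂ x → D * (c * (β * x) + C + A * (β * x * (β * x))) - K *
            (z₀ + z₁ * x + z₂ * (x * x)) ≡
          (D * A * (β * β) - K * z₂) * (x * x) + (D * c * β - K * z₁) * x + (D * C - K * z₀)
        id₂ = solve-∀

      lower : ∀ {x N} → Value x N → Lower x N → 0ℤ ≤ (K * z₂ - D * A * (β * β)) * (+ x * + x) +
          (D * c * β + K * z₁) * + x + (D * C + K * z₀)
      lower {x} {N} v h = subst (0ℤ ≤_) (trans (id₁ D K A c C β N (+ x))
          (trans (cong (λ z → D * (c * (β * + x) + C - A * (β * + x * (β * + x))) + K * z) v)
          (id₂ D K A c C β z₀ z₁ z₂ (+ x)))) (0≤D ⊗ h)
        where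
        id₁ : ∀ D K A c C β N x → D * (c * (β * x) + C + (K * N - A * (β * x * (β * x))))
            ≡ D * (c * (β * x) + C - A * (β * x * (β * x))) + K * (D * N)
        id₁ = solve-∀
        id₂ : ∀ D K A c C β z₀ z₁ z₂ x → D * (c * (β * x) + C - A * (β * x * (β * x))) + K *
            (z₀ + z₁ * x + z₂ * (x * x)) ≡
          (K * z₂ - D * A * (β * β)) * (x * x) + (D * c * β + K * z₁) * x + (D * C + K * z₀)
        id₂ = solve-∀

      sharp : ∀ {x N} → Value x N → Sharp x N → 0ℤ ≤ (K * z₂ - D * A * (β * β)) * (+ x * + x) +
          (K * z₁ - D * c * β) * + x + (D * C + K * z₀)
      sharp {x} {N} v h = subst (0ℤ ≤_) (trans (id₁ D K A c C β N (+ x))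
          (trans (cong (λ z → D * (C - A * (β * + x * (β * + x)) - c * (β * + x)) + K * z) v)
          (id₂ D K A c C β z₀ z₁ z₂ (+ x)))) (0≤D ⊗ h)
        where
        id₁ : ∀ D K A c C β N x → D * (K * N - A * (β * x * (β * x)) + C - c * (β * x))
            ≡ D * (C - A * (β * x * (β * x)) - c * (β * x)) + K * (D * N)
        id₁ = solve-∀
        id₂ : ∀ D K A c C β z₀ z₁ z₂ x → D * (C - A * (β * x * (β * x)) - c * (β * x)) + K *
            (z₀ + z₁ * x + z₂ * (x * x)) ≡
          (K * z₂ - D * A * (β * β)) * (x * x) + (K * z₁ - D * c * β) * x + (D * C + K * z₀)
        id₂ = solve-∀

      map-often : ∀ {P Q : ℕ → Set} → (∀ x → P x → Q x) → Frequently P → Frequently Q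
      map-often f often n = let (x , n≤x , p) = often n in x , n≤x , f x p

    module _ (often : Frequently (λ x → ∃[ N ] (Value x N × Upper x N × Lower x N))) where

      private
        up = map-often (λ x (N , v , u , l) → upper {x} {N} v u) often
        low = map-often (λ x (N , v , u , l) → lower {x} {N} v l) often

      leading : K * z₂ ≡ D * A * (β * β)
      leading = ≤-antisym (0≤i-j⇒j≤i (quadratic-nonneg (D * A * (β * β) - K * z₂) (D * c * β - K * z₁)
          (D * C - K * z₀) up)) (0≤i-j⇒j≤i (quadratic-nonneg (K * z₂ - D * A * (β * β)) (D * c * β + K * z₁)
          (D * C + K * z₀) low))

      linear-≤ : K * z₁ ≤ D * c * β
      linear-≤ = 0≤i-j⇒j≤i (quadratic-nonneg₁ (D * A * (β * β) - K * z₂) (D * c * β - K * z₁) (D * C - K * z₀)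
          (trans (cong (λ z → D * A * (β * β) - z) leading) (+-inverseʳ (D * A * (β * β)))) up)

      linear-≥ : - (K * z₁) ≤ D * c * β
      linear-≥ = ≤-from (id₁ (K * z₁) (D * c * β)) (quadratic-nonneg₁ (K * z₂ - D * A * (β * β))
          (D * c * β + K * z₁) (D * C + K * z₀) (trans (cong (λ z → z - D * A * (β * β)) leading)
          (+-inverseʳ (D * A * (β * β)))) low)
        where
        id₁ : ∀ x y → y - - x ≡ y + x
        id₁ = solve-∀

    linear-sharp : Frequently (λ x → ∃[ N ] (Value x N × Upper x N × Lower x N × Sharp x N)) → D * c * β ≤ K * z₁
    linear-sharp often = 0≤i-j⇒j≤i (quadratic-nonneg₁ (K * z₂ - D * A * (β * β)) (K * z₁ - D * c * β) (D * C + K * z₀)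
      (trans (cong (λ z → z - D * A * (β * β))
          (leading (map-often (λ x (N , v , u , l , _) → N , v , u , l) often))) (+-inverseʳ (D * A * (β * β))))
      (map-often (λ x (N , v , _ , _ , s) → sharp {x} {N} v s) often))

  -- With z / D = `G₁ a` and z' / D' = `H₁ 0`, the same slope c bounds the first from above and,
  -- times b, the second from below. Eliminating c leaves b · `G₁ a` ≤ `H₁ 0`.
  compare-slopes : ∀ {K D D' c b z z'} → 1ℤ ≤ K → 0ℤ ≤ D → 0ℤ ≤ D' → 0ℤ ≤ b →
    K * z ≤ D * c * 1ℤ → D' * c * b ≤ K * z' → D' * b * z ≤ D * z'
  compare-slopes {K} {D} {D'} {c} {b} {z} {z'} 1≤K 0≤D 0≤D' 0≤b h h' =
    *-cancelˡ-≤-pos (D' * b * z) (D * z') K {{positive (<-≤-trans (+<+ (ℕ.s≤s ℕ.z≤n)) 1≤K)}}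
      (≤-from (id₁ K D D' c b z z') (0≤D' ⊗ 0≤b ⊗ diff h ⊕ 0≤D ⊗ diff h'))
    where
    id₁ : ∀ K D D' c b z z' → K * (D * z') - K * (D' * b * z) ≡ D' * b * (D * c * 1ℤ - K * z) + D *
        (K * z' - D' * c * b)
    id₁ = solve-∀

open Integral
open import Data.Rational using (ℚ; mkℚ; 0ℚ; 1ℚ; _+_; _*_; _-_; -_; _≤_; _<_; _/_; ∣_∣; toℚᵘ; Positive; positive; nonNegative; 1/_)
open import Data.Rational.Properties
open import Data.Rational.Unnormalised as ℚᵘ using (mkℚᵘ; *≡*; *≤*)
import Data.Rational.Unnormalised.Properties as ℚᵘP
open import Data.Rational.Solver using (module +-*-Solver)

-- The embedding of the integers into the rationals

ι-toℚᵘ : ∀ z → toℚᵘ (ι z) ℚᵘ.≃ mkℚᵘ z 0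
ι-toℚᵘ z = toℚᵘ-fromℚᵘ (mkℚᵘ z 0)

-- Unnormalised fractions bypass the reduction to lowest terms, which leaves an identity of
-- integers.
ι-+ : ∀ a b → ι (a ℤ.+ b) ≡ ι a + ι b
ι-+ a b = toℚᵘ-injective (ℚᵘP.≃-trans (ι-toℚᵘ (a ℤ.+ b)) (ℚᵘP.≃-trans (*≡* (id₁ a b))
  (ℚᵘP.≃-sym (ℚᵘP.≃-trans (toℚᵘ-homo-+ (ι a) (ι b)) (ℚᵘP.+-cong (ι-toℚᵘ a) (ι-toℚᵘ b))))))
  where
  id₁ : ∀ a b → (a ℤ.+ b) ℤ.* 1ℤ ≡ (a ℤ.* 1ℤ ℤ.+ b ℤ.* 1ℤ) ℤ.* 1ℤ
  id₁ = solve-∀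

ι-* : ∀ a b → ι (a ℤ.* b) ≡ ι a * ι b
ι-* a b = toℚᵘ-injective (ℚᵘP.≃-trans (ι-toℚᵘ (a ℤ.* b)) (ℚᵘP.≃-sym
  (ℚᵘP.≃-trans (toℚᵘ-homo-* (ι a) (ι b)) (ℚᵘP.*-cong (ι-toℚᵘ a) (ι-toℚᵘ b)))))

ι-neg : ∀ a → ι (ℤ.- a) ≡ - ι a
ι-neg a = toℚᵘ-injective (ℚᵘP.≃-trans (ι-toℚᵘ (ℤ.- a)) (ℚᵘP.≃-sym
  (ℚᵘP.≃-trans (toℚᵘ-homo‿- (ι a)) (ℚᵘP.-‿cong (ι-toℚᵘ a)))))

ι-mono : ∀ {a b} → a ℤ.≤ b → ι a ≤ ι b
ι-mono {a} {b} h = toℚᵘ-cancel-≤ (ℚᵘP.≤-respˡ-≃ (ℚᵘP.≃-sym (ι-toℚᵘ a)) (ℚᵘP.≤-respʳ-≃ (ℚᵘP.≃-sym (ι-toℚᵘ b))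
  (*≤* (subst₂ ℤ._≤_ (sym (ℤP.*-identityʳ a)) (sym (ℤP.*-identityʳ b)) h))))

ι-cancel : ∀ {a b} → ι a ≤ ι b → a ℤ.≤ b
ι-cancel {a} {b} h with ℚᵘP.≤-respˡ-≃ (ι-toℚᵘ a) (ℚᵘP.≤-respʳ-≃ (ι-toℚᵘ b) (toℚᵘ-mono-≤ h))
... | *≤* h' = subst₂ ℤ._≤_ (ℤP.*-identityʳ a) (ℤP.*-identityʳ b) h'

infixl 6 _⊕ℚ_
infixl 7 _⊗ℚ_

_⊕ℚ_ : ∀ {x y} → 0ℚ ≤ x → 0ℚ ≤ y → 0ℚ ≤ x + y
p ⊕ℚ q = +-mono-≤ p q

_⊗ℚ_ : ∀ {x y} → 0ℚ ≤ x → 0ℚ ≤ y → 0ℚ ≤ x * y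
_⊗ℚ_ {x} {y} p q = subst (_≤ x * y) (*-zeroʳ x) (*-monoˡ-≤-nonNeg x {{nonNegative p}} q)

reciprocal : ∀ z → 1ℤ ℤ.≤ z → ∃[ r ] (r * ι z ≡ 1ℚ × 0ℚ ≤ r)
reciprocal z 1≤z = 1/ ι z , *-inverseˡ (ι z) , <⇒≤ (positive⁻¹ (1/ ι z) {{1/pos⇒pos (ι z)}})
  where
  instance
    pos = positive (<-≤-trans {0ℚ} {1ℚ} (positive⁻¹ 1ℚ) (ι-mono 1≤z))
    nz = pos⇒nonZero (ι z)

ι-cancel-*≡ : ∀ z → 1ℤ ℤ.≤ z → ∀ {p q} → ι z * p ≡ ι z * q → p ≡ q
ι-cancel-*≡ z 1≤z {p} {q} e with reciprocal z 1≤z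
... | r , r-inv , _ = trans (sym (back p)) (trans (cong (r *_) e) (back q))
  where
  back : ∀ p → r * (ι z * p) ≡ p
  back p = trans (sym (*-assoc r (ι z) p)) (trans (cong (_* p) r-inv) (*-identityˡ p))

-- Weighted sums over the vertices and common denominators

sumFin-cong : ∀ {m} {f g : Fin m → ℚ} → (∀ i → f i ≡ g i) → sumFin f ≡ sumFin g
sumFin-cong {zero}  h = refl
sumFin-cong {suc m} h = cong₂ _+_ (h zero) (sumFin-cong λ i → h (suc i))

sumFin-+ : ∀ {m} (f g : Fin m → ℚ) → sumFin (λ i → f i + g i) ≡ sumFin f + sumFin g
sumFin-+ {zero}  f g = refl
sumFin-+ {suc m} f g = trans (cong (λ x → f zero + g zero + x) (sumFin-+ (λ i → f (suc i)) (λ i → g (suc i))))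
  (solve 4 (λ a b c d → (a :+ b) :+ (c :+ d) := (a :+ c) :+ (b :+ d)) refl (f zero) (g zero) _ _)
  where open +-*-Solver

sumFin-* : ∀ {m} c (f : Fin m → ℚ) → sumFin (λ i → c * f i) ≡ c * sumFin f
sumFin-* {zero}  c f = sym (*-zeroʳ c)
sumFin-* {suc m} c f = trans (cong (λ x → c * f zero + x) (sumFin-* c (λ i → f (suc i))))
    (sym (*-distribˡ-+ c (f zero) _))

sumFin-nonneg : ∀ {m} {f : Fin m → ℚ} → (∀ i → 0ℚ ≤ f i) → 0ℚ ≤ sumFin f
sumFin-nonneg {zero}  h = ≤-refl
sumFin-nonneg {suc m} h = h zero ⊕ℚ sumFin-nonneg (λ i → h (suc i))

indicator : ∀ {m} → Fin m → Fin m → ℤ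
indicator i j with i Fin.≟ j
... | yes _ = 1ℤ
... | no  _ = 0ℤ

0≤indicator : ∀ {m} (i j : Fin m) → 0ℤ ℤ.≤ indicator i j
0≤indicator i j with i Fin.≟ j
... | yes _ = +≤+ ℕ.z≤n
... | no  _ = +≤+ ℕ.z≤n

indicator-suc : ∀ {m} (i j : Fin m) → indicator (suc i) (suc j) ≡ indicator i j
indicator-suc i j with i Fin.≟ j
... | yes _ = refl
... | no  _ = refl

sumFin-zero : ∀ {m} (f : Fin m → ℚ) → sumFin (λ j → 0ℚ * f j) ≡ 0ℚ
sumFin-zero f = trans (sumFin-* 0ℚ f) (*-zeroˡ (sumFin f))

sumFin-indicator : ∀ {m} (i : Fin m) (f : Fin m → ℚ) → sumFin (λ j → ι (indicator i j) * f j) ≡ f i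
sumFin-indicator zero    f = trans (cong₂ _+_ (*-identityˡ (f zero)) (sumFin-zero (λ j → f (suc j))))
    (+-identityʳ (f zero))
sumFin-indicator (suc i) f = trans (cong₂ _+_ (*-zeroˡ (f zero))
  (trans (sumFin-cong λ j → cong (λ z → ι z * f (suc j)) (indicator-suc i j))
      (sumFin-indicator i (λ j → f (suc j))))) (+-identityˡ (f (suc i)))

ι-denominator : ∀ p → ∃[ D ] (1 ℕ.≤ D × (∃[ z ] ι (+ D) * p ≡ ι z))
ι-denominator p@(mkℚ n d-1 _) = suc d-1 , ℕ.s≤s ℕ.z≤n , n ,
  toℚᵘ-injective (ℚᵘP.≃-trans (toℚᵘ-homo-* (ι (+ suc d-1)) p)
    (ℚᵘP.≃-trans (ℚᵘP.*-cong (ι-toℚᵘ (+ suc d-1)) (ℚᵘP.≃-refl {toℚᵘ p}))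
      (ℚᵘP.≃-trans (*≡* (trans (id₁ (+ suc d-1) n) (cong (n ℤ.*_) (cong +_ (sym (ℕP.+-identityʳ (suc d-1)))))))
          (ℚᵘP.≃-sym (ι-toℚᵘ n)))))
  where
  id₁ : ∀ d n → d ℤ.* n ℤ.* 1ℤ ≡ n ℤ.* d
  id₁ = solve-∀

commonDenominator : ∀ {m} (f : Fin m → ℚ) → ∃[ D ] (1 ℕ.≤ D × (∀ i → ∃[ z ] ι (+ D) * f i ≡ ι z))
commonDenominator {zero}  f = 1 , ℕ.s≤s ℕ.z≤n , λ ()
commonDenominator {suc m} f with ι-denominator (f zero) | commonDenominator (λ i → f (suc i))
... | D₁ , 1≤D₁ , z₁ , e₁ | D₂ , 1≤D₂ , h = D₁ ℕ.* D₂ , ℕP.*-mono-≤ 1≤D₁ 1≤D₂ , λ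
    { zero    → z₁ ℤ.* + D₂ , trans (cong (_* f zero) split)
        (trans (solve 3 (λ a b x → a :* b :* x := a :* x :* b) refl (ι (+ D₁)) (ι (+ D₂)) (f zero))
                  (trans (cong (_* ι (+ D₂)) e₁) (sym (ι-* z₁ (+ D₂)))))
    ; (suc i) → + D₁ ℤ.* proj₁ (h i) , trans (cong (_* f (suc i)) split)
        (trans (*-assoc (ι (+ D₁)) (ι (+ D₂)) (f (suc i)))
                  (trans (cong (ι (+ D₁) *_) (proj₂ (h i))) (sym (ι-* (+ D₁) (proj₁ (h i))))))
    }
  where
  open +-*-Solver
  split : ι (+ (D₁ ℕ.* D₂)) ≡ ι (+ D₁) * ι (+ D₂)
  split = trans (cong ι (ℤP.pos-* D₁ D₂)) (ι-* (+ D₁) (+ D₂))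

-- Convex hulls in integral homogeneous coordinates

module IntegralVertices {m} (U : Fin m → Pt) (W : ℕ) (1≤W : 1ℤ ℤ.≤ + W) (u v : Fin m → ℤ)
  (u-eq : ∀ i → ι (+ W) * proj₁ (U i) ≡ ι (u i))
  (v-eq : ∀ i → ι (+ W) * proj₂ (U i) ≡ ι (v i)) where

  open +-*-Solver

  InP : ℤ → ℤ → ℤ → Set
  InP k x y = InConv (scale (ι k) U) (ι² (x , y))

  ι-linear : ∀ α β δ a b → ι (α ℤ.* a ℤ.+ β ℤ.* b ℤ.+ δ) ≡ ι α * ι a + ι β * ι b + ι δ
  ι-linear α β δ a b = trans (ι-+ (α ℤ.* a ℤ.+ β ℤ.* b) δ)
      (cong (_+ ι δ) (trans (ι-+ (α ℤ.* a) (β ℤ.* b)) (cong₂ _+_ (ι-* α a) (ι-* β b))))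

  halfplane : ∀ α β δ → (∀ i → 0ℤ ℤ.≤ α ℤ.* u i ℤ.+ β ℤ.* v i ℤ.+ δ) →
    ∀ k x y → 0ℤ ℤ.≤ k → InP k x y → 0ℤ ℤ.≤ α ℤ.* (+ W ℤ.* x) ℤ.+ β ℤ.* (+ W ℤ.* y) ℤ.+ k ℤ.* δ
  halfplane α β δ valid k x y 0≤k (w , (0≤w , sum-w) , sum-x , sum-y) =
    ι-cancel (subst (0ℚ ≤_) total (ι-mono 0≤k ⊗ℚ sumFin-nonneg (λ i → 0≤w i ⊗ℚ ι-mono (valid i))))
    where
    a b c : Fin m → ℚ
    a i = w i * (ι k * proj₁ (U i))
    b i = w i * (ι k * proj₂ (U i))
    c i = w i
    pointwise : ∀ i → ι k * (w i * ι (α ℤ.* u i ℤ.+ β ℤ.* v i ℤ.+ δ)) ≡ ι α * ι (+ W) * a i + ι β * ι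
        (+ W) * b i + ι k * ι δ * c i
    pointwise i = trans (cong (λ z → ι k * (w i * z)) (trans (ι-linear α β δ (u i) (v i))
        (cong₂ (λ p q → ι α * p + ι β * q + ι δ) (sym (u-eq i)) (sym (v-eq i)))))
      (solve 8 (λ K w α β δ W p q → K :* (w :* (α :* (W :* p) :+ β :* (W :* q) :+ δ)) :=
                  α :* W :* (w :* (K :* p)) :+ β :* W :* (w :* (K :* q)) :+ K :* δ :* w) refl
        (ι k) (w i) (ι α) (ι β) (ι δ) (ι (+ W)) (proj₁ (U i)) (proj₂ (U i)))
    total : ι k * sumFin (λ i → w i * ι (α ℤ.* u i ℤ.+ β ℤ.* v i ℤ.+ δ))
        ≡ ι (α ℤ.* (+ W ℤ.* x) ℤ.+ β ℤ.* (+ W ℤ.* y) ℤ.+ k ℤ.* δ)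
    total = begin
      ι k * sumFin (λ i → w i * ι (α ℤ.* u i ℤ.+ β ℤ.* v i ℤ.+ δ))
        ≡⟨ sumFin-* (ι k) (λ i → w i * ι (α ℤ.* u i ℤ.+ β ℤ.* v i ℤ.+ δ)) ⟨
      sumFin (λ i → ι k * (w i * ι (α ℤ.* u i ℤ.+ β ℤ.* v i ℤ.+ δ)))
        ≡⟨ sumFin-cong pointwise ⟩
      sumFin (λ i → ι α * ι (+ W) * a i + ι β * ι (+ W) * b i + ι k * ι δ * c i)
        ≡⟨ sumFin-+ (λ i → ι α * ι (+ W) * a i + ι β * ι (+ W) * b i) (λ i → ι k * ι δ * c i) ⟩
      sumFin (λ i → ι α * ι (+ W) * a i + ι β * ι (+ W) * b i) + sumFin (λ i → ι k * ι δ * c i)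
        ≡⟨ cong₂ _+_ (sumFin-+ (λ i → ι α * ι (+ W) * a i) (λ i → ι β * ι (+ W) * b i)) (sumFin-* (ι k * ι δ) c) ⟩
      sumFin (λ i → ι α * ι (+ W) * a i) + sumFin (λ i → ι β * ι (+ W) * b i) + ι k * ι δ * sumFin c
        ≡⟨ cong₂ (λ p q → p + q + ι k * ι δ * sumFin c) (sumFin-* (ι α * ι (+ W)) a) (sumFin-* (ι β * ι (+ W)) b) ⟩
      ι α * ι (+ W) * sumFin a + ι β * ι (+ W) * sumFin b + ι k * ι δ * sumFin c
        ≡⟨ cong₂ _+_ (cong₂ (λ p q → ι α * ι (+ W) * p + ι β * ι (+ W) * q) sum-x sum-y)
            (cong (λ s → ι k * ι δ * s) sum-w) ⟩
      ι α * ι (+ W) * ι x + ι β * ι (+ W) * ι y + ι k * ι δ * 1ℚ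
        ≡⟨ cong₂ _+_ (cong₂ _+_ (trans (*-assoc (ι α) (ι (+ W)) (ι x)) (cong (ι α *_) (sym (ι-* (+ W) x))))
                                (trans (*-assoc (ι β) (ι (+ W)) (ι y)) (cong (ι β *_) (sym (ι-* (+ W) y)))))
                     (trans (*-identityʳ (ι k * ι δ)) (sym (ι-* k δ))) ⟩
      ι α * ι (+ W ℤ.* x) + ι β * ι (+ W ℤ.* y) + ι (k ℤ.* δ)
        ≡⟨ ι-linear α β (k ℤ.* δ) (+ W ℤ.* x) (+ W ℤ.* y) ⟨
      ι (α ℤ.* (+ W ℤ.* x) ℤ.+ β ℤ.* (+ W ℤ.* y) ℤ.+ k ℤ.* δ) ∎
      where open ≡-Reasoning

  -- For N > 0 this says that (X / N , Y / N) lies in the hull of the points (u i , v i);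
  -- homogeneous coordinates avoid divisions.
  record Cone (X Y N : ℤ) : Set where
    field
      c : Fin m → ℤ
      0≤c : ∀ i → 0ℤ ℤ.≤ c i
      sum-N : sumFin (λ i → ι (c i) * 1ℚ) ≡ ι N
      sum-X : sumFin (λ i → ι (c i) * ι (u i)) ≡ ι X
      sum-Y : sumFin (λ i → ι (c i) * ι (v i)) ≡ ι Y

  open Cone

  cone-vertex : ∀ i → Cone (u i) (v i) 1ℤ
  cone-vertex i = record
    { c = indicator i ; 0≤c = 0≤indicator i
    ; sum-N = sumFin-indicator i (λ _ → 1ℚ)
    ; sum-X = sumFin-indicator i (λ j → ι (u j))
    ; sum-Y = sumFin-indicator i (λ j → ι (v j)) }

  -- The factor `1ℚ` in `sum-N` gives the three sums of a cone point one common form, so that a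
  -- single lemma handles all of them.
  combine : ∀ a b (c c' : Fin m → ℤ) (f : Fin m → ℚ) {S S'} → sumFin (λ i → ι (c i) * f i) ≡ ι S
      → sumFin (λ i → ι (c' i) * f i) ≡ ι S' →
    sumFin (λ i → ι (a ℤ.* c i ℤ.+ b ℤ.* c' i) * f i) ≡ ι (a ℤ.* S ℤ.+ b ℤ.* S')
  combine a b c c' f {S} {S'} e e' = begin
    sumFin (λ i → ι (a ℤ.* c i ℤ.+ b ℤ.* c' i) * f i)
      ≡⟨ sumFin-cong (λ i → trans (cong (_* f i) (ι-lin (c i) (c' i)))
           (solve 5 (λ a x b y f → (a :* x :+ b :* y) :* f := a :* (x :* f) :+ b :* (y :* f)) refl (ι a)
               (ι (c i)) (ι b) (ι (c' i)) (f i))) ⟩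
    sumFin (λ i → ι a * (ι (c i) * f i) + ι b * (ι (c' i) * f i))
      ≡⟨ sumFin-+ (λ i → ι a * (ι (c i) * f i)) (λ i → ι b * (ι (c' i) * f i)) ⟩
    sumFin (λ i → ι a * (ι (c i) * f i)) + sumFin (λ i → ι b * (ι (c' i) * f i))
      ≡⟨ cong₂ _+_ (trans (sumFin-* (ι a) (λ i → ι (c i) * f i)) (cong (ι a *_) e))
          (trans (sumFin-* (ι b) (λ i → ι (c' i) * f i)) (cong (ι b *_) e')) ⟩
    ι a * ι S + ι b * ι S'
      ≡⟨ ι-lin S S' ⟨
    ι (a ℤ.* S ℤ.+ b ℤ.* S') ∎
    where
    open ≡-Reasoning
    ι-lin : ∀ x y → ι (a ℤ.* x ℤ.+ b ℤ.* y) ≡ ι a * ι x + ι b * ι y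
    ι-lin x y = trans (ι-+ (a ℤ.* x) (b ℤ.* y)) (cong₂ _+_ (ι-* a x) (ι-* b y))

  cone-combine : ∀ {X Y N X' Y' N'} a b → 0ℤ ℤ.≤ a → 0ℤ ℤ.≤ b → Cone X Y N → Cone X' Y' N' →
    Cone (a ℤ.* X ℤ.+ b ℤ.* X') (a ℤ.* Y ℤ.+ b ℤ.* Y') (a ℤ.* N ℤ.+ b ℤ.* N')
  cone-combine a b 0≤a 0≤b C C' = record
    { c = λ i → a ℤ.* C .c i ℤ.+ b ℤ.* C' .c i
    ; 0≤c = λ i → (0≤a ⊗ C .0≤c i) ⊕ (0≤b ⊗ C' .0≤c i)
    ; sum-N = combine a b (C .c) (C' .c) (λ _ → 1ℚ) (C .sum-N) (C' .sum-N)
    ; sum-X = combine a b (C .c) (C' .c) (λ i → ι (u i)) (C .sum-X) (C' .sum-X)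
    ; sum-Y = combine a b (C .c) (C' .c) (λ i → ι (v i)) (C .sum-Y) (C' .sum-Y) }

  cone⇒InP : ∀ τ k x y → 1ℤ ℤ.≤ τ → 1ℤ ℤ.≤ k → Cone (τ ℤ.* (+ W ℤ.* x)) (τ ℤ.* (+ W ℤ.* y)) (τ ℤ.* k) → InP k x y
  cone⇒InP τ k x y 1≤τ 1≤k C with reciprocal (τ ℤ.* k) 1≤τk
    where
    1≤τk : 1ℤ ℤ.≤ τ ℤ.* k
    1≤τk = ≤-from (id₁ τ k) (diff 1≤τ ⊗ diff 1≤k ⊕ diff 1≤τ ⊕ diff 1≤k)
      where
      id₁ : ∀ τ k → τ ℤ.* k ℤ.- 1ℤ ≡ (τ ℤ.- 1ℤ) ℤ.* (k ℤ.- 1ℤ) ℤ.+ (τ ℤ.- 1ℤ) ℤ.+ (k ℤ.- 1ℤ)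
      id₁ = solve-∀
  ... | r , r-inv , 0≤r = w , ((λ i → 0≤r ⊗ℚ ι-mono (C .0≤c i)) , sum-w)
        , coordinate x proj₁ u u-eq (C .sum-X) , coordinate y proj₂ v v-eq (C .sum-Y)
    where
    -- The total weight is τ k. Dividing by it normalises the weights, and its factor k cancels the
    -- dilation of the vertices.
    w : Fin m → ℚ
    w i = r * ι (C .c i)
    sum-w : sumFin w ≡ 1ℚ
    sum-w = trans (sumFin-cong λ i → cong (r *_) (sym (*-identityʳ (ι (C .c i)))))
              (trans (sumFin-* r (λ i → ι (C .c i) * 1ℚ)) (trans (cong (r *_) (C .sum-N)) r-inv))
    coordinate : ∀ z (pr : Pt → ℚ) (t : Fin m → ℤ) → (∀ i → ι (+ W) * pr (U i) ≡ ι (t i)) →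
      sumFin (λ i → ι (C .c i) * ι (t i)) ≡ ι (τ ℤ.* (+ W ℤ.* z)) → sumFin (λ i → w i * (ι k * pr (U i))) ≡ ι z
    coordinate z pr t t-eq sum-t = ι-cancel-*≡ (+ W) 1≤W (begin
      ι (+ W) * sumFin (λ i → w i * (ι k * pr (U i)))
        ≡⟨ sumFin-* (ι (+ W)) (λ i → w i * (ι k * pr (U i))) ⟨
      sumFin (λ i → ι (+ W) * (w i * (ι k * pr (U i))))
        ≡⟨ sumFin-cong (λ i → trans (solve 5 (λ W r c K p → W :* ((r :* c) :* (K :* p)) := (r :* K) :*
            (c :* (W :* p))) refl (ι (+ W)) r (ι (C .c i)) (ι k) (pr (U i)))
             (cong (λ p → r * ι k * (ι (C .c i) * p)) (t-eq i))) ⟩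
      sumFin (λ i → r * ι k * (ι (C .c i) * ι (t i)))
        ≡⟨ sumFin-* (r * ι k) (λ i → ι (C .c i) * ι (t i)) ⟩
      r * ι k * sumFin (λ i → ι (C .c i) * ι (t i))
        ≡⟨ cong (λ s → r * ι k * s) (trans sum-t (trans (ι-* τ (+ W ℤ.* z)) (cong (ι τ *_) (ι-* (+ W) z)))) ⟩
      r * ι k * (ι τ * (ι (+ W) * ι z))
        ≡⟨ solve 5 (λ r K τ W z → r :* K :* (τ :* (W :* z)) := r :* (τ :* K) :* (W :* z)) refl r (ι k) (ι τ)
            (ι (+ W)) (ι z) ⟩
      r * (ι τ * ι k) * (ι (+ W) * ι z)
        ≡⟨ cong (_* (ι (+ W) * ι z)) (trans (cong (r *_) (sym (ι-* τ k))) r-inv) ⟩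
      1ℚ * (ι (+ W) * ι z)
        ≡⟨ *-identityˡ (ι (+ W) * ι z) ⟩
      ι (+ W) * ι z ∎)
      where open ≡-Reasoning

-- Lattice points in the dilates of a rational polygon

record CountBounds {m} (U : Fin m → Pt) : Set where
  field
    W M : ℕ
    K A c C : ℤ
    1≤M : 1 ℕ.≤ M
    1≤K : 1ℤ ℤ.≤ K
    bounds : ∀ k N → W ℕ.≤ k → LatticeCount (scale (ℕtoℚ k) U) N →
      (0ℤ ℤ.≤ c ℤ.* + k ℤ.+ C ℤ.- (K ℤ.* + N ℤ.- A ℤ.* (+ k ℤ.* + k))) ×
      (0ℤ ℤ.≤ c ℤ.* + k ℤ.+ C ℤ.+ (K ℤ.* + N ℤ.- A ℤ.* (+ k ℤ.* + k)))
    sharp : ∀ k N → W ℕ.≤ k → LatticeCount (scale (ℕtoℚ k) U) N → ∃[ q ] + k ≡ q ℤ.* + M →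
      0ℤ ℤ.≤ K ℤ.* + N ℤ.- A ℤ.* (+ k ℤ.* + k) ℤ.+ C ℤ.- c ℤ.* + k

positive-suc : ∀ {z} → 1ℤ ℤ.≤ z → ∃[ n ] z ≡ + suc n
positive-suc (+≤+ (ℕ.s≤s {n = n} _)) = n , refl

argmax : ∀ {m} (f : Fin m → ℤ) → Fin m → ∃[ i ] (∀ j → f j ℤ.≤ f i)
argmax {m} f i₀ = let (i , _ , _ , max) = maximum {Q = λ _ → ⊤} (λ _ → yes tt) f (allFin m) i₀ tt in
  i , λ j → max j (∈-allFin j) tt

-- Two different abscissae give a positive width, hence at least one slice. The constants depend on
-- `U` alone, so both coefficient comparisons can share them.
countBounds : ∀ {m} (U : Fin m → Pt) i j → proj₁ (U i) ≢ proj₁ (U j) → CountBounds U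
countBounds {m} U i j xᵢ≢xⱼ with commonDenominator (λ l → proj₁ (U l)) | commonDenominator (λ l → proj₂ (U l))
... | D₁ , 1≤D₁ , X | D₂ , 1≤D₂ , Y = record
  { W = W ; M = E ℕ.* W ; K = K ; A = A ; c = slope ; C = offset
  ; 1≤M = ℕP.*-mono-≤ (ℕP.1≤n! (suc n')) 1≤W ; 1≤K = 1≤K
  ; bounds = λ k N W≤k count → subst (λ l → 0ℤ ℤ.≤ slope ℤ.* + k ℤ.+ offset ℤ.-
      (K ℤ.* + l ℤ.- A ℤ.* (+ k ℤ.* + k))) (proj₁ (proj₂ (proj₂ count))) (upper (config k N W≤k count))
                             , subst (λ l → 0ℤ ℤ.≤ slope ℤ.* + k ℤ.+ offset ℤ.+
                                 (K ℤ.* + l ℤ.- A ℤ.* (+ k ℤ.* + k))) (proj₁ (proj₂ (proj₂ count)))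
                                 (lower (config k N W≤k count))
  ; sharp = λ k N W≤k count d → subst (λ l → 0ℤ ℤ.≤ K ℤ.* + l ℤ.- A ℤ.*
      (+ k ℤ.* + k) ℤ.+ offset ℤ.- slope ℤ.* + k) (proj₁ (proj₂ (proj₂ count))) (sharp (config k N W≤k count) d)
  }
  where
  W : ℕ
  W = D₁ ℕ.* D₂
  1≤W : 1 ℕ.≤ W
  1≤W = ℕP.*-mono-≤ 1≤D₁ 1≤D₂
  u v : Fin m → ℤ
  u l = + D₂ ℤ.* proj₁ (X l)
  v l = + D₁ ℤ.* proj₁ (Y l)
  ι-W : ι (+ W) ≡ ι (+ D₁) * ι (+ D₂)
  ι-W = trans (cong ι (ℤP.pos-* D₁ D₂)) (ι-* (+ D₁) (+ D₂))
  open +-*-Solver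
  u-eq : ∀ l → ι (+ W) * proj₁ (U l) ≡ ι (u l)
  u-eq l = trans (cong (_* proj₁ (U l)) ι-W) (trans (solve 3 (λ a b x → a :* b :* x := b :* (a :* x)) refl
      (ι (+ D₁)) (ι (+ D₂)) (proj₁ (U l)))
             (trans (cong (ι (+ D₂) *_) (proj₂ (X l))) (sym (ι-* (+ D₂) (proj₁ (X l))))))
  v-eq : ∀ l → ι (+ W) * proj₂ (U l) ≡ ι (v l)
  v-eq l = trans (cong (_* proj₂ (U l)) ι-W) (trans (*-assoc (ι (+ D₁)) (ι (+ D₂)) (proj₂ (U l)))
             (trans (cong (ι (+ D₁) *_) (proj₂ (Y l))) (sym (ι-* (+ D₁) (proj₁ (Y l))))))
  1ℤ≤W : 1ℤ ℤ.≤ + W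
  1ℤ≤W = +≤+ 1≤W
  uᵢ≢uⱼ : u i ≢ u j
  uᵢ≢uⱼ e = xᵢ≢xⱼ (ι-cancel-*≡ (+ W) 1ℤ≤W (trans (u-eq i) (trans (cong ι e) (sym (u-eq j)))))

  high = argmax u i
  low  = argmax (λ l → ℤ.- u l) i
  j₀ = proj₁ high
  i₀ = proj₁ low
  greatest : ∀ l → u l ℤ.≤ u j₀
  greatest = proj₂ high
  least : ∀ l → u i₀ ℤ.≤ u l
  least l = ℤP.neg-cancel-≤ (proj₂ low l)
  extent-pos : 1ℤ ℤ.≤ u j₀ ℤ.- u i₀
  extent-pos with 1ℤ ℤ.≤? u j₀ ℤ.- u i₀
  ... | yes p = p
  ... | no ¬p = ⊥-elim (uᵢ≢uⱼ (trans (collapse i) (sym (collapse j))))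
    where
    j₀≤i₀ : u j₀ ℤ.≤ u i₀
    j₀≤i₀ = ≤-from (id₁ (u j₀) (u i₀)) (diff< (ℤP.≰⇒> ¬p))
      where
      id₁ : ∀ a b → b ℤ.- a ≡ 1ℤ ℤ.- (a ℤ.- b) ℤ.- 1ℤ
      id₁ = solve-∀
    collapse : ∀ l → u l ≡ u i₀
    collapse l = ℤP.≤-antisym (ℤP.≤-trans (greatest l) j₀≤i₀) (least l)
  n' = proj₁ (positive-suc extent-pos)

  open IntegralVertices U W 1ℤ≤W u v u-eq v-eq
  open Slicing u v W (suc n') InP Cone cone-vertex cone-combine cone⇒InP halfplane i₀ j₀ least greatest
      (proj₂ (positive-suc extent-pos))
    using (E; sliced)
  instance
    W≢0 : ℕ.NonZero W
    W≢0 = ℕ.>-nonZero 1≤W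
    E≢0 : ℕ.NonZero E
    E≢0 = ℕ.>-nonZero (ℕP.1≤n! (suc n'))
    EW≢0 : ℕ.NonZero (E ℕ.* W)
    EW≢0 = ℕP.m*n≢0 E W
  open SlicedCount W E n' sliced using (Config; size; K; B; count-est)
  open Estimates B {Config} size using (Est)
  A = proj₁ count-est
  open Est (proj₂ count-est)

  1≤K : 1ℤ ℤ.≤ K
  1≤K = 1≤* (+ 2 ℤ.* + B ℤ.* + B) (+ W) (1≤* (+ 2 ℤ.* + B) (+ B) (1≤* (+ 2) (+ B) (+≤+ (ℕ.s≤s ℕ.z≤n)) 1≤B) 1≤B) 1ℤ≤W
    where
    1≤B : 1ℤ ℤ.≤ + B
    1≤B = +≤+ (ℕP.*-mono-≤ (ℕP.1≤n! (suc n')) 1≤W)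

  config : ∀ k N → W ℕ.≤ k → LatticeCount (scale (ℕtoℚ k) U) N → Config
  config k N W≤k (L , unique , _ , member) = record { k = k ; W≤k = W≤k ; L = L ; unique = unique ; member = λ x y → member (x , y) }

-- The quasi-polynomials of a polygon and of its b-th part

ι-injective : ∀ {a b} → ι a ≡ ι b → a ≡ b
ι-injective e = ℤP.≤-antisym (ι-cancel (≤-reflexive e)) (ι-cancel (≤-reflexive (sym e)))

unitFraction : ∀ b .{{_ : NonZero b}} → ι (+ b) * (+ 1 / b) ≡ 1ℚ
unitFraction zero = ⊥-elim (ℕP.n≮n 0 (ℕ.>-nonZero⁻¹ 0))
unitFraction (suc b) = toℚᵘ-injective (ℚᵘP.≃-trans (toℚᵘ-homo-* (ι (+ suc b)) (+ 1 / suc b))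
  (ℚᵘP.≃-trans (ℚᵘP.*-cong (ι-toℚᵘ (+ suc b)) (toℚᵘ-fromℚᵘ (mkℚᵘ (+ 1) b)))
    (*≡* (trans (id₁ (+ suc b)) (cong (λ n → 1ℤ ℤ.* + n) (sym (ℕP.+-identityʳ (suc b))))))))
  where
  id₁ : ∀ b → b ℤ.* + 1 ℤ.* 1ℤ ≡ 1ℤ ℤ.* b
  id₁ = solve-∀

periodic-multiple : ∀ {f : ℕ → ℚ} p → (∀ k → f (k ℕ.+ p) ≡ f k) → ∀ q k → f (k ℕ.+ q ℕ.* p) ≡ f k
periodic-multiple {f} p per zero    k = cong f (ℕP.+-identityʳ k)
periodic-multiple {f} p per (suc q) k = trans (cong f (sym (ℕP.+-assoc k p (q ℕ.* p))))
    (trans (periodic-multiple p per q (k ℕ.+ p)) (per k))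

inConv-cong : ∀ {m} {V V' : Fin m → Pt} → (∀ i → V i ≡ V' i) → ∀ {x} → InConv V x → InConv V' x
inConv-cong e (w , convex , sum-x , sum-y) = w , convex
  , trans (sumFin-cong λ i → cong (λ p → w i * proj₁ p) (sym (e i))) sum-x
  , trans (sumFin-cong λ i → cong (λ p → w i * proj₂ p) (sym (e i))) sum-y

latticeCount-cong : ∀ {m} {V V' : Fin m → Pt} {N} → (∀ i → V i ≡ V' i) → LatticeCount V N → LatticeCount V' N
latticeCount-cong {V = V} {V'} e (L , unique , len , member) = L , unique , len , λ z →
  mk⇔ (λ z∈ → inConv-cong {V = V} {V'} e (Equivalence.to (member z) z∈)) (λ p → Equivalence.from (member z)
      (inConv-cong {V = V'} {V} (λ i → sym (e i)) p))

notVertical : ∀ {m} (V : Fin m → Pt) → IsRationalPolygon V → ∃[ i ] ∃[ j ] proj₁ (V i) ≢ proj₁ (V j)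
notVertical V (_ , i , j , k , det≢0) with proj₁ (V j) ≟ proj₁ (V i) | proj₁ (V k) ≟ proj₁ (V i)
... | no j≢i  | _       = j , i , j≢i
... | yes _   | no k≢i  = k , i , k≢i
... | yes j≡i | yes k≡i = ⊥-elim (det≢0 (trans
    (cong₂ (λ p q → (p - proj₁ (V i)) * (proj₂ (V k) - proj₂ (V i)) - (proj₂ (V j) - proj₂ (V i)) *
        (q - proj₁ (V i))) j≡i k≡i)
    (solve 4 (λ x a b c → (x :- x) :* (c :- a) :- (b :- a) :* (x :- x) := con 0ℚ) refl (proj₁ (V i))
        (proj₂ (V i)) (proj₂ (V j)) (proj₂ (V k)))))
  where open +-*-Solver

clearDenominators : ∀ D {z₀ z₁ z₂ g₀ g₁ g₂} x N → ι (+ D) * g₀ ≡ ι z₀ → ι (+ D) * g₁ ≡ ι z₁ → ι (+ D) * g₂ ≡ ι z₂ →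
  ℕtoℚ N ≡ g₀ + g₁ * ℕtoℚ x + g₂ * (ℕtoℚ x * ℕtoℚ x) →
  + D ℤ.* + N ≡ z₀ ℤ.+ z₁ ℤ.* + x ℤ.+ z₂ ℤ.* (+ x ℤ.* + x)
clearDenominators D {z₀} {z₁} {z₂} {g₀} {g₁} {g₂} x N e₀ e₁ e₂ e = ι-injective (begin
  ι (+ D ℤ.* + N)
    ≡⟨ trans (ι-* (+ D) (+ N)) (cong (ι (+ D) *_) e) ⟩
  ι (+ D) * (g₀ + g₁ * ι (+ x) + g₂ * (ι (+ x) * ι (+ x)))
    ≡⟨ solve 5 (λ D a b c x → D :* (a :+ b :* x :+ c :* (x :* x)) := D :* a :+ D :* b :* x :+ D :* c :*
        (x :* x)) refl (ι (+ D)) g₀ g₁ g₂ (ι (+ x)) ⟩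
  ι (+ D) * g₀ + ι (+ D) * g₁ * ι (+ x) + ι (+ D) * g₂ * (ι (+ x) * ι (+ x))
    ≡⟨ cong₂ _+_ (cong₂ (λ a b → a + b * ι (+ x)) e₀ e₁) (cong (λ c → c * (ι (+ x) * ι (+ x))) e₂) ⟩
  ι z₀ + ι z₁ * ι (+ x) + ι z₂ * (ι (+ x) * ι (+ x))
    ≡⟨ cong₂ (λ a b → ι z₀ + a + b) (ι-* z₁ (+ x)) (trans (ι-* z₂ (+ x ℤ.* + x)) (cong (ι z₂ *_) (ι-* (+ x) (+ x)))) ⟨
  ι z₀ + ι (z₁ ℤ.* + x) + ι (z₂ ℤ.* (+ x ℤ.* + x))
    ≡⟨ trans (ι-+ (z₀ ℤ.+ z₁ ℤ.* + x) (z₂ ℤ.* (+ x ℤ.* + x))) (cong (_+ ι (z₂ ℤ.* (+ x ℤ.* + x)))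
        (ι-+ z₀ (z₁ ℤ.* + x))) ⟨
  ι (z₀ ℤ.+ z₁ ℤ.* + x ℤ.+ z₂ ℤ.* (+ x ℤ.* + x)) ∎)
  where
  open ≡-Reasoning
  open +-*-Solver

triple : ℚ → ℚ → ℚ → Fin 3 → ℚ
triple x y z zero             = x
triple x y z (suc zero)       = y
triple x y z (suc (suc zero)) = z

m≤[m+n]*p : ∀ m n {p} → 1 ℕ.≤ p → m ℕ.≤ (m ℕ.+ n) ℕ.* p
m≤[m+n]*p m n {suc p} _ = ℕP.≤-trans (ℕP.m≤m+n m n) (ℕP.m≤m*n (m ℕ.+ n) (suc p))

n≤[m+n]*p : ∀ m n {p} → 1 ℕ.≤ p → n ℕ.≤ (m ℕ.+ n) ℕ.* p
n≤[m+n]*p m n {suc p} _ = ℕP.≤-trans (ℕP.m≤n+m n m) (ℕP.m≤m*n (m ℕ.+ n) (suc p))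

module Comparison {m} (V : Fin m → Pt) (b : ℕ) .{{_ : NonZero b}} (B : CountBounds (scale (+ 1 / b) V)) where

  open CountBounds B

  U : Fin m → Pt
  U = scale (+ 1 / b) V

  1≤b : 1 ℕ.≤ b
  1≤b = ℕ.>-nonZero⁻¹ b

  -- Dilates of `V` are dilates of `U` by multiples of b, so one estimate governs both
  -- quasi-polynomials; this is the source of the factor b in the result.
  rescale : ∀ x i → scale (ℕtoℚ x) V i ≡ scale (ℕtoℚ (b ℕ.* x)) U i
  rescale x i = cong₂ _,_ (coordinate (proj₁ (V i))) (coordinate (proj₂ (V i)))
    where
    open +-*-Solver
    coordinate : ∀ p → ℕtoℚ x * p ≡ ℕtoℚ (b ℕ.* x) * ((+ 1 / b) * p)
    coordinate p = sym (trans (cong (_* ((+ 1 / b) * p)) (trans (cong ι (ℤP.pos-* b x)) (ι-* (+ b) (+ x))))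
      (trans (solve 4 (λ b x r p → b :* x :* (r :* p) := (b :* r) :* (x :* p)) refl (ι (+ b)) (ι (+ x)) (+ 1 / b) p)
        (trans (cong (_* (ι (+ x) * p)) (unitFraction b)) (*-identityˡ (ι (+ x) * p)))))

  module Dilates (a : ℕ) (G₀ G₁ G₂ : ℕ → ℚ) (quasi : IsEhrhartQuasiPoly U G₀ G₁ G₂) where
    p : ℕ
    p = proj₁ (proj₁ quasi)
    1≤p : 1 ℕ.≤ p
    1≤p = ℕ.>-nonZero⁻¹ p {{proj₁ (proj₂ (proj₁ quasi))}}
    periods = proj₂ (proj₂ (proj₁ quasi))
    denominator = commonDenominator (triple (G₀ a) (G₁ a) (G₂ a))
    D : ℕ
    D = proj₁ denominator
    1≤D : 1 ℕ.≤ D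
    1≤D = proj₁ (proj₂ denominator)
    z : Fin 3 → ℤ
    z i = proj₁ (proj₂ (proj₂ denominator) i)
    z₀ z₁ z₂ : ℤ
    z₀ = z zero
    z₁ = z (suc zero)
    z₂ = z (suc (suc zero))
    z₁-eq : ι (+ D) * G₁ a ≡ ι z₁
    z₁-eq = proj₂ (proj₂ (proj₂ denominator) (suc zero))

    open Compare (+ D) K A c C 1ℤ z₀ z₁ z₂ (nonneg D) public

    often : Frequently (λ x → ∃[ N ] (Value x N × Upper x N × Lower x N))
    often n = x , ℕP.≤-trans (m≤[m+n]*p n W 1≤p) (ℕP.m≤n+m _ a) , + N , value
            , subst (λ k → 0ℤ ℤ.≤ c ℤ.* k ℤ.+ C ℤ.- (K ℤ.* + N ℤ.- A ℤ.* (k ℤ.* k)))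
                (sym (ℤP.*-identityˡ (+ x))) (proj₁ (bounds x N W≤x count))
            , subst (λ k → 0ℤ ℤ.≤ c ℤ.* k ℤ.+ C ℤ.+ (K ℤ.* + N ℤ.- A ℤ.* (k ℤ.* k)))
                (sym (ℤP.*-identityˡ (+ x))) (proj₂ (bounds x N W≤x count))
      where
      x : ℕ
      -- Congruent to a modulo the period, at least n for `Frequently`, and at least W for the
      -- estimates.
      x = a ℕ.+ (n ℕ.+ W) ℕ.* p
      W≤x : W ℕ.≤ x
      W≤x = ℕP.≤-trans (n≤[m+n]*p n W 1≤p) (ℕP.m≤n+m _ a)
      N : ℕ
      N = proj₁ (proj₂ quasi x)
      count : LatticeCount (scale (ℕtoℚ x) U) N
      count = proj₁ (proj₂ (proj₂ quasi x))
      value : Value x (+ N)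
      value = clearDenominators D {z₀} {z₁} {z₂} x N
        (proj₂ (proj₂ (proj₂ denominator) zero)) z₁-eq (proj₂ (proj₂ (proj₂ denominator) (suc (suc zero))))
        (trans (proj₂ (proj₂ (proj₂ quasi x)))
          (cong₂ _+_ (cong₂ (λ g h → g + h * ℕtoℚ x) (periodic-multiple {G₀} p (proj₁ periods) (n ℕ.+ W) a)
              (periodic-multiple {G₁} p (proj₁ (proj₂ periods)) (n ℕ.+ W) a))
            (cong (_* (ℕtoℚ x * ℕtoℚ x)) (periodic-multiple {G₂} p (proj₂ (proj₂ periods)) (n ℕ.+ W) a))))

  module Origin (H₀ H₁ H₂ : ℕ → ℚ) (quasi : IsEhrhartQuasiPoly V H₀ H₁ H₂) where
    p : ℕ
    p = proj₁ (proj₁ quasi)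
    1≤p : 1 ℕ.≤ p
    1≤p = ℕ.>-nonZero⁻¹ p {{proj₁ (proj₂ (proj₁ quasi))}}
    periods = proj₂ (proj₂ (proj₁ quasi))
    denominator = commonDenominator (triple (H₀ 0) (H₁ 0) (H₂ 0))
    D : ℕ
    D = proj₁ denominator
    1≤D : 1 ℕ.≤ D
    1≤D = proj₁ (proj₂ denominator)
    z : Fin 3 → ℤ
    z i = proj₁ (proj₂ (proj₂ denominator) i)
    z₀ z₁ z₂ : ℤ
    z₀ = z zero
    z₁ = z (suc zero)
    z₂ = z (suc (suc zero))
    z₁-eq : ι (+ D) * H₁ 0 ≡ ι z₁
    z₁-eq = proj₂ (proj₂ (proj₂ denominator) (suc zero))

    open Compare (+ D) K A c C (+ b) z₀ z₁ z₂ (nonneg D) public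

    often : Frequently (λ x → ∃[ N ] (Value x N × Upper x N × Lower x N × Sharp x N))
    often n = x , m≤[m+n]*p n W 1≤M*p , + N , value
            , subst (λ k → 0ℤ ℤ.≤ c ℤ.* k ℤ.+ C ℤ.- (K ℤ.* + N ℤ.- A ℤ.* (k ℤ.* k))) (ℤP.pos-* b x)
                (proj₁ (bounds (b ℕ.* x) N W≤bx count))
            , subst (λ k → 0ℤ ℤ.≤ c ℤ.* k ℤ.+ C ℤ.+ (K ℤ.* + N ℤ.- A ℤ.* (k ℤ.* k))) (ℤP.pos-* b x)
                (proj₂ (bounds (b ℕ.* x) N W≤bx count))
            , subst (λ k → 0ℤ ℤ.≤ K ℤ.* + N ℤ.- A ℤ.* (k ℤ.* k) ℤ.+ C ℤ.- c ℤ.* k) (ℤP.pos-* b x)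
                (sharp (b ℕ.* x) N W≤bx count multiple)
      where
      x : ℕ
      -- A multiple of p, so that the coefficients are those at 0, and of M, so that `sharp` applies
      -- to b x.
      x = (n ℕ.+ W) ℕ.* (M ℕ.* p)
      1≤M*p : 1 ℕ.≤ M ℕ.* p
      1≤M*p = ℕP.*-mono-≤ 1≤M 1≤p
      W≤bx : W ℕ.≤ b ℕ.* x
      W≤bx = ℕP.≤-trans (n≤[m+n]*p n W 1≤M*p) (subst (ℕ._≤ b ℕ.* x) (ℕP.*-identityˡ x) (ℕP.*-monoˡ-≤ x 1≤b))
      N : ℕ
      N = proj₁ (proj₂ quasi x)
      count : LatticeCount (scale (ℕtoℚ (b ℕ.* x)) U) N
      count = latticeCount-cong {V = scale (ℕtoℚ x) V} {scale (ℕtoℚ (b ℕ.* x)) U} (rescale x)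
          (proj₁ (proj₂ (proj₂ quasi x)))
      multiple : ∃[ q ] + (b ℕ.* x) ≡ q ℤ.* + M
      multiple = + (b ℕ.* ((n ℕ.+ W) ℕ.* p)) , trans (cong +_ (id₁ b (n ℕ.+ W) M p))
          (ℤP.pos-* (b ℕ.* ((n ℕ.+ W) ℕ.* p)) M)
        where
        id₁ : ∀ b n M p → b ℕ.* (n ℕ.* (M ℕ.* p)) ≡ b ℕ.* (n ℕ.* p) ℕ.* M
        id₁ = ℕR.solve-∀
      at-origin : ∀ {f : ℕ → ℚ} → (∀ k → f (k ℕ.+ p) ≡ f k) → f x ≡ f 0
      at-origin {f} per = trans (cong f (sym (ℕP.*-assoc (n ℕ.+ W) M p))) (periodic-multiple {f} p per
          ((n ℕ.+ W) ℕ.* M) 0)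
      value : Value x (+ N)
      value = clearDenominators D {z₀} {z₁} {z₂} x N
        (proj₂ (proj₂ (proj₂ denominator) zero)) z₁-eq (proj₂ (proj₂ (proj₂ denominator) (suc (suc zero))))
        (trans (proj₂ (proj₂ (proj₂ quasi x)))
          (cong₂ _+_ (cong₂ (λ g h → g + h * ℕtoℚ x) (at-origin {H₀} (proj₁ periods))
              (at-origin {H₁} (proj₁ (proj₂ periods))))
            (cong (_* (ℕtoℚ x * ℕtoℚ x)) (at-origin {H₂} (proj₂ (proj₂ periods))))))

  slope-bound : ∀ a H₀ H₁ H₂ → IsEhrhartQuasiPoly V H₀ H₁ H₂ → ∀ G₀ G₁ G₂ → IsEhrhartQuasiPoly U G₀ G₁ G₂ →
    ∣ ℕtoℚ b * G₁ a ∣ ≤ H₁ 0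
  slope-bound a H₀ H₁ H₂ quasiH G₀ G₁ G₂ quasiG = absolute (∣p∣≡p∨∣p∣≡-p (ℕtoℚ b * G₁ a))
    where
    module G = Dilates a G₀ G₁ G₂ quasiG
    module H = Origin H₀ H₁ H₂ quasiH
    open +-*-Solver

    -- Both `G₁ a` and its negative are instances, which together give the absolute value.
    one-sided : ∀ g z → ι (+ G.D) * g ≡ ι z → K ℤ.* z ℤ.≤ + G.D ℤ.* c ℤ.* 1ℤ → ℕtoℚ b * g ≤ H₁ 0
    one-sided g z z-eq h = *-cancelˡ-≤-pos DD {{DD>0}} (subst₂ _≤_ (sym left) (sym right)
        (ι-mono (compare-slopes {K} {+ G.D} {+ H.D} {c} {+ b} {z} {H.z₁} 1≤K (nonneg G.D) (nonneg H.D)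
            (nonneg b) h (H.linear-sharp H.often))))
      where
      DD : ℚ
      DD = ι (+ H.D ℤ.* + G.D)
      DD>0 : Positive DD
      DD>0 = positive (<-≤-trans {0ℚ} {1ℚ} (positive⁻¹ 1ℚ) (ι-mono (1≤* (+ H.D) (+ G.D) (+≤+ H.1≤D) (+≤+ G.1≤D))))
      left : DD * (ι (+ b) * g) ≡ ι (+ H.D ℤ.* + b ℤ.* z)
      left = trans (cong (_* (ι (+ b) * g)) (ι-* (+ H.D) (+ G.D)))
        (trans (solve 4 (λ D' D b g → D' :* D :* (b :* g) := D' :* b :* (D :* g)) refl (ι (+ H.D)) (ι (+ G.D))
            (ι (+ b)) g)
          (trans (cong₂ _*_ (sym (ι-* (+ H.D) (+ b))) z-eq) (sym (ι-* (+ H.D ℤ.* + b) z))))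
      right : DD * H₁ 0 ≡ ι (+ G.D ℤ.* H.z₁)
      right = trans (cong (_* H₁ 0) (ι-* (+ H.D) (+ G.D)))
        (trans (solve 3 (λ D' D h → D' :* D :* h := D :* (D' :* h)) refl (ι (+ H.D)) (ι (+ G.D)) (H₁ 0))
          (trans (cong (ι (+ G.D) *_) H.z₁-eq) (sym (ι-* (+ G.D) H.z₁))))

    absolute : ∣ ℕtoℚ b * G₁ a ∣ ≡ ℕtoℚ b * G₁ a ⊎ ∣ ℕtoℚ b * G₁ a ∣ ≡ - (ℕtoℚ b * G₁ a) → ∣ ℕtoℚ b * G₁ a ∣ ≤ H₁ 0
    absolute (inj₁ e) = subst (_≤ H₁ 0) (sym e) (one-sided (G₁ a) G.z₁ G.z₁-eq (G.linear-≤ G.often))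
    absolute (inj₂ e) = subst (_≤ H₁ 0) (trans (sym (neg-distribʳ-* (ℕtoℚ b) (G₁ a))) (sym e))
      (one-sided (- G₁ a) (ℤ.- G.z₁)
        (trans (sym (neg-distribʳ-* (ι (+ G.D)) (G₁ a))) (trans (cong -_ G.z₁-eq) (sym (ι-neg G.z₁))))
        (subst (ℤ._≤ + G.D ℤ.* c ℤ.* 1ℤ) (ℤP.neg-distribʳ-* K G.z₁) (G.linear-≥ G.often)))

theorem1p8 : ∀ {m} (V : Fin m → Pt) → IsRationalPolygon V →
    ∀ (q : ℚ) → IsRationalDenominator V q →
    ∀ (a b : ℕ) .{{_ : NonZero b}} → (+ a / b) < q →
    ∀ (H₀ H₁ H₂ : ℕ → ℚ) → IsEhrhartQuasiPoly V H₀ H₁ H₂ →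
    ∀ (G₀ G₁ G₂ : ℕ → ℚ) → IsEhrhartQuasiPoly (scale (+ 1 / b) V) G₀ G₁ G₂ →
    ∣ ℕtoℚ b * G₁ a ∣ ≤ H₁ 0
theorem1p8 V polygon _ _ a b _ H₀ H₁ H₂ quasiH G₀ G₁ G₂ quasiG =
  Comparison.slope-bound V b (countBounds (scale (+ 1 / b) V) i j separated) a H₀ H₁ H₂ quasiH G₀ G₁ G₂ quasiG
  where
  i = proj₁ (notVertical V polygon)
  j = proj₁ (proj₂ (notVertical V polygon))
  undo : ∀ x → ι (+ b) * ((+ 1 / b) * x) ≡ x
  undo x = trans (sym (*-assoc (ι (+ b)) (+ 1 / b) x)) (trans (cong (_* x) (unitFraction b)) (*-identityˡ x))
  separated : (+ 1 / b) * proj₁ (V i) ≢ (+ 1 / b) * proj₁ (V j)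
  separated e = proj₂ (proj₂ (notVertical V polygon)) (trans (sym (undo (proj₁ (V i))))
      (trans (cong (ι (+ b) *_) e) (undo (proj₁ (V j)))))
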